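{- There exists $y_0>0$ such that for all $y>y_0$ and all $n\ge1$, \[ \mathbb{P}\left(\sup_{0\leq s\leq1}\hat W^{(n)}_s\,>\,(8/9)^{1/4}y\right)\;\leq\; e^{ -y}. \]
   Context: Let $U_n$ be uniform on the set of plane trees (rooted, children linearly ordered) with $n$ edges, with integer vertex labels such that adjacent labels differ by at most $1$ and the root has label $0$. The contour traversal of $U_n$ (depth-first traversal around the tree, one edge per unit of time, each edge crossed twice) visits vertices $v_0=\text{root},v_1,\dots,v_{2n}=\text{root}$. Let $V^{(n)}(t)$ be the label of $v_t$ and, for $0\le s\le1$, \[\hat W^{(n)}_s=\frac{V^{(n)}(\lfloor 2ns\rfloor)}{(8n/9)^{1/4}}.\] -}

module Defs where

open import Data.Bool.Base using (Bool; true)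
open import Data.Fin.Base using (Fin; zero; suc; toℕ)
open import Data.Fin.Properties using (toℕ<n)
open import Data.List.Base using (List; []; _∷_; _++_; length; lookup; map; concatMap; cartesianProduct; cartesianProductWith; upTo; filterᵇ)
open import Data.List.Properties using (length-++)
open import Data.List.Membership.Propositional using (_∈_; find; lose)
open import Data.List.Membership.Propositional.Properties
open import Data.List.Relation.Binary.Disjoint.Propositional using (Disjoint)
open import Data.List.Relation.Unary.All as All using (All; []; _∷_)
import Data.List.Relation.Unary.All.Properties as Allₚ
open import Data.List.Relation.Unary.AllPairs as AllPairs using ([]; _∷_)
import Data.List.Relation.Unary.AllPairs.Properties as AllPairsₚ
open import Data.List.Relation.Unary.Any using (here; there)
open import Data.List.Relation.Unary.Unique.Propositional using (Unique)
import Data.List.Relation.Unary.Unique.Propositional.Properties as Unique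
open import Data.Nat.Base as ℕ using (ℕ; zero; suc)
import Data.Nat.Properties as ℕₚ
import Data.Nat.DivMod as DivMod
open import Data.Nat.Solver using () renaming (module +-*-Solver to ℕ-Solver)
open import Data.Integer.Base as ℤ using (ℤ; +_; 0ℤ; 1ℤ; -1ℤ)
import Data.Integer.Properties as ℤₚ
open import Data.Rational.Base as ℚ using (ℚ; 0ℚ; 1ℚ; ½; _/_; ∣_∣; _≤_; _<_; _+_; _*_; _-_; -_; 1/_; _÷_)
open import Data.Rational.Properties as ℚₚ hiding (_≟_)
import Data.Rational.Unnormalised.Base as ℚᵘ
import Data.Rational.Unnormalised.Properties as ℚᵘₚ
open import Data.Rational.Solver using (module +-*-Solver)
open import Data.Product.Base using (Σ; ∃; _×_; _,_; proj₁; proj₂)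
open import Data.Sum.Base using (_⊎_; inj₁; inj₂; [_,_]′)
open import Function.Base using (_∘_)
open import Relation.Nullary.Negation.Core using (¬_; contradiction)
open import Relation.Nullary.Decidable.Core using (yes; no)
open import Relation.Binary.PropositionalEquality using (_≡_; _≢_; refl; sym; trans; cong; cong₂; subst; subst₂; module ≡-Reasoning)

open +-*-Solver using (solve; _:=_; _:+_; _:*_; :-_; _:-_; con)
open ℕ-Solver using () renaming (solve to ℕsolve; _:=_ to _:=ℕ_; _:+_ to _:+ℕ_; _:*_ to _:*ℕ_; _:^_ to _:^ℕ_; con to conℕ)

0<1 : 0ℚ < 1ℚ
0<1 = positive⁻¹ 1ℚ

fromℕ : ℕ → ℚ
fromℕ n = + n / 1

monoʳ : ∀ {r p q} → 0ℚ ≤ r → p ≤ q → p * r ≤ q * r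
monoʳ {r} 0≤r = *-monoʳ-≤-nonNeg r {{ℚ.nonNegative 0≤r}}

monoˡ : ∀ {r p q} → 0ℚ ≤ r → p ≤ q → r * p ≤ r * q
monoˡ {r} 0≤r = *-monoˡ-≤-nonNeg r {{ℚ.nonNegative 0≤r}}

*-mono : ∀ {p q r s} → 0ℚ ≤ r → 0ℚ ≤ q → p ≤ q → r ≤ s → p * r ≤ q * s
*-mono 0≤r 0≤q p≤q r≤s = ≤-trans (monoʳ 0≤r p≤q) (monoˡ 0≤q r≤s)

*-nonNeg : ∀ {p q} → 0ℚ ≤ p → 0ℚ ≤ q → 0ℚ ≤ p * q
*-nonNeg {p} {q} 0≤p 0≤q = subst (_≤ p * q) (*-zeroˡ q) (monoʳ 0≤q 0≤p)

*-pos : ∀ {p q} → 0ℚ < p → 0ℚ < q → 0ℚ < p * q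
*-pos {p} {q} 0<p 0<q =
  positive⁻¹ (p * q) {{pos*pos⇒pos p {{ℚ.positive 0<p}} q {{ℚ.positive 0<q}}}}

+-nonNeg : ∀ {p q} → 0ℚ ≤ p → 0ℚ ≤ q → 0ℚ ≤ p + q
+-nonNeg = +-mono-≤

p≤p+q : ∀ {p q} → 0ℚ ≤ q → p ≤ p + q
p≤p+q {p} {q} 0≤q = subst (_≤ p + q) (+-identityʳ p) (+-monoʳ-≤ p 0≤q)

x≤∣x∣ : ∀ x → x ≤ ∣ x ∣
x≤∣x∣ x with ≤-total 0ℚ x
... | inj₁ 0≤x = ≤-reflexive (sym (0≤p⇒∣p∣≡p 0≤x))
... | inj₂ x≤0 = ≤-trans x≤0 (0≤∣p∣ x)

∣x∣≤ : ∀ {x e} → x ≤ e → - x ≤ e → ∣ x ∣ ≤ e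
∣x∣≤ {x} {e} x≤e -x≤e with ∣p∣≡p∨∣p∣≡-p x
... | inj₁ eq = subst (_≤ e) (sym eq) x≤e
... | inj₂ eq = subst (_≤ e) (sym eq) -x≤e

∣-∣-sym : ∀ a b → ∣ a - b ∣ ≡ ∣ b - a ∣
∣-∣-sym a b = trans (sym (∣-p∣≡∣p∣ (a - b)))
  (cong ∣_∣ (solve 2 (λ a b → :- (a :- b) := b :- a) refl a b))

triangle : ∀ a b c → ∣ a - c ∣ ≤ ∣ a - b ∣ + ∣ b - c ∣
triangle a b c = subst (_≤ ∣ a - b ∣ + ∣ b - c ∣)
  (cong ∣_∣ (solve 3 (λ a b c → (a :- b) :+ (b :- c) := a :- c) refl a b c))
  (∣p+q∣≤∣p∣+∣q∣ (a - b) (b - c))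

sub≤ : ∀ {a b e} → a ≤ b + e → a - b ≤ e
sub≤ {a} {b} {e} h = subst (a - b ≤_)
  (solve 2 (λ b e → (b :+ e) :- b := e) refl b e) (+-monoˡ-≤ (- b) h)

≤-by-diff : ∀ {a b} → 0ℚ ≤ b - a → a ≤ b
≤-by-diff {a} {b} h = subst₂ _≤_ (+-identityʳ a)
  (solve 2 (λ a b → a :+ (b :- a) := b) refl a b) (+-monoʳ-≤ a h)

diff-nonNeg : ∀ {a b} → a ≤ b → 0ℚ ≤ b - a
diff-nonNeg {a} {b} h = subst (_≤ b - a) (+-inverseʳ a) (+-monoˡ-≤ (- a) h)

½-pos : ∀ {ε} → 0ℚ < ε → 0ℚ < ½ * ε
½-pos = *-pos (positive⁻¹ ½)

½+½ : ∀ ε → ½ * ε + ½ * ε ≡ ε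
½+½ ε = trans (sym (*-distribʳ-+ ε ½ ½)) (*-identityˡ ε)

/-pos : ∀ m n .{{_ : ℕ.NonZero m}} .{{_ : ℕ.NonZero n}} → 0ℚ < + m / n
/-pos m n = positive⁻¹ _ {{normalize-pos m n}}

/-nonNeg : ∀ m n .{{_ : ℕ.NonZero n}} → 0ℚ ≤ + m / n
/-nonNeg m n = nonNegative⁻¹ _ {{normalize-nonNeg m n}}

toℚᵘ-/ : ∀ i n .{{_ : ℕ.NonZero n}} → ℚ.toℚᵘ (i / n) ℚᵘ.≃ i ℚᵘ./ n
toℚᵘ-/ i (suc n) = toℚᵘ-fromℚᵘ (ℚᵘ.mkℚᵘ i n)

/-mono : ∀ i j m n .{{_ : ℕ.NonZero m}} .{{_ : ℕ.NonZero n}} →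
  i ℤ.* + n ℤ.≤ j ℤ.* + m → i / m ≤ j / n
/-mono i j m@(suc _) n@(suc _) h = toℚᵘ-cancel-≤
  (ℚᵘₚ.≤-respˡ-≃ (ℚᵘₚ.≃-sym (toℚᵘ-/ i m))
  (ℚᵘₚ.≤-respʳ-≃ (ℚᵘₚ.≃-sym (toℚᵘ-/ j n)) (ℚᵘ.*≤* h)))

/-≡ : ∀ i j m n .{{_ : ℕ.NonZero m}} .{{_ : ℕ.NonZero n}} →
  i ℤ.* + n ≡ j ℤ.* + m → i / m ≡ j / n
/-≡ i j m n h = ≤-antisym (/-mono i j m n (ℤₚ.≤-reflexive h)) (/-mono j i n m (ℤₚ.≤-reflexive (sym h)))

/-+ : ∀ i j m n .{{_ : ℕ.NonZero m}} .{{_ : ℕ.NonZero n}} .{{_ : ℕ.NonZero (m ℕ.* n)}} →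
  i / m + j / n ≡ (i ℤ.* + n ℤ.+ j ℤ.* + m) / (m ℕ.* n)
/-+ i j m@(suc _) n@(suc _) = toℚᵘ-injective
  (ℚᵘₚ.≃-trans (toℚᵘ-homo-+ (i / m) (j / n))
  (ℚᵘₚ.≃-trans (ℚᵘₚ.+-cong (toℚᵘ-/ i m) (toℚᵘ-/ j n))
  (ℚᵘₚ.≃-sym (toℚᵘ-/ (i ℤ.* + n ℤ.+ j ℤ.* + m) (m ℕ.* n)))))

/-* : ∀ i j m n .{{_ : ℕ.NonZero m}} .{{_ : ℕ.NonZero n}} .{{_ : ℕ.NonZero (m ℕ.* n)}} →
  (i / m) * (j / n) ≡ (i ℤ.* j) / (m ℕ.* n)
/-* i j m@(suc _) n@(suc _) = toℚᵘ-injective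
  (ℚᵘₚ.≃-trans (toℚᵘ-homo-* (i / m) (j / n))
  (ℚᵘₚ.≃-trans (ℚᵘₚ.*-cong (toℚᵘ-/ i m) (toℚᵘ-/ j n))
  (ℚᵘₚ.≃-sym (toℚᵘ-/ (i ℤ.* j) (m ℕ.* n)))))

*-/-cancel : ∀ i m .{{_ : ℕ.NonZero m}} → fromℕ m * (i / m) ≡ i / 1
*-/-cancel i m@(suc _) = trans (/-* (+ m) i 1 m) (/-≡ (+ m ℤ.* i) i (1 ℕ.* m) 1 eq)
  where
  eq : + m ℤ.* i ℤ.* + 1 ≡ i ℤ.* + (1 ℕ.* m)
  eq = trans (ℤₚ.*-identityʳ _) (trans (ℤₚ.*-comm (+ m) i) (cong (λ k → i ℤ.* + k) (sym (ℕₚ.*-identityˡ m))))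

fromℕ-suc : ∀ n → fromℕ (suc n) ≡ fromℕ n + 1ℚ
fromℕ-suc n = sym (trans (/-+ (+ n) (+ 1) 1 1) (cong (λ k → k / 1)
  (trans (cong (ℤ._+ + 1) (ℤₚ.*-identityʳ (+ n))) (cong +_ (ℕₚ.+-comm n 1)))))

fromℕ-mono : ∀ {m n} → m ℕ.≤ n → fromℕ m ≤ fromℕ n
fromℕ-mono {m} {n} h = /-mono (+ m) (+ n) 1 1 (ℤₚ.*-monoʳ-≤-nonNeg (+ 1) (ℤ.+≤+ h))

archimedean : ∀ {ε} → 0ℚ < ε → ∃ λ N → + 1 / suc N ≤ ε
archimedean {ε@(ℚ.mkℚ (+ zero) d c)} (ℚ.*<* (ℤ.+<+ ()))
archimedean {ε@(ℚ.mkℚ (+ suc a) d c)} _ = d , subst (+ 1 / suc d ≤_) (↥p/↧p≡p ε)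
    (/-mono (+ 1) (+ suc a) (suc d) (suc d) (ℤₚ.*-monoʳ-≤-nonNeg (+ suc d) {+ 1} {+ suc a} (ℤ.+≤+ (ℕ.s≤s ℕ.z≤n))))

1/-anti : ∀ {m n} → m ℕ.≤ n → + 1 / suc n ≤ + 1 / suc m
1/-anti {m} {n} h = /-mono (+ 1) (+ 1) (suc n) (suc m) (ℤₚ.*-monoˡ-≤-nonNeg (+ 1) (ℤ.+≤+ (ℕ.s≤s h)))

-- Real numbers are Cauchy sequences of rationals; equality of reals is the
-- relation x ≤ℝ y × y ≤ℝ x, not _≡_.
IsCauchy : (ℕ → ℚ) → Set
IsCauchy x = ∀ ε → 0ℚ < ε →
  ∃ λ N → ∀ m n → N ℕ.≤ m → N ℕ.≤ n → ∣ x m - x n ∣ ≤ ε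

record ℝ : Set where
  constructor mkℝ
  field
    seq    : ℕ → ℚ
    cauchy : IsCauchy seq

open ℝ public

infix 4 _<ℝ_ _≤ℝ_

-- Strict order carries a rational gap valid from some index on; the weak order
-- is its negative, as for any constructive Cauchy reals.
_<ℝ_ : ℝ → ℝ → Set
x <ℝ y = ∃ λ ε → 0ℚ < ε × ∃ λ N → ∀ k → N ℕ.≤ k → seq x k + ε ≤ seq y k

_≤ℝ_ : ℝ → ℝ → Set
x ≤ℝ y = ¬ (y <ℝ x)

dominated : ∀ x y z {C D} → 0ℚ < C → 0ℚ < D → IsCauchy x → IsCauchy y →
  (∀ m n → ∣ z m - z n ∣ ≤ C * ∣ x m - x n ∣ + D * ∣ y m - y n ∣) → IsCauchy z
dominated x y z {C} {D} C>0 D>0 cx cy h ε ε>0 =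
  Nx ℕ.⊔ Ny , λ m n N≤m N≤n → begin
    ∣ z m - z n ∣                                   ≤⟨ h m n ⟩
    C * ∣ x m - x n ∣ + D * ∣ y m - y n ∣           ≤⟨ +-mono-≤
      (scaled C>0 (px m n (≤l N≤m) (≤l N≤n)))
      (scaled D>0 (py m n (≤r N≤m) (≤r N≤n))) ⟩
    ½ * ε + ½ * ε                                   ≡⟨ ½+½ ε ⟩
    ε                                               ∎
  where
  open ≤-Reasoning
  inv : ∀ {C} → 0ℚ < C → ℚ
  inv {C} C>0 = (1/ C) {{ℚ.>-nonZero C>0}}
  inv-pos : ∀ {C} (C>0 : 0ℚ < C) → 0ℚ < inv C>0
  inv-pos {C} C>0 = positive⁻¹ _ {{1/pos⇒pos C {{ℚ.positive C>0}}}}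
  δ : ∀ {C} → 0ℚ < C → ℚ
  δ C>0 = inv C>0 * (½ * ε)
  δ-pos : ∀ {C} (C>0 : 0ℚ < C) → 0ℚ < δ C>0
  δ-pos C>0 = *-pos (inv-pos C>0) (½-pos ε>0)
  Cx = cx (δ C>0) (δ-pos C>0)
  Cy = cy (δ D>0) (δ-pos D>0)
  Nx = proj₁ Cx
  px = proj₂ Cx
  Ny = proj₁ Cy
  py = proj₂ Cy
  ≤l : ∀ {m} → Nx ℕ.⊔ Ny ℕ.≤ m → Nx ℕ.≤ m
  ≤l = ℕₚ.≤-trans (ℕₚ.m≤m⊔n Nx Ny)
  ≤r : ∀ {m} → Nx ℕ.⊔ Ny ℕ.≤ m → Ny ℕ.≤ m
  ≤r = ℕₚ.≤-trans (ℕₚ.m≤n⊔m Nx Ny)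
  scaled : ∀ {C a} (C>0 : 0ℚ < C) → a ≤ δ C>0 → C * a ≤ ½ * ε
  scaled {C} {a} C>0 a≤ = begin
    C * a                  ≤⟨ monoˡ (<⇒≤ C>0) a≤ ⟩
    C * (inv C>0 * (½ * ε)) ≡⟨ *-assoc C (inv C>0) (½ * ε) ⟨
    C * inv C>0 * (½ * ε)   ≡⟨ cong (_* (½ * ε)) (*-inverseʳ C {{ℚ.>-nonZero C>0}}) ⟩
    1ℚ * (½ * ε)           ≡⟨ *-identityˡ (½ * ε) ⟩
    ½ * ε                  ∎

dominated₁ : ∀ x z {C} → 0ℚ < C → IsCauchy x →
  (∀ m n → ∣ z m - z n ∣ ≤ C * ∣ x m - x n ∣) → IsCauchy z
dominated₁ x z {C} C>0 cx h = dominated x x z C>0 0<1 cx cx (λ m n →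
  ≤-trans (h m n) (p≤p+q {C * ∣ x m - x n ∣} {1ℚ * ∣ x m - x n ∣} (*-nonNeg {1ℚ} (<⇒≤ 0<1) (0≤∣p∣ (x m - x n)))))

bounded : ∀ x → IsCauchy x → ∃ λ B → 0ℚ < B × ∀ n → ∣ x n ∣ ≤ B
bounded x cx = S N + 1ℚ , <-≤-trans 0<1 (subst (1ℚ ≤_) (+-comm 1ℚ (S N)) (p≤p+q (S≥0 N))) , bound
  where
  N = proj₁ (cx 1ℚ 0<1)
  S : ℕ → ℚ
  S zero    = ∣ x zero ∣
  S (suc k) = S k + ∣ x (suc k) ∣
  S≥0 : ∀ k → 0ℚ ≤ S k
  S≥0 zero = 0≤∣p∣ _
  S≥0 (suc k) = +-nonNeg (S≥0 k) (0≤∣p∣ _)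
  last : ∀ k → ∣ x k ∣ ≤ S k
  last zero = ≤-refl
  last (suc k) = subst (_≤ S (suc k)) (+-identityˡ _) (+-monoˡ-≤ ∣ x (suc k) ∣ (S≥0 k))
  S-mono : ∀ {i k} → i ℕ.≤′ k → S i ≤ S k
  S-mono (ℕ.≤′-reflexive refl) = ≤-refl
  S-mono (ℕ.≤′-step h) = ≤-trans (S-mono h) (p≤p+q (0≤∣p∣ _))
  bound : ∀ n → ∣ x n ∣ ≤ S N + 1ℚ
  bound n with ℕₚ.≤-total n N
  ... | inj₁ n≤N = ≤-trans (last n) (≤-trans (S-mono (ℕₚ.≤⇒≤′ n≤N)) (p≤p+q (<⇒≤ 0<1)))
  ... | inj₂ N≤n = begin
    ∣ x n ∣                    ≡⟨ cong ∣_∣ (solve 2 (λ a b → a := b :+ (a :- b)) refl (x n) (x N)) ⟩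
    ∣ x N + (x n - x N) ∣      ≤⟨ ∣p+q∣≤∣p∣+∣q∣ (x N) (x n - x N) ⟩
    ∣ x N ∣ + ∣ x n - x N ∣    ≤⟨ +-mono-≤ (last N) (proj₂ (cx 1ℚ 0<1) n N N≤n ℕₚ.≤-refl) ⟩
    S N + 1ℚ                   ∎
    where open ≤-Reasoning

fromℚ : ℚ → ℝ
fromℚ q = mkℝ (λ _ → q) (λ ε ε>0 → 0 , λ _ _ _ _ →
  subst (_≤ ε) (cong ∣_∣ (sym (+-inverseʳ q))) (<⇒≤ ε>0))

infix 8 -ℝ_
-ℝ_ : ℝ → ℝ
-ℝ x = mkℝ (λ k → - seq x k) (dominated₁ (seq x) (λ k → - seq x k) 0<1 (cauchy x) λ m n → ≤-reflexive (
  trans (cong ∣_∣ (solve 2 (λ a b → :- a :- :- b := b :- a) refl (seq x m) (seq x n)))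
  (trans (∣-∣-sym (seq x n) (seq x m)) (sym (*-identityˡ _)))))

infixl 7 _*ℝ_ 
_*ℝ_ : ℝ → ℝ → ℝ
x *ℝ y = mkℝ (λ k → seq x k * seq y k)
  (dominated (seq x) (seq y) (λ k → seq x k * seq y k) (proj₁ (proj₂ By)) (proj₁ (proj₂ Bx)) (cauchy x) (cauchy y) bound)
  where
  Bx = bounded (seq x) (cauchy x)
  By = bounded (seq y) (cauchy y)
  open ≤-Reasoning
  bound : ∀ m n → ∣ seq x m * seq y m - seq x n * seq y n ∣ ≤
    proj₁ By * ∣ seq x m - seq x n ∣ + proj₁ Bx * ∣ seq y m - seq y n ∣
  bound m n = begin
    ∣ a * c - b * d ∣                        ≡⟨ cong ∣_∣ (solve 4 (λ a b c d → a :* c :- b :* d := c :* (a :- b) :+ b :* (c :- d)) refl a b c d) ⟩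
    ∣ c * (a - b) + b * (c - d) ∣            ≤⟨ ∣p+q∣≤∣p∣+∣q∣ (c * (a - b)) (b * (c - d)) ⟩
    ∣ c * (a - b) ∣ + ∣ b * (c - d) ∣        ≡⟨ cong₂ _+_ (∣p*q∣≡∣p∣*∣q∣ c (a - b)) (∣p*q∣≡∣p∣*∣q∣ b (c - d)) ⟩
    ∣ c ∣ * ∣ a - b ∣ + ∣ b ∣ * ∣ c - d ∣    ≤⟨ +-mono-≤ (monoʳ (0≤∣p∣ (a - b)) (proj₂ (proj₂ By) m)) (monoʳ (0≤∣p∣ (c - d)) (proj₂ (proj₂ Bx) n)) ⟩
    proj₁ By * ∣ a - b ∣ + proj₁ Bx * ∣ c - d ∣ ∎
    where
    a = seq x m
    b = seq x n
    c = seq y m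
    d = seq y n

shift-cauchy : ∀ x N → IsCauchy x → IsCauchy (λ k → x (N ℕ.+ k))
shift-cauchy x N cx ε ε>0 = proj₁ (cx ε ε>0) , λ m n h h' →
  proj₂ (cx ε ε>0) _ _ (ℕₚ.≤-trans h (ℕₚ.m≤n+m m N)) (ℕₚ.≤-trans h' (ℕₚ.m≤n+m n N))

recip-cauchy : ∀ x {ε} → 0ℚ < ε → .{{nz : ∀ {k} → ℚ.NonZero (x k)}} → (∀ k → ε ≤ x k) → IsCauchy x →
  IsCauchy (λ k → 1/ x k)
recip-cauchy x {ε} ε>0 {{nz}} ε≤ cx = dominated₁ x r (*-pos i>0 i>0) cx bound
  where
  open ≤-Reasoning
  i = (1/ ε) {{ℚ.>-nonZero ε>0}}
  i>0 : 0ℚ < i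
  i>0 = positive⁻¹ _ {{1/pos⇒pos ε {{ℚ.positive ε>0}}}}
  x>0 : ∀ k → 0ℚ < x k
  x>0 k = <-≤-trans ε>0 (ε≤ k)
  r : ℕ → ℚ
  r k = 1/ x k
  r>0 : ∀ k → 0ℚ < r k
  r>0 k = positive⁻¹ _ {{1/pos⇒pos (x k) {{ℚ.positive (x>0 k)}}}}
  r≤i : ∀ k → r k ≤ i
  r≤i k = begin
    r k              ≡⟨ *-identityˡ (r k) ⟨
    1ℚ * r k         ≡⟨ cong (_* r k) (*-inverseˡ ε {{ℚ.>-nonZero ε>0}}) ⟨
    i * ε * r k      ≤⟨ monoʳ (<⇒≤ (r>0 k)) (monoˡ (<⇒≤ i>0) (ε≤ k)) ⟩
    i * x k * r k    ≡⟨ *-assoc i (x k) (r k) ⟩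
    i * (x k * r k)  ≡⟨ cong (i *_) (*-inverseʳ (x k)) ⟩
    i * 1ℚ           ≡⟨ *-identityʳ i ⟩
    i                ∎
  eq : ∀ m n → r m - r n ≡ r m * r n * (x n - x m)
  eq m n = begin-equality
    r m - r n                              ≡⟨ cong₂ _-_ (*-identityʳ (r m)) (*-identityʳ (r n)) ⟨
    r m * 1ℚ - r n * 1ℚ                    ≡⟨ cong₂ (λ u v → r m * u - r n * v) (*-inverseʳ (x n)) (*-inverseʳ (x m)) ⟨
    r m * (x n * r n) - r n * (x m * r m)  ≡⟨ solve 4 (λ rm rn xm xn → rm :* (xn :* rn) :- rn :* (xm :* rm) := rm :* rn :* (xn :- xm)) refl (r m) (r n) (x m) (x n) ⟩
    r m * r n * (x n - x m) ∎
  bound : ∀ m n → ∣ r m - r n ∣ ≤ i * i * ∣ x m - x n ∣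
  bound m n = begin
    ∣ r m - r n ∣                    ≡⟨ cong ∣_∣ (eq m n) ⟩
    ∣ r m * r n * (x n - x m) ∣      ≡⟨ ∣p*q∣≡∣p∣*∣q∣ (r m * r n) (x n - x m) ⟩
    ∣ r m * r n ∣ * ∣ x n - x m ∣    ≡⟨ cong₂ _*_ (0≤p⇒∣p∣≡p (<⇒≤ (*-pos (r>0 m) (r>0 n)))) (∣-∣-sym (x n) (x m)) ⟩
    r m * r n * ∣ x m - x n ∣        ≤⟨ monoʳ (0≤∣p∣ _) (*-mono (<⇒≤ (r>0 n)) (<⇒≤ i>0) (r≤i m) (r≤i n)) ⟩
    i * i * ∣ x m - x n ∣ ∎

-- The sequence is shifted past the index from which x is bounded away from 0,
-- so that every entry is invertible.
recip : (x : ℝ) → fromℚ 0ℚ <ℝ x → ℝ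
recip x (ε , ε>0 , N , h) = mkℝ (λ k → (1/ seq x (N ℕ.+ k)) {{nz k}})
  (recip-cauchy (λ k → seq x (N ℕ.+ k)) ε>0 {{λ {k} → nz k}} ε≤ (shift-cauchy (seq x) N (cauchy x)))
  where
  ε≤ : ∀ k → ε ≤ seq x (N ℕ.+ k)
  ε≤ k = subst (_≤ seq x (N ℕ.+ k)) (+-identityˡ ε) (h (N ℕ.+ k) (ℕₚ.m≤m+n N k))
  .nz : ∀ k → ℚ.NonZero (seq x (N ℕ.+ k))
  nz k = ℚ.>-nonZero (<-≤-trans ε>0 (ε≤ k))

-- expTerm q j = qʲ / j!
expTerm : ℚ → ℕ → ℚ
expTerm q zero    = 1ℚ
expTerm q (suc j) = expTerm q j * q * (+ 1 / suc j)

expSum : ℚ → ℕ → ℚ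
expSum q zero    = expTerm q zero
expSum q (suc k) = expSum q k + expTerm q (suc k)

module _ {B : ℚ} (B≥0 : 0ℚ ≤ B) where
  private
    T = expTerm B
    r : ℕ → ℚ
    r j = + 1 / suc j
    r≥0 : ∀ j → 0ℚ ≤ r j
    r≥0 j = /-nonNeg 1 (suc j)

  expTerm-nonNeg : ∀ j → 0ℚ ≤ T j
  expTerm-nonNeg zero    = <⇒≤ 0<1
  expTerm-nonNeg (suc j) = *-nonNeg (*-nonNeg (expTerm-nonNeg j) B≥0) (r≥0 j)

  term-bound : ∀ {q} → ∣ q ∣ ≤ B → ∀ j → ∣ expTerm q j ∣ ≤ T j
  term-bound h zero = ≤-refl
  term-bound {q} h (suc j) = begin
    ∣ expTerm q j * q * r j ∣        ≡⟨ ∣p*q∣≡∣p∣*∣q∣ (expTerm q j * q) (r j) ⟩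
    ∣ expTerm q j * q ∣ * ∣ r j ∣    ≡⟨ cong₂ _*_ (∣p*q∣≡∣p∣*∣q∣ (expTerm q j) q) (0≤p⇒∣p∣≡p (r≥0 j)) ⟩
    ∣ expTerm q j ∣ * ∣ q ∣ * r j    ≤⟨ monoʳ (r≥0 j) (*-mono (0≤∣p∣ q) (expTerm-nonNeg j) (term-bound h j) h) ⟩
    T j * B * r j ∎
    where open ≤-Reasoning

  sum-tail′ : ∀ {q} → ∣ q ∣ ≤ B → ∀ {m n} → m ℕ.≤′ n →
    ∣ expSum q m - expSum q n ∣ ≤ expSum B n - expSum B m
  sum-tail′ {q} h {m} (ℕ.≤′-reflexive refl) = ≤-reflexive
    (trans (cong ∣_∣ (+-inverseʳ (expSum q m))) (sym (+-inverseʳ (expSum B m))))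
  sum-tail′ {q} h {m} {suc n} (ℕ.≤′-step m≤n) = begin
    ∣ sm - (sn + t) ∣     ≡⟨ cong ∣_∣ (solve 3 (λ sm sn t → sm :- (sn :+ t) := (sm :- sn) :- t) refl sm sn t) ⟩
    ∣ (sm - sn) - t ∣     ≤⟨ ∣p-q∣≤∣p∣+∣q∣ (sm - sn) t ⟩
    ∣ sm - sn ∣ + ∣ t ∣   ≤⟨ +-mono-≤ (sum-tail′ h m≤n) (term-bound h (suc n)) ⟩
    (expSum B n - expSum B m) + T (suc n) ≡⟨ solve 3 (λ a b c → (a :- b) :+ c := (a :+ c) :- b) refl (expSum B n) (expSum B m) (T (suc n)) ⟩
    (expSum B n + T (suc n)) - expSum B m ∎
    where
    open ≤-Reasoning
    sm = expSum q m
    sn = expSum q n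
    t = expTerm q (suc n)

  sum-tail : ∀ {q} → ∣ q ∣ ≤ B → ∀ m n → ∣ expSum q m - expSum q n ∣ ≤ ∣ expSum B m - expSum B n ∣
  sum-tail {q} h m n with ℕₚ.≤-total m n
  ... | inj₁ m≤n = ≤-trans (sum-tail′ h (ℕₚ.≤⇒≤′ m≤n))
    (≤-trans (x≤∣x∣ _) (≤-reflexive (∣-∣-sym (expSum B n) (expSum B m))))
  ... | inj₂ n≤m = subst (_≤ ∣ expSum B m - expSum B n ∣) (∣-∣-sym (expSum q n) (expSum q m))
    (≤-trans (sum-tail′ h (ℕₚ.≤⇒≤′ n≤m)) (x≤∣x∣ _))

  [1+j]/[1+j]≡1 : ∀ j → fromℕ (suc j) * r j ≡ 1ℚ
  [1+j]/[1+j]≡1 j = *-/-cancel (+ 1) (suc j)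

  term-lip : ∀ {a b} → ∣ a ∣ ≤ B → ∣ b ∣ ≤ B → ∀ j →
    ∣ expTerm a (suc j) - expTerm b (suc j) ∣ ≤ T j * ∣ a - b ∣
  term-lip {a} {b} ha hb zero = ≤-reflexive (trans (cong ∣_∣
    (solve 2 (λ a b → con 1ℚ :* a :* con 1ℚ :- con 1ℚ :* b :* con 1ℚ := a :- b) refl a b)) (sym (*-identityˡ _)))
  term-lip {a} {b} ha hb (suc j) = begin
    ∣ A * a * ρ - A′ * b * ρ ∣            ≡⟨ cong ∣_∣ (solve 5 (λ A a ρ A′ b → A :* a :* ρ :- A′ :* b :* ρ := ((A :- A′) :* a :+ A′ :* (a :- b)) :* ρ) refl A a ρ A′ b) ⟩
    ∣ ((A - A′) * a + A′ * (a - b)) * ρ ∣ ≡⟨ trans (∣p*q∣≡∣p∣*∣q∣ ((A - A′) * a + A′ * (a - b)) ρ) (cong (∣ (A - A′) * a + A′ * (a - b) ∣ *_) (0≤p⇒∣p∣≡p (r≥0 (suc j)))) ⟩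
    ∣ (A - A′) * a + A′ * (a - b) ∣ * ρ   ≤⟨ monoʳ (r≥0 (suc j)) (∣p+q∣≤∣p∣+∣q∣ ((A - A′) * a) (A′ * (a - b))) ⟩
    (∣ (A - A′) * a ∣ + ∣ A′ * (a - b) ∣) * ρ ≡⟨ cong (_* ρ) (cong₂ _+_ (∣p*q∣≡∣p∣*∣q∣ (A - A′) a) (∣p*q∣≡∣p∣*∣q∣ A′ (a - b))) ⟩
    (∣ A - A′ ∣ * ∣ a ∣ + ∣ A′ ∣ * Δ) * ρ ≤⟨ monoʳ (r≥0 (suc j)) (+-mono-≤
         (*-mono (0≤∣p∣ a) (*-nonNeg (expTerm-nonNeg j) (0≤∣p∣ (a - b))) (term-lip ha hb j) ha)
         (monoʳ (0≤∣p∣ (a - b)) (term-bound hb (suc j)))) ⟩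
    (T j * Δ * B + T (suc j) * Δ) * ρ     ≡⟨ cong (λ u → (u + T (suc j) * Δ) * ρ) TB ⟩
    (c * T (suc j) * Δ + T (suc j) * Δ) * ρ ≡⟨ solve 4 (λ c t Δ ρ → (c :* t :* Δ :+ t :* Δ) :* ρ := ((c :+ con 1ℚ) :* ρ) :* (t :* Δ)) refl c (T (suc j)) Δ ρ ⟩
    (c + 1ℚ) * ρ * (T (suc j) * Δ)        ≡⟨ cong (_* (T (suc j) * Δ)) (trans (cong (_* ρ) (sym (fromℕ-suc (suc j)))) ([1+j]/[1+j]≡1 (suc j))) ⟩
    1ℚ * (T (suc j) * Δ)                  ≡⟨ *-identityˡ _ ⟩
    T (suc j) * Δ ∎
    where
    open ≤-Reasoning
    A = expTerm a (suc j)
    A′ = expTerm b (suc j)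
    ρ = r (suc j)
    Δ = ∣ a - b ∣
    c = fromℕ (suc j)
    TB : T j * Δ * B ≡ c * T (suc j) * Δ
    TB = begin-equality
      T j * Δ * B                    ≡⟨ *-identityˡ _ ⟨
      1ℚ * (T j * Δ * B)             ≡⟨ cong (_* (T j * Δ * B)) ([1+j]/[1+j]≡1 j) ⟨
      c * r j * (T j * Δ * B)        ≡⟨ solve 5 (λ c r t Δ B → c :* r :* (t :* Δ :* B) := c :* (t :* B :* r) :* Δ) refl c (r j) (T j) Δ B ⟩
      c * (T j * B * r j) * Δ ∎

  sum-lip : ∀ {a b} → ∣ a ∣ ≤ B → ∣ b ∣ ≤ B → ∀ k →
    ∣ expSum a k - expSum b k ∣ ≤ expSum B k * ∣ a - b ∣
  sum-lip {a} {b} ha hb zero = *-nonNeg (<⇒≤ 0<1) (0≤∣p∣ (a - b))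
  sum-lip {a} {b} ha hb (suc k) = ≤-trans (sum-lip′ k) (monoʳ (0≤∣p∣ (a - b)) (p≤p+q {expSum B k} (expTerm-nonNeg (suc k))))
    where
    open ≤-Reasoning
    Δ = ∣ a - b ∣
    split : ∀ a b c d → ∣ (a + b) - (c + d) ∣ ≤ ∣ a - c ∣ + ∣ b - d ∣
    split a b c d = subst (_≤ ∣ a - c ∣ + ∣ b - d ∣) (cong ∣_∣
      (solve 4 (λ a b c d → (a :- c) :+ (b :- d) := (a :+ b) :- (c :+ d)) refl a b c d))
      (∣p+q∣≤∣p∣+∣q∣ (a - c) (b - d))
    sum-lip′ : ∀ k → ∣ expSum a (suc k) - expSum b (suc k) ∣ ≤ expSum B k * Δ
    sum-lip′ zero = ≤-trans (split 1ℚ (expTerm a 1) 1ℚ (expTerm b 1))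
      (subst (_≤ 1ℚ * Δ) (sym (+-identityˡ _)) (term-lip ha hb 0))
    sum-lip′ (suc k) = begin
      _  ≤⟨ split (expSum a (suc k)) (expTerm a (suc (suc k))) (expSum b (suc k)) (expTerm b (suc (suc k))) ⟩
      _  ≤⟨ +-mono-≤ (sum-lip′ k) (term-lip ha hb (suc k)) ⟩
      expSum B k * Δ + T (suc k) * Δ ≡⟨ *-distribʳ-+ Δ (expSum B k) (T (suc k)) ⟨
      expSum B (suc k) * Δ ∎

expSum-cauchy : ∀ b → IsCauchy (expSum (fromℕ b))
expSum-cauchy b ε ε>0 = N ℕ.+ M , λ m n hm hn → close m n hm hn
  where
  B = fromℕ b
  B≥0 : 0ℚ ≤ B
  B≥0 = /-nonNeg b 1
  T = expTerm B
  r : ℕ → ℚ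
  r j = + 1 / suc j
  N = b ℕ.+ b
  halving : ∀ j → N ℕ.≤ j → B * r j ≤ ½
  halving j N≤j = begin
    B * r j                  ≡⟨ trans (/-* (+ b) (+ 1) 1 (suc j)) refl ⟩
    (+ b ℤ.* + 1) / (1 ℕ.* suc j) ≤⟨ /-mono (+ b ℤ.* + 1) (+ 1) (1 ℕ.* suc j) 2 ineq ⟩
    ½                        ∎
    where
    open ≤-Reasoning
    ineq : + b ℤ.* + 1 ℤ.* + 2 ℤ.≤ + 1 ℤ.* + (1 ℕ.* suc j)
    ineq = subst₂ ℤ._≤_
      (trans (cong +_ (trans (cong (b ℕ.+_) (sym (ℕₚ.+-identityʳ b))) (ℕₚ.*-comm 2 b)))
         (trans (ℤₚ.pos-* b 2) (cong (ℤ._* + 2) (sym (ℤₚ.*-identityʳ (+ b))))))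
      (trans (cong +_ (sym (ℕₚ.*-identityˡ (suc j)))) (sym (ℤₚ.*-identityˡ (+ (1 ℕ.* suc j)))))
      (ℤ.+≤+ (ℕₚ.≤-trans N≤j (ℕₚ.n≤1+n j)))
  half : ∀ j → N ℕ.≤ j → T (suc j) ≤ T j * ½
  half j N≤j = subst (_≤ T j * ½) (sym (*-assoc (T j) B (r j))) (monoˡ (expTerm-nonNeg B≥0 j) (halving j N≤j))
  half-r : ∀ i → r i * ½ ≤ r (suc i)
  half-r i = subst (_≤ r (suc i)) (sym (/-* (+ 1) (+ 1) (suc i) 2))
    (/-mono (+ 1) (+ 1) (suc i ℕ.* 2) (suc (suc i)) (ℤₚ.*-monoˡ-≤-nonNeg (+ 1)
      (ℤ.+≤+ (ℕ.s≤s (ℕ.s≤s (ℕₚ.m≤m*n i 2))))))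
  decay : ∀ i → T (N ℕ.+ i) ≤ T N * r i
  decay zero = ≤-reflexive (trans (cong T (ℕₚ.+-identityʳ N)) (sym (*-identityʳ (T N))))
  decay (suc i) = subst (λ u → T u ≤ T N * r (suc i)) (sym (ℕₚ.+-suc N i)) (begin
    T (suc (N ℕ.+ i))  ≤⟨ half (N ℕ.+ i) (ℕₚ.m≤m+n N i) ⟩
    T (N ℕ.+ i) * ½    ≤⟨ monoʳ (<⇒≤ (positive⁻¹ ½)) (decay i) ⟩
    T N * r i * ½      ≡⟨ *-assoc (T N) (r i) ½ ⟩
    T N * (r i * ½)    ≤⟨ monoˡ (expTerm-nonNeg B≥0 N) (half-r i) ⟩
    T N * r (suc i)    ∎)
    where open ≤-Reasoning
  U : ℕ → ℚ
  U k = expSum B k + T k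
  U-anti : ∀ {m n} → N ℕ.≤ m → m ℕ.≤′ n → U n ≤ U m
  U-anti N≤m (ℕ.≤′-reflexive refl) = ≤-refl
  U-anti {m} {suc n} N≤m (ℕ.≤′-step m≤n) = ≤-trans (begin
    expSum B n + t + t       ≡⟨ +-assoc (expSum B n) t t ⟩
    expSum B n + (t + t)     ≤⟨ +-monoʳ-≤ (expSum B n) (+-mono-≤ h h) ⟩
    expSum B n + (T n * ½ + T n * ½) ≡⟨ cong (λ u → expSum B n + u) (trans (cong₂ _+_ (*-comm (T n) ½) (*-comm (T n) ½)) (½+½ (T n))) ⟩
    expSum B n + T n         ∎) (U-anti N≤m m≤n)
    where
    open ≤-Reasoning
    t = T (suc n)
    h = half n (ℕₚ.≤-trans N≤m (ℕₚ.≤′⇒≤ m≤n))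
  S-mono : ∀ {m n} → m ℕ.≤′ n → expSum B m ≤ expSum B n
  S-mono (ℕ.≤′-reflexive refl) = ≤-refl
  S-mono {n = suc n} (ℕ.≤′-step h) = ≤-trans (S-mono h) (p≤p+q (expTerm-nonNeg B≥0 (suc n)))
  K : ℚ
  K = T N + 1ℚ
  K>0 : 0ℚ < K
  K>0 = <-≤-trans 0<1 (subst (1ℚ ≤_) (+-comm 1ℚ (T N)) (p≤p+q (expTerm-nonNeg B≥0 N)))
  i = (1/ K) {{ℚ.>-nonZero K>0}}
  arch = archimedean (*-pos (positive⁻¹ i {{1/pos⇒pos K {{ℚ.positive K>0}}}}) ε>0)
  M = proj₁ arch
  small : ∀ m → N ℕ.+ M ℕ.≤ m → T m ≤ ε
  small m h = begin
    T m              ≡⟨ cong T (ℕₚ.m+[n∸m]≡n N≤m) ⟨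
    T (N ℕ.+ d)      ≤⟨ decay d ⟩
    T N * r d        ≤⟨ *-mono {T N} {K} (/-nonNeg 1 (suc d)) (<⇒≤ K>0) (p≤p+q {T N} (<⇒≤ 0<1)) (≤-trans (1/-anti M≤d) (proj₂ arch)) ⟩
    K * (i * ε)      ≡⟨ *-assoc K i ε ⟨
    K * i * ε        ≡⟨ cong (_* ε) (*-inverseʳ K {{ℚ.>-nonZero K>0}}) ⟩
    1ℚ * ε           ≡⟨ *-identityˡ ε ⟩
    ε                ∎
    where
    open ≤-Reasoning
    N≤m = ℕₚ.≤-trans (ℕₚ.m≤m+n N M) h
    d = m ℕ.∸ N
    M≤d : M ℕ.≤ d
    M≤d = ℕₚ.m+n≤o⇒m≤o∸n M (subst (ℕ._≤ m) (ℕₚ.+-comm N M) h)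
  ordered : ∀ m n → N ℕ.+ M ℕ.≤ m → m ℕ.≤ n → ∣ expSum B n - expSum B m ∣ ≤ ε
  ordered m n hm m≤n = ∣x∣≤
    (≤-trans (sub≤ {expSum B n} {expSum B m} {T m} (≤-trans (p≤p+q {expSum B n} (expTerm-nonNeg B≥0 n)) (U-anti (ℕₚ.≤-trans (ℕₚ.m≤m+n N M) hm) (ℕₚ.≤⇒≤′ m≤n)))) (small m hm))
    (≤-trans (neg-antimono-≤ (diff-nonNeg (S-mono (ℕₚ.≤⇒≤′ m≤n)))) (<⇒≤ ε>0))
  close : ∀ m n → N ℕ.+ M ℕ.≤ m → N ℕ.+ M ℕ.≤ n → ∣ expSum B m - expSum B n ∣ ≤ ε
  close m n hm hn = [ (λ m≤n → subst (_≤ ε) (∣-∣-sym (expSum B n) (expSum B m)) (ordered m n hm m≤n))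
                    , ordered n m hn ]′ (ℕₚ.≤-total m n)

ℕ-bound : ∀ q → 0ℚ ≤ q → ∃ λ b → q ≤ fromℕ b
ℕ-bound q@(ℚ.mkℚ (+ a) d c) _ = a , subst (_≤ fromℕ a) (↥p/↧p≡p q)
  (/-mono (+ a) (+ a) (suc d) 1 (ℤₚ.*-monoˡ-≤-nonNeg (+ a) (ℤ.+≤+ (ℕ.s≤s ℕ.z≤n))))
ℕ-bound (ℚ.mkℚ (ℤ.-[1+ _ ]) d c) (ℚ.*≤* ())

-- Diagonal of the exponential series: the k-th approximant is
-- Σ_{j ≤ k} xₖʲ / j!.  The domination by the series at an integer bound of |x|
-- shows that it has the same limit as the full series at x.
exp : ℝ → ℝ
exp x = mkℝ (λ k → expSum (seq x k) k)
  (dominated (seq x) (expSum B) (λ k → expSum (seq x k) k) (proj₁ (proj₂ E)) 0<1 (cauchy x) cS bound)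
  where
  Bx = bounded (seq x) (cauchy x)
  nb = ℕ-bound (proj₁ Bx) (<⇒≤ (proj₁ (proj₂ Bx)))
  B = fromℕ (proj₁ nb)
  B≥0 : 0ℚ ≤ B
  B≥0 = /-nonNeg (proj₁ nb) 1
  hx : ∀ k → ∣ seq x k ∣ ≤ B
  hx k = ≤-trans (proj₂ (proj₂ Bx) k) (proj₂ nb)
  cS = expSum-cauchy (proj₁ nb)
  E = bounded (expSum B) cS
  open ≤-Reasoning
  bound : ∀ m n → ∣ expSum (seq x m) m - expSum (seq x n) n ∣ ≤
    proj₁ E * ∣ seq x m - seq x n ∣ + 1ℚ * ∣ expSum B m - expSum B n ∣
  bound m n = begin
    ∣ expSum (seq x m) m - expSum (seq x n) n ∣ ≤⟨ triangle (expSum (seq x m) m) (expSum (seq x n) m) (expSum (seq x n) n) ⟩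
    ∣ expSum (seq x m) m - expSum (seq x n) m ∣ + ∣ expSum (seq x n) m - expSum (seq x n) n ∣ ≤⟨ +-mono-≤
           (≤-trans (sum-lip B≥0 (hx m) (hx n) m)
             (monoʳ (0≤∣p∣ (seq x m - seq x n)) (≤-trans (x≤∣x∣ (expSum B m)) (proj₂ (proj₂ E) m))))
           (subst (∣ expSum (seq x n) m - expSum (seq x n) n ∣ ≤_) (sym (*-identityˡ ∣ expSum B m - expSum B n ∣)) (sum-tail B≥0 (hx n) m n)) ⟩
    proj₁ E * ∣ seq x m - seq x n ∣ + 1ℚ * ∣ expSum B m - expSum B n ∣ ∎

⌊⁴√_⌋ : ℕ → ℕ
⌊⁴√ zero ⌋  = 0
⌊⁴√ suc m ⌋ with suc ⌊⁴√ m ⌋ ℕ.^ 4 ℕₚ.≤? suc m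
... | yes _ = suc ⌊⁴√ m ⌋
... | no  _ = ⌊⁴√ m ⌋

⌊⁴√⌋-lower : ∀ m → ⌊⁴√ m ⌋ ℕ.^ 4 ℕ.≤ m
⌊⁴√⌋-lower zero = ℕ.z≤n
⌊⁴√⌋-lower (suc m) with suc ⌊⁴√ m ⌋ ℕ.^ 4 ℕₚ.≤? suc m
... | yes h = h
... | no  _ = ℕₚ.m≤n⇒m≤1+n (⌊⁴√⌋-lower m)

⌊⁴√⌋-upper : ∀ m → m ℕ.< suc ⌊⁴√ m ⌋ ℕ.^ 4
⌊⁴√⌋-upper zero = ℕ.s≤s ℕ.z≤n
⌊⁴√⌋-upper (suc m) with suc ⌊⁴√ m ⌋ ℕ.^ 4 ℕₚ.≤? suc m
... | yes _ = ℕₚ.≤-<-trans (⌊⁴√⌋-upper m) (ℕₚ.^-monoˡ-< 4 (ℕₚ.n<1+n (suc ⌊⁴√ m ⌋)))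
... | no  h = ℕₚ.≰⇒> h

^4-distrib-* : ∀ x y → (x ℕ.* y) ℕ.^ 4 ≡ x ℕ.^ 4 ℕ.* y ℕ.^ 4
^4-distrib-* = ℕsolve 2 (λ x y → (x :*ℕ y) :^ℕ 4 :=ℕ x :^ℕ 4 :*ℕ y :^ℕ 4) refl

module _ (p d : ℕ) .{{_ : ℕ.NonZero d}} where

  -- ⌊ (p/d)^{1/4} · (k+1) ⌋, by rootNum-lower and rootNum-upper below
  rootNum : ℕ → ℕ
  rootNum k = ⌊⁴√ p ℕ.* suc k ℕ.^ 4 DivMod./ d ⌋

  rootNum-lower : ∀ k → rootNum k ℕ.^ 4 ℕ.* d ℕ.≤ p ℕ.* suc k ℕ.^ 4
  rootNum-lower k = ℕₚ.≤-trans (ℕₚ.*-monoˡ-≤ d (⌊⁴√⌋-lower (x DivMod./ d))) (DivMod.m/n*n≤m x d)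
    where x = p ℕ.* suc k ℕ.^ 4

  rootNum-upper : ∀ k → p ℕ.* suc k ℕ.^ 4 ℕ.< suc (rootNum k) ℕ.^ 4 ℕ.* d
  rootNum-upper k = begin-strict
    x                                ≡⟨ DivMod.m≡m%n+[m/n]*n x d ⟩
    x DivMod.% d ℕ.+ x DivMod./ d ℕ.* d <⟨ ℕₚ.+-monoˡ-< (x DivMod./ d ℕ.* d) (DivMod.m%n<n x d) ⟩
    suc (x DivMod./ d) ℕ.* d         ≤⟨ ℕₚ.*-monoˡ-≤ d (⌊⁴√⌋-upper (x DivMod./ d)) ⟩
    suc (rootNum k) ℕ.^ 4 ℕ.* d      ∎
    where
    open ℕₚ.≤-Reasoning
    x = p ℕ.* suc k ℕ.^ 4

  rootNum-close : ∀ k m → rootNum k ℕ.* suc m ℕ.≤ suc (rootNum m) ℕ.* suc k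
  rootNum-close k m with suc (rootNum m) ℕ.* suc k ℕₚ.≤? rootNum k ℕ.* suc m
  ... | no  h = ℕₚ.<⇒≤ (ℕₚ.≰⇒> h)
  ... | yes h = contradiction (begin-strict
      p ℕ.* M ℕ.^ 4 ℕ.* K ℕ.^ 4     <⟨ ℕₚ.*-monoˡ-< (K ℕ.^ 4) {{ℕₚ.m^n≢0 K 4}} (rootNum-upper m) ⟩
      b ℕ.^ 4 ℕ.* d ℕ.* K ℕ.^ 4     ≡⟨ swap (b ℕ.^ 4) d (K ℕ.^ 4) ⟩
      b ℕ.^ 4 ℕ.* K ℕ.^ 4 ℕ.* d     ≡⟨ cong (ℕ._* d) (^4-distrib-* b K) ⟨
      (b ℕ.* K) ℕ.^ 4 ℕ.* d         ≤⟨ ℕₚ.*-monoˡ-≤ d (ℕₚ.^-monoˡ-≤ 4 h) ⟩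
      (a ℕ.* M) ℕ.^ 4 ℕ.* d         ≡⟨ cong (ℕ._* d) (^4-distrib-* a M) ⟩
      a ℕ.^ 4 ℕ.* M ℕ.^ 4 ℕ.* d     ≡⟨ swap (a ℕ.^ 4) (M ℕ.^ 4) d ⟩
      a ℕ.^ 4 ℕ.* d ℕ.* M ℕ.^ 4     ≤⟨ ℕₚ.*-monoˡ-≤ (M ℕ.^ 4) (rootNum-lower k) ⟩
      p ℕ.* K ℕ.^ 4 ℕ.* M ℕ.^ 4     ≡⟨ swap p (K ℕ.^ 4) (M ℕ.^ 4) ⟩
      p ℕ.* M ℕ.^ 4 ℕ.* K ℕ.^ 4     ∎) (ℕₚ.<-irrefl refl)
    where
    open ℕₚ.≤-Reasoning
    a = rootNum k
    b = suc (rootNum m)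
    K = suc k
    M = suc m
    swap : ∀ x y z → x ℕ.* y ℕ.* z ≡ x ℕ.* z ℕ.* y
    swap x y z = trans (ℕₚ.*-assoc x y z) (trans (cong (x ℕ.*_) (ℕₚ.*-comm y z)) (sym (ℕₚ.*-assoc x z y)))

  rootSeq : ℕ → ℚ
  rootSeq k = + rootNum k / suc k

  rootSeq-close : ∀ k m → rootSeq k - rootSeq m ≤ + 1 / suc m
  rootSeq-close k m = sub≤ {rootSeq k} {rootSeq m} {+ 1 / suc m} (begin
    rootSeq k                          ≤⟨ /-mono (+ a) (+ suc b) (suc k) (suc m) (subst₂ ℤ._≤_ (ℤₚ.pos-* a (suc m)) (ℤₚ.pos-* (suc b) (suc k)) (ℤ.+≤+ (rootNum-close k m))) ⟩
    + suc b / suc m                    ≡⟨ *-/-cancelʳ ⟩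
    rootSeq m + + 1 / suc m            ∎)
    where
    open ≤-Reasoning
    a = rootNum k
    b = rootNum m
    *-/-cancelʳ : + suc b / suc m ≡ rootSeq m + + 1 / suc m
    *-/-cancelʳ = sym (trans (/-+ (+ b) (+ 1) (suc m) (suc m))
      (/-≡ (+ b ℤ.* + suc m ℤ.+ + 1 ℤ.* + suc m) (+ suc b) (suc m ℕ.* suc m) (suc m)
        (trans (cong (ℤ._* + suc m) (trans (sym (ℤₚ.*-distribʳ-+ (+ suc m) (+ b) (+ 1))) (cong (λ u → + u ℤ.* + suc m) (ℕₚ.+-comm b 1))))
        (trans (ℤₚ.*-assoc (+ suc b) (+ suc m) (+ suc m)) (cong (+ suc b ℤ.*_) (sym (ℤₚ.pos-* (suc m) (suc m))))))))

  -- (p/d)^{1/4}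
  ⁴√ : ℝ
  ⁴√ = mkℝ rootSeq λ ε ε>0 → proj₁ (archimedean ε>0) , λ m n hm hn → ∣x∣≤
    (≤-trans (rootSeq-close m n) (≤-trans (1/-anti hn) (proj₂ (archimedean ε>0))))
    (subst (_≤ ε) (solve 2 (λ a b → b :- a := :- (a :- b)) refl (rootSeq m) (rootSeq n))
      (≤-trans (rootSeq-close n m) (≤-trans (1/-anti hm) (proj₂ (archimedean ε>0)))))

  rootNum-pos : 1 ℕ.≤ p → ∀ k → 2 ℕ.* d ℕ.≤ k → suc k ℕ.≤ rootNum k ℕ.* (2 ℕ.* d)
  rootNum-pos p≥1 k 2d≤k with suc (rootNum k) ℕ.* d ℕₚ.≤? suc k
  ... | yes h = contradiction (begin-strict
      p ℕ.* suc k ℕ.^ 4               <⟨ rootNum-upper k ⟩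
      b ℕ.^ 4 ℕ.* d                   ≤⟨ ℕₚ.*-monoʳ-≤ (b ℕ.^ 4) (ℕₚ.m≤m*n d (d ℕ.^ 3) {{ℕₚ.m^n≢0 d 3}}) ⟩
      b ℕ.^ 4 ℕ.* d ℕ.^ 4             ≡⟨ ^4-distrib-* b d ⟨
      (b ℕ.* d) ℕ.^ 4                 ≤⟨ ℕₚ.^-monoˡ-≤ 4 h ⟩
      suc k ℕ.^ 4                     ≤⟨ ℕₚ.m≤n*m (suc k ℕ.^ 4) p {{ℕ.>-nonZero p≥1}} ⟩
      p ℕ.* suc k ℕ.^ 4               ∎) (ℕₚ.<-irrefl refl)
    where
    open ℕₚ.≤-Reasoning
    b = suc (rootNum k)
  ... | no h = ℕₚ.+-cancelʳ-≤ (suc k) (suc k) (r ℕ.* (2 ℕ.* d)) (begin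
      suc k ℕ.+ suc k                 ≤⟨ ℕₚ.+-mono-≤ lt lt ⟩
      (d ℕ.+ r ℕ.* d) ℕ.+ (d ℕ.+ r ℕ.* d) ≡⟨ ℕsolve 2 (λ r d → (d :+ℕ r :*ℕ d) :+ℕ (d :+ℕ r :*ℕ d) :=ℕ r :*ℕ (d :+ℕ (d :+ℕ conℕ 0)) :+ℕ (d :+ℕ (d :+ℕ conℕ 0))) refl r d ⟩
      r ℕ.* (2 ℕ.* d) ℕ.+ 2 ℕ.* d     ≤⟨ ℕₚ.+-monoʳ-≤ (r ℕ.* (2 ℕ.* d)) (ℕₚ.m≤n⇒m≤1+n 2d≤k) ⟩
      r ℕ.* (2 ℕ.* d) ℕ.+ suc k       ∎)
    where
    open ℕₚ.≤-Reasoning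
    r = rootNum k
    lt : suc k ℕ.≤ d ℕ.+ r ℕ.* d
    lt = ℕₚ.<⇒≤ (ℕₚ.≰⇒> h)

  ⁴√-pos : .{{_ : ℕ.NonZero p}} → fromℚ 0ℚ <ℝ ⁴√
  ⁴√-pos = (+ 1 / (2 ℕ.* d)) , /-pos 1 (2 ℕ.* d) , 2 ℕ.* d , λ k h →
    subst (_≤ rootSeq k) (sym (+-identityˡ (+ 1 / (2 ℕ.* d))))
      (/-mono (+ 1) (+ rootNum k) (2 ℕ.* d) (suc k)
        (subst₂ ℤ._≤_ (sym (ℤₚ.*-identityˡ (+ suc k))) (ℤₚ.pos-* (rootNum k) (2 ℕ.* d))
          (ℤ.+≤+ (rootNum-pos (ℕ.>-nonZero⁻¹ p) k h))))
    where
    instance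
      2d≢0 : ℕ.NonZero (2 ℕ.* d)
      2d≢0 = ℕₚ.m*n≢0 2 d

-- Plane trees with integer vertex labels; the order of children is the list
-- order.  A vertex is represented by the subtree hanging from it.
data Tree : Set where
  node : ℤ → List Tree → Tree

label : Tree → ℤ
label (node x _) = x

mutual
  edges : Tree → ℕ
  edges (node _ ts) = forestEdges ts

  forestEdges : List Tree → ℕ
  forestEdges []       = 0
  forestEdges (t ∷ ts) = suc (edges t ℕ.+ forestEdges ts)

data Admissible : Tree → Set

-- |label(child) − label(parent)| ≤ 1, and recursively inside the child's subtree
Below : ℤ → Tree → Set
Below x c = ℤ.∣ label c ℤ.- x ∣ ℕ.≤ 1 × Admissible c

data Admissible where
  node : ∀ {x ts} → All (Below x) ts → Admissible (node x ts)

record IsLabelledTree (n : ℕ) (U : Tree) : Set where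
  field
    edges≡n    : edges U ≡ n
    root≡0     : label U ≡ 0ℤ
    admissible : Admissible U

mutual
  -- v₀, v₁, …, v₂ₙ: the walk returns to t after exploring each child.
  contour : Tree → List Tree
  contour t@(node _ ts) = t ∷ excursions t ts

  excursions : Tree → List Tree → List Tree
  excursions t []       = []
  excursions t (c ∷ cs) = contour c ++ t ∷ excursions t cs

mutual
  length-contour : ∀ t → length (contour t) ≡ suc (2 ℕ.* edges t)
  length-contour t@(node _ ts) = cong suc (length-excursions t ts)

  length-excursions : ∀ t cs → length (excursions t cs) ≡ 2 ℕ.* forestEdges cs
  length-excursions t []       = refl
  length-excursions t (c ∷ cs) = begin
    length (contour c ++ t ∷ excursions t cs)                 ≡⟨ length-++ (contour c) ⟩
    length (contour c) ℕ.+ suc (length (excursions t cs))     ≡⟨ cong₂ (λ a b → a ℕ.+ suc b) (length-contour c) (length-excursions t cs) ⟩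
    suc (2 ℕ.* edges c) ℕ.+ suc (2 ℕ.* forestEdges cs)        ≡⟨ ℕsolve 2 (λ a b → (conℕ 1 :+ℕ conℕ 2 :*ℕ a) :+ℕ (conℕ 1 :+ℕ conℕ 2 :*ℕ b) :=ℕ conℕ 2 :*ℕ (conℕ 1 :+ℕ (a :+ℕ b))) refl (edges c) (forestEdges cs) ⟩
    2 ℕ.* suc (edges c ℕ.+ forestEdges cs)                    ∎
    where open ≡-Reasoning

V : (U : Tree) → Fin (length (contour U)) → ℤ
V U t = label (lookup (contour U) t)

steps : List ℤ
steps = -1ℤ ∷ 0ℤ ∷ 1ℤ ∷ []

graft : ℤ → List Tree → List Tree → List Tree
graft y cs rest = node y cs ∷ rest

-- forests f x n enumerates the ordered forests that can hang below a vertex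
-- labelled x using n edges in total (the edges to the forest's roots included),
-- provided n ≤ f.  The first tree has i edges and root label x + δ.
forests : (fuel : ℕ) → ℤ → ℕ → List (List Tree)
splits  : (fuel : ℕ) → ℤ → ℕ → ℕ × ℤ → List (List Tree)

forests _       x zero    = [] ∷ []
forests zero    x (suc n) = []
forests (suc f) x (suc n) = concatMap (splits f x n) (cartesianProduct (upTo (suc n)) steps)

splits f x n (i , δ) =
  cartesianProductWith (graft (x ℤ.+ δ)) (forests f (x ℤ.+ δ) i) (forests f x (n ℕ.∸ i))

-- Ω-sound, Ω-complete and Ω-unique below show that Ω n lists every labelled
-- tree with n edges exactly once.
Ω : ℕ → List Tree
Ω n = map (node 0ℤ) (forests n 0ℤ n)

shift-diff : ∀ x δ → x ℤ.+ δ ℤ.- x ≡ δ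
shift-diff x δ = begin
  x ℤ.+ δ ℤ.- x       ≡⟨ cong (ℤ._- x) (ℤₚ.+-comm x δ) ⟩
  δ ℤ.+ x ℤ.- x       ≡⟨ ℤₚ.+-assoc δ x (ℤ.- x) ⟩
  δ ℤ.+ (x ℤ.- x)     ≡⟨ cong (λ u → δ ℤ.+ u) (ℤₚ.+-inverseʳ x) ⟩
  δ ℤ.+ 0ℤ            ≡⟨ ℤₚ.+-identityʳ δ ⟩
  δ                   ∎
  where open ≡-Reasoning

add-diff : ∀ x y → x ℤ.+ (y ℤ.- x) ≡ y
add-diff x y = trans (sym (ℤₚ.+-assoc x y (ℤ.- x))) (shift-diff x y)

∈-steps⁻ : ∀ {δ} → δ ∈ steps → ℤ.∣ δ ∣ ℕ.≤ 1
∈-steps⁻ (here refl)                 = ℕ.s≤s ℕ.z≤n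
∈-steps⁻ (there (here refl))         = ℕ.z≤n
∈-steps⁻ (there (there (here refl))) = ℕ.s≤s ℕ.z≤n

∈-steps⁺ : ∀ δ → ℤ.∣ δ ∣ ℕ.≤ 1 → δ ∈ steps
∈-steps⁺ (+ 0)            _ = there (here refl)
∈-steps⁺ (+ 1)            _ = there (there (here refl))
∈-steps⁺ (+ suc (suc _))  (ℕ.s≤s ())
∈-steps⁺ ℤ.-[1+ 0 ]       _ = here refl
∈-steps⁺ ℤ.-[1+ suc _ ]   (ℕ.s≤s ())

forests-sound : ∀ f x n {ts} → ts ∈ forests f x n → forestEdges ts ≡ n × All (Below x) ts
forests-sound zero    x zero    (here refl) = refl , []
forests-sound (suc f) x zero    (here refl) = refl , []
forests-sound (suc f) x (suc n) ts∈
  with (i , δ) , iδ∈ , ts∈′ ← find (∈-concatMap⁻ (splits f x n) {cartesianProduct (upTo (suc n)) steps} ts∈)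
  with i∈ , δ∈ ← ∈-cartesianProduct⁻ (upTo (suc n)) steps iδ∈
  with cs , rest , cs∈ , rest∈ , refl ← ∈-cartesianProductWith⁻ (graft (x ℤ.+ δ))
         (forests f (x ℤ.+ δ) i) (forests f x (n ℕ.∸ i)) ts∈′
  with csE , csA ← forests-sound f (x ℤ.+ δ) i cs∈
  with restE , restA ← forests-sound f x (n ℕ.∸ i) rest∈
  = cong suc (trans (cong₂ ℕ._+_ csE restE) (ℕₚ.m+[n∸m]≡n (ℕₚ.≤-pred (∈-upTo⁻ i∈))))
  , (subst (λ u → ℤ.∣ u ∣ ℕ.≤ 1) (sym (shift-diff x δ)) (∈-steps⁻ δ∈) , node csA) ∷ restA

forests-complete : ∀ f x ts → forestEdges ts ℕ.≤ f → All (Below x) ts → ts ∈ forests f x (forestEdges ts)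
forests-complete zero    x [] _ _ = here refl
forests-complete (suc f) x [] _ _ = here refl
forests-complete (suc f) x (node y cs ∷ ts) (ℕ.s≤s n≤f) ((near , node csA) ∷ tsA) =
  ∈-concatMap⁺ (splits f x n) (lose (∈-cartesianProduct⁺ (∈-upTo⁺ (ℕ.s≤s i≤n)) (∈-steps⁺ (y ℤ.- x) near)) member)
  where
  i = forestEdges cs
  n = i ℕ.+ forestEdges ts
  i≤n : i ℕ.≤ n
  i≤n = ℕₚ.m≤m+n i (forestEdges ts)
  member : node y cs ∷ ts ∈ splits f x n (i , y ℤ.- x)
  member = subst (λ z → node y cs ∷ ts ∈ cartesianProductWith (graft z) (forests f z i) (forests f x (n ℕ.∸ i)))
    (sym (add-diff x y))
    (∈-cartesianProductWith⁺ (graft y)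
      (forests-complete f y cs (ℕₚ.≤-trans i≤n n≤f) csA)
      (subst (λ k → ts ∈ forests f x k) (sym (ℕₚ.m+n∸m≡n i (forestEdges ts)))
        (forests-complete f x ts (ℕₚ.≤-trans (ℕₚ.m≤n+m (forestEdges ts) i) n≤f) tsA)))

graft-injective : ∀ y {cs cs′ rest rest′} → graft y cs rest ≡ graft y cs′ rest′ → cs ≡ cs′ × rest ≡ rest′
graft-injective y refl = refl , refl

steps-unique : Unique steps
steps-unique = ((λ ()) ∷ (λ ()) ∷ []) ∷ ((λ ()) ∷ []) ∷ [] ∷ []

splits-disjoint : ∀ f x n {p q} → p ≢ q → Disjoint (splits f x n p) (splits f x n q)
splits-disjoint f x n {i , δ} {j , η} p≢q (v∈p , v∈q)
  with cs , rest , cs∈ , _ , refl ← ∈-cartesianProductWith⁻ (graft (x ℤ.+ δ))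
         (forests f (x ℤ.+ δ) i) (forests f x (n ℕ.∸ i)) v∈p
  with cs′ , rest′ , cs′∈ , _ , eq ← ∈-cartesianProductWith⁻ (graft (x ℤ.+ η))
         (forests f (x ℤ.+ η) j) (forests f x (n ℕ.∸ j)) v∈q
  = p≢q (cong₂ _,_
      (trans (sym (proj₁ (forests-sound f _ i cs∈)))
        (trans (cong forestEdges (same-children eq)) (proj₁ (forests-sound f _ j cs′∈))))
      (trans (sym (shift-diff x δ)) (trans (cong (ℤ._- x) (same-label eq)) (shift-diff x η))))
  where
  same-children : ∀ {y z as bs us vs} → graft y as us ≡ graft z bs vs → as ≡ bs
  same-children refl = refl
  same-label : ∀ {y z as bs us vs} → graft y as us ≡ graft z bs vs → y ≡ z
  same-label refl = refl

forests-unique : ∀ f x n → Unique (forests f x n)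
splits-unique  : ∀ f x n p → Unique (splits f x n p)

forests-unique zero    x zero    = [] ∷ []
forests-unique (suc f) x zero    = [] ∷ []
forests-unique zero    x (suc n) = []
forests-unique (suc f) x (suc n) = Unique.concat⁺ {xss = map (splits f x n) idx}
  (Allₚ.map⁺ (All.universal (splits-unique f x n) idx))
  (AllPairsₚ.map⁺ {f = splits f x n} {xs = idx} (AllPairs.map (splits-disjoint f x n)
    (Unique.cartesianProduct⁺ (Unique.upTo⁺ (suc n)) steps-unique)))
  where idx = cartesianProduct (upTo (suc n)) steps

splits-unique f x n (i , δ) =
  Unique.cartesianProductWith⁺ (graft (x ℤ.+ δ)) (graft-injective (x ℤ.+ δ))
    (forests-unique f (x ℤ.+ δ) i) (forests-unique f x (n ℕ.∸ i))

Ω-sound : ∀ {n U} → U ∈ Ω n → IsLabelledTree n U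
Ω-sound {n} U∈ with ts , ts∈ , refl ← ∈-map⁻ (node 0ℤ) U∈
  with e , a ← forests-sound n 0ℤ n ts∈ =
  record { edges≡n = e ; root≡0 = refl ; admissible = node a }

Ω-complete : ∀ {n U} → IsLabelledTree n U → U ∈ Ω n
Ω-complete {U = node _ ts} record { edges≡n = refl ; root≡0 = refl ; admissible = node a } =
  ∈-map⁺ (node 0ℤ) (forests-complete (forestEdges ts) 0ℤ ts ℕₚ.≤-refl a)

Ω-unique : ∀ n → Unique (Ω n)
Ω-unique n = Unique.map⁺ (λ { refl → refl }) (forests-unique n 0ℤ n)

path : ℕ → Tree
path zero    = node 0ℤ []
path (suc n) = node 0ℤ (path n ∷ [])

path-isLabelledTree : ∀ n → IsLabelledTree n (path n)
path-isLabelledTree zero = record { edges≡n = refl ; root≡0 = refl ; admissible = node [] }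
path-isLabelledTree (suc n) with record { edges≡n = e ; root≡0 = r ; admissible = a } ← path-isLabelledTree n =
  record { edges≡n = cong suc (trans (ℕₚ.+-identityʳ _) e) ; root≡0 = refl
         ; admissible = node ((subst (λ u → ℤ.∣ u ℤ.- 0ℤ ∣ ℕ.≤ 1) (sym r) ℕ.z≤n , a) ∷ []) }

∣Ω∣≢0 : ∀ n → ℕ.NonZero (length (Ω n))
∣Ω∣≢0 n = nonempty (Ω-complete (path-isLabelledTree n))
  where
  nonempty : ∀ {U : Tree} {Us} → U ∈ Us → ℕ.NonZero (length Us)
  nonempty (here _)  = _
  nonempty (there _) = _

-- Uniform probability of a decidable event: favourable cases over all cases.
prob : ℕ → (Tree → Bool) → ℚ
prob n A = (+ length (filterᵇ A (Ω n)) / length (Ω n)) {{∣Ω∣≢0 n}}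

-- ℙ(E) ≤ p for the uniform measure.  An event defined by comparing reals need
-- not be decidable, so the bound is required of every decidable A contained in
-- E.  If E is itself decidable, A = E is allowed, and since prob is monotone
-- this is exactly prob(E) ≤ p.
ℙ[_∣_]≤_ : ℕ → (Tree → Set) → ℝ → Set
ℙ[ n ∣ E ]≤ p = (A : Tree → Bool) → (∀ U → IsLabelledTree n U → A U ≡ true → E U) → fromℚ (prob n A) ≤ℝ p

infixl 7 _÷ℝ_⟨_⟩
_÷ℝ_⟨_⟩ : ℝ → (y : ℝ) → fromℚ 0ℚ <ℝ y → ℝ
x ÷ℝ y ⟨ y>0 ⟩ = x *ℝ recip y y>0

IsFloor : ℝ → ℕ → Set
IsFloor r k = fromℚ (fromℕ k) ≤ℝ r × r <ℝ fromℚ (fromℕ (suc k))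

-- (8n/9)^{1/4}
scale : ℕ → ℝ
scale n = ⁴√ (8 ℕ.* n) 9

scale-pos : ∀ n .{{_ : ℕ.NonZero n}} → fromℚ 0ℚ <ℝ scale n
scale-pos n = ⁴√-pos (8 ℕ.* n) 9 {{_}} {{ℕₚ.m*n≢0 8 n}}

-- A time s ∈ [0,1] together with ⌊2ns⌋, an index of the contour walk.  The floor
-- is carried as data because it is not computable from a Cauchy real;
-- classically it exists and is unique, and 2ns ≤ 2n keeps it in range by
-- length-contour.
record Time (n : ℕ) (U : Tree) : Set where
  field
    s     : ℝ
    0≤s   : fromℚ 0ℚ ≤ℝ s
    s≤1   : s ≤ℝ fromℚ 1ℚ
    step  : Fin (length (contour U))
    floor : IsFloor (fromℚ (fromℕ (2 ℕ.* n)) *ℝ s) (toℕ step)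

Ŵ : (n : ℕ) .{{_ : ℕ.NonZero n}} (U : Tree) → Time n U → ℝ
Ŵ n U τ = fromℚ (V U (Time.step τ) / 1) ÷ℝ scale n ⟨ scale-pos n ⟩

IsSup : {I : Set} → (I → ℝ) → ℝ → Set
IsSup {I} f M = (∀ i → f i ≤ℝ M) × (∀ b → (∀ i → f i ≤ℝ b) → M ≤ℝ b)

-- The supremum of f exists and exceeds a.  For f = Ŵ n U existence always holds
-- (supŴ-exists), so this is just the comparison of the supremum with a.
Sup_>_ : {I : Set} → (I → ℝ) → ℝ → Set
Sup f > a = ∃ λ M → IsSup f M × a <ℝ M

≤ℝ-termwise : ∀ {x y} → (∀ k → seq x k ≤ seq y k) → x ≤ℝ y
≤ℝ-termwise {x} {y} h (ε , ε>0 , N , y+ε≤x) = <-irrefl refl (begin-strict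
  seq y N        ≡⟨ +-identityʳ (seq y N) ⟨
  seq y N + 0ℚ   <⟨ +-monoʳ-< (seq y N) ε>0 ⟩
  seq y N + ε    ≤⟨ y+ε≤x N ℕₚ.≤-refl ⟩
  seq x N        ≤⟨ h N ⟩
  seq y N        ∎)
  where open ≤-Reasoning

recip-nonNeg : ∀ x (x>0 : fromℚ 0ℚ <ℝ x) k → 0ℚ ≤ seq (recip x x>0) k
recip-nonNeg x (ε , ε>0 , N , h) k = <⇒≤ (positive⁻¹ _ {{1/pos⇒pos (seq x (N ℕ.+ k)) {{ℚ.positive
  (<-≤-trans ε>0 (subst (_≤ seq x (N ℕ.+ k)) (+-identityˡ ε) (h (N ℕ.+ k) (ℕₚ.m≤m+n N k))))}}}})

argmax : ∀ {m} (f : Fin (suc m) → ℤ) → ∃ λ i → ∀ j → f j ℤ.≤ f i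
argmax {zero}  f = zero , λ { zero → ℤₚ.≤-refl }
argmax {suc m} f with i , max ← argmax (λ j → f (suc j)) = case (ℤₚ.≤-total (f zero) (f (suc i)))
  where
  case : f zero ℤ.≤ f (suc i) ⊎ f (suc i) ℤ.≤ f zero → ∃ λ i → ∀ j → f j ℤ.≤ f i
  case (inj₁ h) = suc i , λ { zero → h ; (suc j) → max j }
  case (inj₂ h) = zero , λ { zero → ℤₚ.≤-refl ; (suc j) → ℤₚ.≤-trans (max j) h }

argmax-V : ∀ U → ∃ λ i → ∀ j → V U j ℤ.≤ V U i
argmax-V U@(node _ _) = argmax (V U)

module _ (n : ℕ) .{{_ : ℕ.NonZero n}} (U : Tree) (isLT : IsLabelledTree n U) where

  step≤2n : (k : Fin (length (contour U))) → toℕ k ℕ.≤ 2 ℕ.* n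
  step≤2n k = ℕₚ.≤-pred (subst (toℕ k ℕ.<_)
    (trans (length-contour U) (cong (λ e → suc (2 ℕ.* e)) (IsLabelledTree.edges≡n isLT))) (toℕ<n k))

  timeAt : Fin (length (contour U)) → Time n U
  timeAt k = record
    { s     = fromℚ (+ j / 2n)
    ; 0≤s   = ≤ℝ-termwise {fromℚ 0ℚ} {fromℚ (+ j / 2n)} (λ _ → /-nonNeg j 2n)
    ; s≤1   = ≤ℝ-termwise {fromℚ (+ j / 2n)} {fromℚ 1ℚ} (λ _ → /-mono (+ j) (+ 1) 2n 1
                (subst₂ ℤ._≤_ (sym (ℤₚ.*-identityʳ (+ j))) (sym (ℤₚ.*-identityˡ (+ 2n))) (ℤ.+≤+ (step≤2n k))))
    ; step  = k
    ; floor = ≤ℝ-termwise {fromℚ (fromℕ j)} {fromℚ (fromℕ 2n) *ℝ fromℚ (+ j / 2n)}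
                (λ _ → ≤-reflexive (sym 2ns≡j))
            , 1ℚ , 0<1 , 0 , λ _ _ → ≤-reflexive (trans (cong (_+ 1ℚ) 2ns≡j) (sym (fromℕ-suc j)))
    }
    where
    j  = toℕ k
    2n = 2 ℕ.* n
    instance
      2n≢0 : ℕ.NonZero 2n
      2n≢0 = ℕₚ.m*n≢0 2 n
    2ns≡j : fromℕ 2n * (+ j / 2n) ≡ fromℕ j
    2ns≡j = *-/-cancel (+ j) 2n

  supŴ-exists : ∃ (IsSup (Ŵ n U))
  supŴ-exists = Ŵ n U (timeAt i)
    , (λ τ → ≤ℝ-termwise {Ŵ n U τ} {Ŵ n U (timeAt i)} λ k →
        monoʳ (recip-nonNeg (scale n) (scale-pos n) k)
          (/-mono (V U (Time.step τ)) (V U i) 1 1 (ℤₚ.*-monoʳ-≤-nonNeg (+ 1) (max (Time.step τ)))))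
    , λ b bound → bound (timeAt i)
    where
    i   = proj₁ (argmax-V U)
    max = proj₂ (argmax-V U)

module Submission where

open import Defs
open import Data.Nat.Base using (ℕ; NonZero)
open import Data.Rational.Base using (0ℚ)
open import Data.Product.Base using (∃-syntax; _×_)
open import Data.Bool.Base using (Bool; true; false; _∧_)
open import Data.Bool.Properties using (∧-conicalˡ; ∧-conicalʳ; ¬-not)
open import Data.Integer.Base as ℤ using (ℤ)
import Data.Integer.Properties as ℤₚ
open import Data.List.Base using (List; []; _∷_; _++_; length; map; concatMap; cartesianProduct; cartesianProductWith; applyUpTo; filterᵇ)
open import Data.List.Properties using (filter-++; length-++)
open import Data.List.Membership.Propositional using (_∈_)
open import Data.List.Membership.Propositional.Properties using (∈-lookup)
open import Data.List.Relation.Unary.All as All using (All; []; _∷_)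
open import Data.List.Relation.Unary.All.Properties using (++⁺)
open import Data.List.Relation.Unary.Any using (here; there)
open import Data.Nat.Base as ℕ using (zero; suc; _∸_)
import Data.Nat.Properties as ℕₚ
open import Data.Nat.Solver using () renaming (module +-*-Solver to ℕ-Solver)
open import Data.Product.Base using (_,_; proj₁; proj₂)
open import Data.Rational.Base as ℚ using (ℚ; 1ℚ; ½; _/_; ∣_∣; _≤_; _<_; _+_; _*_; _-_; -_; 1/_)
open import Data.Rational.Properties as ℚₚ using (≤-refl; ≤-reflexive; ≤-trans; <⇒≤; +-mono-≤; module ≤-Reasoning)
open import Data.Rational.Solver using (module +-*-Solver)
open import Data.Sum.Base using (inj₁; inj₂)
open import Function.Base using (_∘_)
open import Relation.Binary.PropositionalEquality using (_≡_; refl; sym; trans; cong; cong₂; subst; subst₂; module ≡-Reasoning)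
open import Relation.Nullary.Decidable using (T?; does; dec-true; dec-false; yes; no)
open import Relation.Nullary.Negation.Core using (contradiction)

open ℕ-Solver using () renaming (solve to ℕsolve; _:=_ to _:=ℕ_; _:+_ to _:+ℕ_; _:*_ to _:*ℕ_; _:^_ to _:^ℕ_; con to conℕ)
open +-*-Solver using (solve; _:=_; _:+_; _:*_; :-_; _:-_; con)

-- Let φₙ(j) be the probability that the labels of Uₙ reach j.  Three facts
-- combine to φₙ(q + i) ≤ C xⁱ for n ≤ q⁴, with x = q / (q + κ) and C depending
-- on κ only.
--  * φₙ(j) is nondecreasing in n, because a uniform plane tree with n + 1 edges
--    can be grown from one with n edges, compatibly with the decomposition at
--    the first child (Luczak and Winkler).
--  * The generating functions F_j(g) = Σ 3ⁿ Catₙ φₙ(j) gⁿ satisfy a monotone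
--    recursion in j, so they lie below any supersolution: below
--    4 / ((j + 1) (j + 2)) for every g ≤ 1/12, and below a multiple of xʲ for g
--    slightly subcritical.  Starting the geometric decay at j = q gives
--    F_{q+i}(g) ≤ 4 q⁻² xⁱ.
--  * The sizes in [q⁴ , 16 q⁴) carry mass of order q⁻² in Σ 3ᵐ Catₘ 12⁻ᵐ, and
--    passing from 1/12 to g costs only a bounded factor on them.  By
--    monotonicity F_j(g) is at least φₙ(j) times this mass, and q⁻² cancels.
-- Since n^{1/4} is comparable to q, reaching a multiple y of n^{1/4} takes i of
-- order y q, where xⁱ ≤ (1 + κ)^{-i/q}; a large κ beats e^{-y}.

-- A bound on the generating function controls only an average of the hitting probabilities over
-- sizes; monotonicity in the size takes the place of singularity analysis in extracting a bound for
-- a single n. Nothing has to converge either: the series are truncated, the truncation of a product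
-- lies below the product of the truncations, and the order of truncation is the induction variable
-- of the comparisons. The exponent 1/4 arises from two square roots. For a decay rate x = 1 / (1 +
-- θ), the value R of the full generating function falls short of its critical value 2 by order θ²,
-- and R has a square-root singularity in g, so g falls short of 1/12 by order θ⁴. At θ = κ / q,
-- sizes of order q⁴ therefore lose only a constant factor, at most 2 to the power 32 κ⁴, while
-- every further q levels gain a factor 1 + κ.

-- Rational arithmetic

fromℕ-nonNeg : ∀ n → 0ℚ ≤ fromℕ n
fromℕ-nonNeg n = /-nonNeg n 1

fromℕ-+ : ∀ m n → fromℕ (m ℕ.+ n) ≡ fromℕ m + fromℕ n
fromℕ-+ zero    n = sym (ℚₚ.+-identityˡ (fromℕ n))
fromℕ-+ (suc m) n = begin
  fromℕ (suc (m ℕ.+ n))       ≡⟨ fromℕ-suc (m ℕ.+ n) ⟩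
  fromℕ (m ℕ.+ n) + 1ℚ        ≡⟨ cong (_+ 1ℚ) (fromℕ-+ m n) ⟩
  fromℕ m + fromℕ n + 1ℚ      ≡⟨ solve 2 (λ a b → a :+ b :+ con 1ℚ := a :+ con 1ℚ :+ b) refl (fromℕ m) (fromℕ n) ⟩
  fromℕ m + 1ℚ + fromℕ n      ≡⟨ cong (_+ fromℕ n) (fromℕ-suc m) ⟨
  fromℕ (suc m) + fromℕ n     ∎
  where open ≡-Reasoning

fromℕ-* : ∀ m n → fromℕ (m ℕ.* n) ≡ fromℕ m * fromℕ n
fromℕ-* zero    n = sym (ℚₚ.*-zeroˡ (fromℕ n))
fromℕ-* (suc m) n = begin
  fromℕ (n ℕ.+ m ℕ.* n)            ≡⟨ fromℕ-+ n (m ℕ.* n) ⟩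
  fromℕ n + fromℕ (m ℕ.* n)        ≡⟨ cong (fromℕ n +_) (fromℕ-* m n) ⟩
  fromℕ n + fromℕ m * fromℕ n      ≡⟨ solve 2 (λ a b → b :+ a :* b := (a :+ con 1ℚ) :* b) refl (fromℕ m) (fromℕ n) ⟩
  (fromℕ m + 1ℚ) * fromℕ n         ≡⟨ cong (_* fromℕ n) (fromℕ-suc m) ⟨
  fromℕ (suc m) * fromℕ n          ∎
  where open ≡-Reasoning

fromℕ-cancel-≤ : ∀ {m n} → fromℕ m ≤ fromℕ n → m ℕ.≤ n
fromℕ-cancel-≤ {m} {n} h with m ℕₚ.≤? n
... | yes m≤n = m≤n
... | no  m≰n = contradiction
  (ℚₚ.<-≤-trans (ℚₚ.+-monoʳ-< (fromℕ n) 0<1)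
    (≤-trans (≤-reflexive (sym (fromℕ-suc n))) (≤-trans (fromℕ-mono (ℕₚ.≰⇒> m≰n)) (≤-trans h (≤-reflexive (sym (ℚₚ.+-identityʳ (fromℕ n))))))))
  (ℚₚ.<-irrefl refl)

inv : ℕ → ℚ
inv n = ℤ.+ 1 / suc n

inv-nonNeg : ∀ n → 0ℚ ≤ inv n
inv-nonNeg n = /-nonNeg 1 (suc n)

fromℕ-inv : ∀ n → (fromℕ n + 1ℚ) * inv n ≡ 1ℚ
fromℕ-inv n = trans (cong (_* inv n) (sym (fromℕ-suc n))) (*-/-cancel (ℤ.+ 1) (suc n))

reciprocal : ∀ p → 0ℚ < p → ∃[ p′ ] 0ℚ < p′ × p * p′ ≡ 1ℚ
reciprocal p p>0 = (1/ p) {{p≢0}}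
  , ℚₚ.positive⁻¹ _ {{ℚₚ.1/pos⇒pos p {{ℚ.positive p>0}}}}
  , ℚₚ.*-inverseʳ p {{p≢0}}
  where p≢0 = ℚ.>-nonZero p>0

*-cancelˡ-≤ : ∀ {r p q} → 0ℚ < r → r * p ≤ r * q → p ≤ q
*-cancelˡ-≤ {r} r>0 = ℚₚ.*-cancelˡ-≤-pos r {{ℚ.positive r>0}}

≤-by : ∀ {a b} d → 0ℚ ≤ d → b ≡ a + d → a ≤ b
≤-by {a} d d≥0 eq = subst (a ≤_) (sym eq) (p≤p+q d≥0)

square-nonNeg : ∀ y → 0ℚ ≤ y * y
square-nonNeg y with ℚₚ.≤-total 0ℚ y
... | inj₁ y≥0 = *-nonNeg y≥0 y≥0
... | inj₂ y≤0 = subst (0ℚ ≤_) (solve 1 (λ y → :- y :* :- y := y :* y) refl y) (*-nonNeg (ℚₚ.neg-antimono-≤ y≤0) (ℚₚ.neg-antimono-≤ y≤0))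

square≤1 : ∀ {x} → x * x ≤ 1ℚ → x ≤ 1ℚ
square≤1 {x} h with ℚₚ.≤-total x 1ℚ
... | inj₁ x≤1 = x≤1
... | inj₂ 1≤x = ≤-trans (≤-trans (≤-reflexive (sym (ℚₚ.*-identityʳ x)))
  (monoˡ (≤-trans (<⇒≤ 0<1) 1≤x) 1≤x)) h

1≤square : ∀ {x} → 0ℚ ≤ x → 1ℚ ≤ x * x → 1ℚ ≤ x
1≤square {x} x≥0 h with ℚₚ.≤-total 1ℚ x
... | inj₁ 1≤x = 1≤x
... | inj₂ x≤1 = ≤-trans h (≤-trans (monoˡ x≥0 x≤1) (≤-reflexive (ℚₚ.*-identityʳ x)))

-- Powers and Bernoulli inequalities

infixr 8 _^_
_^_ : ℚ → ℕ → ℚ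
x ^ zero  = 1ℚ
x ^ suc n = x * x ^ n

^-nonNeg : ∀ {x} → 0ℚ ≤ x → ∀ n → 0ℚ ≤ x ^ n
^-nonNeg x≥0 zero    = <⇒≤ 0<1
^-nonNeg x≥0 (suc n) = *-nonNeg x≥0 (^-nonNeg x≥0 n)

^-pos : ∀ {x} → 0ℚ < x → ∀ n → 0ℚ < x ^ n
^-pos x>0 zero    = 0<1
^-pos x>0 (suc n) = *-pos x>0 (^-pos x>0 n)

^-distribˡ-+ : ∀ x m n → x ^ (m ℕ.+ n) ≡ x ^ m * x ^ n
^-distribˡ-+ x zero    n = sym (ℚₚ.*-identityˡ (x ^ n))
^-distribˡ-+ x (suc m) n = trans (cong (x *_) (^-distribˡ-+ x m n)) (sym (ℚₚ.*-assoc x (x ^ m) (x ^ n)))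

^-*-assoc : ∀ x m n → x ^ (m ℕ.* n) ≡ (x ^ n) ^ m
^-*-assoc x zero    n = refl
^-*-assoc x (suc m) n = trans (^-distribˡ-+ x n (m ℕ.* n)) (cong (x ^ n *_) (^-*-assoc x m n))

^-distribʳ-* : ∀ x y n → (x * y) ^ n ≡ x ^ n * y ^ n
^-distribʳ-* x y zero    = refl
^-distribʳ-* x y (suc n) = trans (cong (x * y *_) (^-distribʳ-* x y n))
  (solve 4 (λ x y a b → x :* y :* (a :* b) := x :* a :* (y :* b)) refl x y (x ^ n) (y ^ n))

1^ : ∀ n → 1ℚ ^ n ≡ 1ℚ
1^ zero    = refl
1^ (suc n) = trans (ℚₚ.*-identityˡ (1ℚ ^ n)) (1^ n)

^-monoˡ : ∀ {x y} → 0ℚ ≤ x → x ≤ y → ∀ n → x ^ n ≤ y ^ n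
^-monoˡ x≥0 x≤y zero    = ≤-refl
^-monoˡ x≥0 x≤y (suc n) = *-mono (^-nonNeg x≥0 n) (≤-trans x≥0 x≤y) x≤y (^-monoˡ x≥0 x≤y n)

1≤^ : ∀ {x} → 1ℚ ≤ x → ∀ n → 1ℚ ≤ x ^ n
1≤^ {x} 1≤x n = subst (_≤ x ^ n) (1^ n) (^-monoˡ (<⇒≤ 0<1) 1≤x n)

^-monoʳ : ∀ {x} → 1ℚ ≤ x → ∀ {m n} → m ℕ.≤ n → x ^ m ≤ x ^ n
^-monoʳ {x} 1≤x {m} {n} m≤n = subst₂ _≤_ (ℚₚ.*-identityʳ (x ^ m))
  (trans (sym (^-distribˡ-+ x m (n ∸ m))) (cong (x ^_) (ℕₚ.m+[n∸m]≡n m≤n)))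
  (monoˡ (^-nonNeg (≤-trans (<⇒≤ 0<1) 1≤x) m) (1≤^ 1≤x (n ∸ m)))

fromℕ-^ : ∀ m n → fromℕ (m ℕ.^ n) ≡ fromℕ m ^ n
fromℕ-^ m zero    = refl
fromℕ-^ m (suc n) = trans (fromℕ-* m (m ℕ.^ n)) (cong (fromℕ m *_) (fromℕ-^ m n))

bernoulli⁺ : ∀ {u} → 0ℚ ≤ u → ∀ n → 1ℚ + fromℕ n * u ≤ (1ℚ + u) ^ n
bernoulli⁺ {u} u≥0 zero = ≤-reflexive (solve 1 (λ u → con 1ℚ :+ con 0ℚ :* u := con 1ℚ) refl u)
bernoulli⁺ {u} u≥0 (suc n) = begin
  1ℚ + fromℕ (suc n) * u          ≡⟨ cong (λ a → 1ℚ + a * u) (fromℕ-suc n) ⟩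
  1ℚ + (fromℕ n + 1ℚ) * u         ≤⟨ ≤-by (u * (fromℕ n * u)) (*-nonNeg u≥0 (*-nonNeg (fromℕ-nonNeg n) u≥0))
                                      (solve 2 (λ a u → (con 1ℚ :+ u) :* (con 1ℚ :+ a :* u) := con 1ℚ :+ (a :+ con 1ℚ) :* u :+ u :* (a :* u)) refl (fromℕ n) u) ⟩
  (1ℚ + u) * (1ℚ + fromℕ n * u)   ≤⟨ monoˡ (+-nonNeg (<⇒≤ 0<1) u≥0) (bernoulli⁺ u≥0 n) ⟩
  (1ℚ + u) * (1ℚ + u) ^ n         ∎
  where open ≤-Reasoning

bernoulli⁻ : ∀ {u} → 0ℚ ≤ u → u ≤ 1ℚ → ∀ n → 1ℚ - fromℕ n * u ≤ (1ℚ - u) ^ n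
bernoulli⁻ {u} u≥0 u≤1 zero = ≤-reflexive (solve 1 (λ u → con 1ℚ :- con 0ℚ :* u := con 1ℚ) refl u)
bernoulli⁻ {u} u≥0 u≤1 (suc n) = begin
  1ℚ - fromℕ (suc n) * u          ≡⟨ cong (λ a → 1ℚ - a * u) (fromℕ-suc n) ⟩
  1ℚ - (fromℕ n + 1ℚ) * u         ≤⟨ ≤-by (u * (fromℕ n * u)) (*-nonNeg u≥0 (*-nonNeg (fromℕ-nonNeg n) u≥0))
                                      (solve 2 (λ a u → (con 1ℚ :- u) :* (con 1ℚ :- a :* u) := con 1ℚ :- (a :+ con 1ℚ) :* u :+ u :* (a :* u)) refl (fromℕ n) u) ⟩
  (1ℚ - u) * (1ℚ - fromℕ n * u)   ≤⟨ monoˡ (diff-nonNeg u≤1) (bernoulli⁻ u≥0 u≤1 n) ⟩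
  (1ℚ - u) * (1ℚ - u) ^ n         ∎
  where open ≤-Reasoning

-- A converse to Bernoulli on the range where the linear bound has at most doubled. At k = m with 2
-- m u = 1 it gives (1 + 1/(2m))ᵐ ≤ 2, the only upper bound on a large power that is used.
[1+u]^k≤1+2ku : ∀ {u} → 0ℚ ≤ u → ∀ m → fromℕ m * (u + u) ≤ 1ℚ → ∀ k → k ℕ.≤ m →
  (1ℚ + u) ^ k ≤ 1ℚ + fromℕ k * (u + u)
[1+u]^k≤1+2ku {u} u≥0 m h zero _ = ≤-reflexive (solve 1 (λ u → con 1ℚ := con 1ℚ :+ con 0ℚ :* (u :+ u)) refl u)
[1+u]^k≤1+2ku {u} u≥0 m h (suc k) k<m = begin
  (1ℚ + u) * (1ℚ + u) ^ k                 ≤⟨ monoˡ (+-nonNeg (<⇒≤ 0<1) u≥0) ([1+u]^k≤1+2ku u≥0 m h k (ℕₚ.<⇒≤ k<m)) ⟩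
  (1ℚ + u) * (1ℚ + a * (u + u))           ≤⟨ ≤-by (u * (1ℚ - a * (u + u))) (*-nonNeg u≥0 (diff-nonNeg k2u≤1))
                                              (solve 2 (λ a u → con 1ℚ :+ (a :+ con 1ℚ) :* (u :+ u) :=
                                                (con 1ℚ :+ u) :* (con 1ℚ :+ a :* (u :+ u)) :+ u :* (con 1ℚ :- a :* (u :+ u))) refl a u) ⟩
  1ℚ + (a + 1ℚ) * (u + u)                 ≡⟨ cong (λ b → 1ℚ + b * (u + u)) (fromℕ-suc k) ⟨
  1ℚ + fromℕ (suc k) * (u + u)            ∎
  where
  open ≤-Reasoning
  a = fromℕ k
  k2u≤1 : a * (u + u) ≤ 1ℚ
  k2u≤1 = ≤-trans (monoʳ (+-nonNeg u≥0 u≥0) (fromℕ-mono (ℕₚ.<⇒≤ k<m))) h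

-- Finite sums, convolutions and truncated power series

Σ< : ℕ → (ℕ → ℚ) → ℚ
Σ< zero    h = 0ℚ
Σ< (suc n) h = h 0 + Σ< n (h ∘ suc)

Σ<-cong : ∀ n {h k} → (∀ i → h i ≡ k i) → Σ< n h ≡ Σ< n k
Σ<-cong zero    eq = refl
Σ<-cong (suc n) eq = cong₂ _+_ (eq 0) (Σ<-cong n (eq ∘ suc))

Σ<-mono : ∀ n {h k} → (∀ i → i ℕ.< n → h i ≤ k i) → Σ< n h ≤ Σ< n k
Σ<-mono zero    le = ≤-refl
Σ<-mono (suc n) le = +-mono-≤ (le 0 ℕ.z<s) (Σ<-mono n (λ i i<n → le (suc i) (ℕ.s<s i<n)))

Σ<-nonNeg : ∀ n {h} → (∀ i → 0ℚ ≤ h i) → 0ℚ ≤ Σ< n h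
Σ<-nonNeg zero    h≥0 = ≤-refl
Σ<-nonNeg (suc n) h≥0 = +-nonNeg (h≥0 0) (Σ<-nonNeg n (h≥0 ∘ suc))

Σ<-+ : ∀ n h k → Σ< n (λ i → h i + k i) ≡ Σ< n h + Σ< n k
Σ<-+ zero    h k = refl
Σ<-+ (suc n) h k = trans (cong (h 0 + k 0 +_) (Σ<-+ n (h ∘ suc) (k ∘ suc)))
  (solve 4 (λ a b c d → a :+ b :+ (c :+ d) := a :+ c :+ (b :+ d)) refl (h 0) (k 0) (Σ< n (h ∘ suc)) (Σ< n (k ∘ suc)))

Σ<-*ˡ : ∀ n c h → Σ< n (λ i → c * h i) ≡ c * Σ< n h
Σ<-*ˡ zero    c h = sym (ℚₚ.*-zeroʳ c)
Σ<-*ˡ (suc n) c h = trans (cong (c * h 0 +_) (Σ<-*ˡ n c (h ∘ suc))) (sym (ℚₚ.*-distribˡ-+ c (h 0) (Σ< n (h ∘ suc))))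

Σ<-++ : ∀ m n h → Σ< (m ℕ.+ n) h ≡ Σ< m h + Σ< n (λ i → h (m ℕ.+ i))
Σ<-++ zero    n h = sym (ℚₚ.+-identityˡ (Σ< n h))
Σ<-++ (suc m) n h = trans (cong (h 0 +_) (Σ<-++ m n (h ∘ suc))) (sym (ℚₚ.+-assoc (h 0) (Σ< m (h ∘ suc)) _))

Σ<-telescope : ∀ n (b : ℕ → ℚ) → Σ< n (λ i → b i - b (suc i)) ≡ b 0 - b n
Σ<-telescope zero    b = sym (ℚₚ.+-inverseʳ (b 0))
Σ<-telescope (suc n) b = trans (cong (b 0 - b 1 +_) (Σ<-telescope n (b ∘ suc)))
  (solve 3 (λ x y z → x :- y :+ (y :- z) := x :- z) refl (b 0) (b 1) (b (suc n)))

-- Δ n h = Σ_{i + k = n} h i k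
Δ : ℕ → (ℕ → ℕ → ℚ) → ℚ
Δ zero    h = h 0 0
Δ (suc n) h = h 0 (suc n) + Δ n (h ∘ suc)

Δ-cong : ∀ n {h k} → (∀ i j → i ℕ.+ j ≡ n → h i j ≡ k i j) → Δ n h ≡ Δ n k
Δ-cong zero    eq = eq 0 0 refl
Δ-cong (suc n) eq = cong₂ _+_ (eq 0 (suc n) refl) (Δ-cong n (λ i j e → eq (suc i) j (cong suc e)))

Δ-mono : ∀ n {h k} → (∀ i j → i ℕ.+ j ≡ n → h i j ≤ k i j) → Δ n h ≤ Δ n k
Δ-mono zero    le = le 0 0 refl
Δ-mono (suc n) le = +-mono-≤ (le 0 (suc n) refl) (Δ-mono n (λ i j e → le (suc i) j (cong suc e)))

Δ-nonNeg : ∀ n {h} → (∀ i j → 0ℚ ≤ h i j) → 0ℚ ≤ Δ n h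
Δ-nonNeg zero    h≥0 = h≥0 0 0
Δ-nonNeg (suc n) h≥0 = +-nonNeg (h≥0 0 (suc n)) (Δ-nonNeg n (h≥0 ∘ suc))

Δ-+ : ∀ n h k → Δ n (λ i j → h i j + k i j) ≡ Δ n h + Δ n k
Δ-+ zero    h k = refl
Δ-+ (suc n) h k = trans (cong (h 0 (suc n) + k 0 (suc n) +_) (Δ-+ n (h ∘ suc) (k ∘ suc)))
  (solve 4 (λ a b c d → a :+ b :+ (c :+ d) := a :+ c :+ (b :+ d)) refl (h 0 (suc n)) (k 0 (suc n)) (Δ n (h ∘ suc)) (Δ n (k ∘ suc)))

Δ-*ˡ : ∀ n c h → Δ n (λ i j → c * h i j) ≡ c * Δ n h
Δ-*ˡ zero    c h = refl
Δ-*ˡ (suc n) c h = trans (cong (c * h 0 (suc n) +_) (Δ-*ˡ n c (h ∘ suc))) (sym (ℚₚ.*-distribˡ-+ c (h 0 (suc n)) (Δ n (h ∘ suc))))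

Δ-snoc : ∀ n h → Δ (suc n) h ≡ Δ n (λ i j → h i (suc j)) + h (suc n) 0
Δ-snoc zero    h = refl
Δ-snoc (suc n) h = trans (cong (h 0 (suc (suc n)) +_) (Δ-snoc n (h ∘ suc)))
  (sym (ℚₚ.+-assoc (h 0 (suc (suc n))) (Δ n (λ i j → h (suc i) (suc j))) (h (suc (suc n)) 0)))

conv : (ℕ → ℚ) → (ℕ → ℚ) → ℕ → ℚ
conv h k n = Δ n (λ i j → h i * k j)

-- The left side runs over the triangle i + j < M, the right side over the whole square, and all
-- terms are nonnegative.
Σ<-conv-≤ : ∀ {h k} → (∀ i → 0ℚ ≤ h i) → (∀ i → 0ℚ ≤ k i) → ∀ M → Σ< M (conv h k) ≤ Σ< M h * Σ< M k
Σ<-conv-≤ {h} {k} h≥0 k≥0 M = ≤-trans (≤-reflexive (front h M)) (bound h h≥0 M)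
  where
  front : ∀ h M → Σ< M (conv h k) ≡ Σ< M (λ i → h i * Σ< (M ∸ i) k)
  front h zero    = refl
  front h (suc M) = begin
    h 0 * k 0 + Σ< M (λ m → h 0 * k (suc m) + conv (h ∘ suc) k m)
      ≡⟨ cong (h 0 * k 0 +_) (Σ<-+ M (λ m → h 0 * k (suc m)) (conv (h ∘ suc) k)) ⟩
    h 0 * k 0 + (Σ< M (λ m → h 0 * k (suc m)) + Σ< M (conv (h ∘ suc) k))
      ≡⟨ cong₂ (λ a b → h 0 * k 0 + (a + b)) (Σ<-*ˡ M (h 0) (k ∘ suc)) (front (h ∘ suc) M) ⟩
    h 0 * k 0 + (h 0 * K + H)
      ≡⟨ solve 4 (λ a b c d → a :* b :+ (a :* c :+ d) := a :* (b :+ c) :+ d) refl (h 0) (k 0) K H ⟩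
    h 0 * (k 0 + K) + H ∎
    where
    open ≡-Reasoning
    K = Σ< M (k ∘ suc)
    H = Σ< M (λ i → h (suc i) * Σ< (M ∸ i) k)
  Σ<-∸ : ∀ M i → i ℕ.≤ M → Σ< (M ∸ i) k ≤ Σ< M k
  Σ<-∸ M i i≤M = ≤-by _ (Σ<-nonNeg i (λ j → k≥0 (M ∸ i ℕ.+ j)))
    (trans (cong (λ m → Σ< m k) (sym (ℕₚ.m∸n+n≡m i≤M))) (Σ<-++ (M ∸ i) i k))
  bound : ∀ h → (∀ i → 0ℚ ≤ h i) → ∀ M → Σ< M (λ i → h i * Σ< (M ∸ i) k) ≤ Σ< M h * Σ< M k
  bound h h≥0 M = ≤-trans (Σ<-mono M (λ i i<M → monoˡ (h≥0 i) (Σ<-∸ M i (ℕₚ.<⇒≤ i<M))))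
    (≤-reflexive (trans (Σ<-cong M (λ i → ℚₚ.*-comm (h i) (Σ< M k)))
      (trans (Σ<-*ˡ M (Σ< M k) h) (ℚₚ.*-comm (Σ< M k) (Σ< M h)))))

[_]_⟨_⟩ : ℕ → (ℕ → ℚ) → ℚ → ℚ
[ M ] h ⟨ g ⟩ = Σ< M (λ m → h m * g ^ m)

conv-^ : ∀ g h k n → conv h k n * g ^ n ≡ conv (λ i → h i * g ^ i) (λ i → k i * g ^ i) n
conv-^ g h k n = trans (ℚₚ.*-comm (conv h k n) (g ^ n)) (trans (sym (Δ-*ˡ n (g ^ n) (λ i j → h i * k j)))
  (Δ-cong n λ { i j refl → trans (cong (_* (h i * k j)) (^-distribˡ-+ g i j))
    (solve 4 (λ a b x y → a :* b :* (x :* y) := x :* a :* (y :* b)) refl (g ^ i) (g ^ j) (h i) (k j)) }))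

[]-conv-≤ : ∀ {g h k} → 0ℚ ≤ g → (∀ i → 0ℚ ≤ h i) → (∀ i → 0ℚ ≤ k i) → ∀ M →
  [ M ] conv h k ⟨ g ⟩ ≤ [ M ] h ⟨ g ⟩ * [ M ] k ⟨ g ⟩
[]-conv-≤ {g} {h} {k} g≥0 h≥0 k≥0 M = ≤-trans (≤-reflexive (Σ<-cong M (conv-^ g h k)))
  (Σ<-conv-≤ (λ i → *-nonNeg (h≥0 i) (^-nonNeg g≥0 i)) (λ i → *-nonNeg (k≥0 i) (^-nonNeg g≥0 i)) M)

[]-cong : ∀ M g {h k} → (∀ i → h i ≡ k i) → [ M ] h ⟨ g ⟩ ≡ [ M ] k ⟨ g ⟩
[]-cong M g eq = Σ<-cong M (λ i → cong (_* g ^ i) (eq i))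

[]-+ : ∀ M g h k → [ M ] (λ i → h i + k i) ⟨ g ⟩ ≡ [ M ] h ⟨ g ⟩ + [ M ] k ⟨ g ⟩
[]-+ M g h k = trans (Σ<-cong M (λ i → ℚₚ.*-distribʳ-+ (g ^ i) (h i) (k i))) (Σ<-+ M _ _)

[]-*ˡ : ∀ M g c h → [ M ] (λ i → c * h i) ⟨ g ⟩ ≡ c * [ M ] h ⟨ g ⟩
[]-*ˡ M g c h = trans (Σ<-cong M (λ i → ℚₚ.*-assoc c (h i) (g ^ i))) (Σ<-*ˡ M c _)

[]-suc : ∀ M g h → [ suc M ] h ⟨ g ⟩ ≡ h 0 + g * [ M ] (h ∘ suc) ⟨ g ⟩
[]-suc M g h = cong₂ _+_ (ℚₚ.*-identityʳ (h 0))
  (trans (Σ<-cong M (λ i → solve 3 (λ a b c → a :* (b :* c) := b :* (a :* c)) refl (h (suc i)) g (g ^ i))) (Σ<-*ˡ M g _))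

[]-nonNeg : ∀ M {g h} → 0ℚ ≤ g → (∀ i → 0ℚ ≤ h i) → 0ℚ ≤ [ M ] h ⟨ g ⟩
[]-nonNeg M g≥0 h≥0 = Σ<-nonNeg M (λ i → *-nonNeg (h≥0 i) (^-nonNeg g≥0 i))

[]-mono : ∀ M {g h k} → 0ℚ ≤ g → (∀ i → h i ≤ k i) → [ M ] h ⟨ g ⟩ ≤ [ M ] k ⟨ g ⟩
[]-mono M g≥0 le = Σ<-mono M (λ i _ → monoʳ (^-nonNeg g≥0 i) (le i))

-- Catalan weights and their growth

inv-suc : ∀ n → (fromℕ n + fromℕ 2) * inv (suc n) ≡ 1ℚ
inv-suc n = trans (cong (_* inv (suc n))
  (trans (solve 1 (λ a → a :+ con (fromℕ 2) := a :+ con 1ℚ :+ con 1ℚ) refl (fromℕ n)) (cong (_+ 1ℚ) (sym (fromℕ-suc n)))))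
  (fromℕ-inv (suc n))

inv-odd : ∀ n → (fromℕ 2 * fromℕ n + 1ℚ) * inv (2 ℕ.* n) ≡ 1ℚ
inv-odd n = trans (cong (λ a → (a + 1ℚ) * inv (2 ℕ.* n)) (sym (fromℕ-* 2 n))) (fromℕ-inv (2 ℕ.* n))

-- Three times the quotient 2 (2n + 1) / (n + 2) of consecutive Catalan numbers.
ratio : ℕ → ℚ
ratio n = fromℕ 6 * (fromℕ 2 * fromℕ n + 1ℚ) * inv (suc n)

ratio⁻¹ : ℕ → ℚ
ratio⁻¹ n = inv 5 * (fromℕ n + fromℕ 2) * inv (2 ℕ.* n)

-- t n = 3ⁿ Catₙ is the number of labelled trees with n edges.
t : ℕ → ℚ
t zero    = 1ℚ
t (suc n) = t n * ratio n

-- The inverse is itself a product of explicit ratios, so that identities between weights reduce to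
-- ring identities and the unit laws of `inv`.
t⁻¹ : ℕ → ℚ
t⁻¹ zero    = 1ℚ
t⁻¹ (suc n) = t⁻¹ n * ratio⁻¹ n

t-inverse : ∀ n → t n * t⁻¹ n ≡ 1ℚ
t-inverse zero    = refl
t-inverse (suc n) = begin
  t n * (fromℕ 6 * (fromℕ 2 * a + 1ℚ) * r) * (t⁻¹ n * (inv 5 * (a + fromℕ 2) * o))
    ≡⟨ solve 5 (λ x y a r o → x :* (con (fromℕ 6) :* (con (fromℕ 2) :* a :+ con 1ℚ) :* r) :* (y :* (con (inv 5) :* (a :+ con (fromℕ 2)) :* o))
         := x :* y :* ((con (fromℕ 2) :* a :+ con 1ℚ) :* o :* ((a :+ con (fromℕ 2)) :* r))) refl (t n) (t⁻¹ n) a r o ⟩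
  t n * t⁻¹ n * ((fromℕ 2 * a + 1ℚ) * o * ((a + fromℕ 2) * r))
    ≡⟨ cong₂ _*_ (t-inverse n) (cong₂ _*_ (inv-odd n) (inv-suc n)) ⟩
  1ℚ ∎
  where
  open ≡-Reasoning
  a = fromℕ n
  r = inv (suc n)
  o = inv (2 ℕ.* n)

odd-nonNeg : ∀ n → 0ℚ ≤ fromℕ 2 * fromℕ n + 1ℚ
odd-nonNeg n = +-nonNeg (*-nonNeg (fromℕ-nonNeg 2) (fromℕ-nonNeg n)) (<⇒≤ 0<1)

t-nonNeg : ∀ n → 0ℚ ≤ t n
t-nonNeg zero    = <⇒≤ 0<1
t-nonNeg (suc n) = *-nonNeg (t-nonNeg n) (*-nonNeg (*-nonNeg (fromℕ-nonNeg 6) (odd-nonNeg n)) (inv-nonNeg (suc n)))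

t⁻¹-nonNeg : ∀ n → 0ℚ ≤ t⁻¹ n
t⁻¹-nonNeg zero    = <⇒≤ 0<1
t⁻¹-nonNeg (suc n) = *-nonNeg (t⁻¹-nonNeg n)
  (*-nonNeg (*-nonNeg (inv-nonNeg 5) (+-nonNeg (fromℕ-nonNeg n) (fromℕ-nonNeg 2))) (inv-nonNeg (2 ℕ.* n)))

-- In a uniform tree with i + k + 1 edges, the probability that the subtree
-- hanging from the first child has i of them.
w : ℕ → ℕ → ℚ
w i k = fromℕ 3 * t i * t k * t⁻¹ (suc (i ℕ.+ k))

w-nonNeg : ∀ i k → 0ℚ ≤ w i k
w-nonNeg i k = *-nonNeg (*-nonNeg (*-nonNeg (fromℕ-nonNeg 3) (t-nonNeg i)) (t-nonNeg k)) (t⁻¹-nonNeg (suc (i ℕ.+ k)))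

w-comm : ∀ i k → w i k ≡ w k i
w-comm i k = cong₂ _*_ (solve 3 (λ c x y → c :* x :* y := c :* y :* x) refl (fromℕ 3) (t i) (t k))
  (cong (λ n → t⁻¹ (suc n)) (ℕₚ.+-comm i k))

-- The inverse of (n + 1) (n + 2) (2n + 3), the common denominator of the growth probabilities.
d : ℕ → ℚ
d n = inv n * inv (suc n) * inv (2 ℕ.* suc n)

d-unit : ∀ n → (fromℕ n + 1ℚ) * (fromℕ n + fromℕ 2) * (fromℕ 2 * (fromℕ n + 1ℚ) + 1ℚ) * d n ≡ 1ℚ
d-unit n = begin
  x * y * z * (inv n * inv (suc n) * o)    ≡⟨ solve 6 (λ x y z p q o → x :* y :* z :* (p :* q :* o) := x :* p :* (y :* q) :* (z :* o)) refl x y z (inv n) (inv (suc n)) o ⟩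
  x * inv n * (y * inv (suc n)) * (z * o)  ≡⟨ cong₂ _*_ (cong₂ _*_ (fromℕ-inv n) (inv-suc n))
                                               (trans (cong (λ b → (fromℕ 2 * b + 1ℚ) * o) (sym (fromℕ-suc n))) (inv-odd (suc n))) ⟩
  1ℚ                                       ∎
  where
  open ≡-Reasoning
  x = fromℕ n + 1ℚ
  y = fromℕ n + fromℕ 2
  z = fromℕ 2 * (fromℕ n + 1ℚ) + 1ℚ
  o = inv (2 ℕ.* suc n)

-- A uniform tree with n + 2 edges arises from one with n + 1 = i + k + 1 edges,
-- split as (i , k), by growing the first part with probability grow i k.
-- The closed form comes from solving w-grow successively for i = 0, 1, …
growNum : ℚ → ℚ → ℚ
growNum a b = (a + 1ℚ) * (fromℕ 2 * a + 1ℚ) * (a + fromℕ 3 * b + fromℕ 3)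

grow : ℕ → ℕ → ℚ
grow i k = growNum (fromℕ i) (fromℕ k) * d (i ℕ.+ k)

grow-nonNeg : ∀ i k → 0ℚ ≤ grow i k
grow-nonNeg i k = *-nonNeg
  (*-nonNeg (*-nonNeg (+-nonNeg (fromℕ-nonNeg i) (<⇒≤ 0<1)) (odd-nonNeg i))
    (+-nonNeg (+-nonNeg (fromℕ-nonNeg i) (*-nonNeg (fromℕ-nonNeg 3) (fromℕ-nonNeg k))) (fromℕ-nonNeg 3)))
  (*-nonNeg (*-nonNeg (inv-nonNeg (i ℕ.+ k)) (inv-nonNeg (suc (i ℕ.+ k)))) (inv-nonNeg (2 ℕ.* suc (i ℕ.+ k))))

-- By symmetry the second part grows with probability `grow k i`, and the two numerators add up to
-- the denominator inverted by `d`.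
grow-sum : ∀ i k → grow k i + grow i k ≡ 1ℚ
grow-sum i k = begin
  growNum b a * d (k ℕ.+ i) + growNum a b * D   ≡⟨ cong (λ n → growNum b a * d n + growNum a b * D) (ℕₚ.+-comm k i) ⟩
  growNum b a * D + growNum a b * D             ≡⟨ solve 3 (λ a b D →
      (b :+ con 1ℚ) :* (con (fromℕ 2) :* b :+ con 1ℚ) :* (b :+ con (fromℕ 3) :* a :+ con (fromℕ 3)) :* D :+
      (a :+ con 1ℚ) :* (con (fromℕ 2) :* a :+ con 1ℚ) :* (a :+ con (fromℕ 3) :* b :+ con (fromℕ 3)) :* D :=
      (a :+ b :+ con 1ℚ) :* (a :+ b :+ con (fromℕ 2)) :* (con (fromℕ 2) :* (a :+ b :+ con 1ℚ) :+ con 1ℚ) :* D) refl a b D ⟩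
  unit (a + b)                                  ≡⟨ cong unit (fromℕ-+ i k) ⟨
  unit (fromℕ (i ℕ.+ k))                        ≡⟨ d-unit (i ℕ.+ k) ⟩
  1ℚ                                            ∎
  where
  open ≡-Reasoning
  a = fromℕ i
  b = fromℕ k
  D = d (i ℕ.+ k)
  unit : ℚ → ℚ
  unit s = (s + 1ℚ) * (s + fromℕ 2) * (fromℕ 2 * (s + 1ℚ) + 1ℚ) * D

-- A split (i + 1 , k + 1) has two predecessors: (i + 1 , k) with the second part grown, and (i , k
-- + 1) with the first part grown. The two sides carry different denominators; unit factors are
-- inserted on each until a polynomial identity remains.
w-grow : ∀ i k → w (suc i) (suc k) ≡ w (suc i) k * grow k (suc i) + w i (suc k) * grow i (suc k)
w-grow i k = begin
  fromℕ 3 * (t i * ra) * (t k * rb) * (t⁻¹ (suc m) * (inv 5 * (fromℕ (suc m) + fromℕ 2) * O))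
    ≡⟨ cong (λ s → fromℕ 3 * (t i * ra) * (t k * rb) * (t⁻¹ (suc m) * (inv 5 * (s + fromℕ 2) * O))) (trans (fromℕ-suc m) (cong (_+ 1ℚ) M≡)) ⟩
  L                                               ≡⟨ ℚₚ.*-identityʳ L ⟨
  L * 1ℚ                                          ≡⟨ cong (L *_) (cong₂ _*_ (trans (cong (λ s → (s + 1ℚ) * P) (sym M≡)) (fromℕ-inv m)) (trans (cong (λ s → (s + fromℕ 2) * Q) (sym M≡)) (inv-suc m))) ⟨
  L * ((M + 1ℚ) * P * ((M + fromℕ 2) * Q))        ≡⟨ solve 10 (λ x y T a b A B P Q O →
       let 2′ = con (fromℕ 2) ; 3′ = con (fromℕ 3) ; 6′ = con (fromℕ 6) ; 1′ = con 1ℚ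
           M = a :+ (b :+ 1′)
           ra = 6′ :* (2′ :* a :+ 1′) :* A
           rb = 6′ :* (2′ :* b :+ 1′) :* B
           num = λ a b → (a :+ 1′) :* (2′ :* a :+ 1′) :* (a :+ 3′ :* b :+ 3′) in
       3′ :* (x :* ra) :* (y :* rb) :* (T :* (con (inv 5) :* (M :+ 1′ :+ 2′) :* O)) :* ((M :+ 1′) :* P :* ((M :+ 2′) :* Q))
       := 3′ :* (x :* ra) :* y :* T :* (num b (a :+ 1′) :* (P :* Q :* O)) :* ((b :+ 2′) :* B)
       :+ 3′ :* x :* (y :* rb) :* T :* (num a (b :+ 1′) :* (P :* Q :* O)) :* ((a :+ 2′) :* A))
       refl (t i) (t k) (t⁻¹ (suc m)) a b (inv (suc i)) (inv (suc k)) P Q O ⟩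
  R₁ * ((b + fromℕ 2) * inv (suc k)) + R₂ * ((a + fromℕ 2) * inv (suc i))
    ≡⟨ cong₂ _+_ (trans (cong (R₁ *_) (inv-suc k)) (ℚₚ.*-identityʳ R₁)) (trans (cong (R₂ *_) (inv-suc i)) (ℚₚ.*-identityʳ R₂)) ⟩
  R₁ + R₂                                         ≡⟨ cong₂ (λ u v → fromℕ 3 * (t i * ra) * t k * t⁻¹ (suc m) * (growNum b u * d m) + fromℕ 3 * t i * (t k * rb) * t⁻¹ (suc m) * (growNum a v * d m)) (fromℕ-suc i) (fromℕ-suc k) ⟨
  fromℕ 3 * (t i * ra) * t k * t⁻¹ (suc m) * (growNum b (fromℕ (suc i)) * d m) + w i (suc k) * grow i (suc k)
    ≡⟨ cong₂ (λ n n′ → fromℕ 3 * (t i * ra) * t k * t⁻¹ (suc n) * (growNum b (fromℕ (suc i)) * d n′) + w i (suc k) * grow i (suc k)) (sym (ℕₚ.+-suc i k))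
         (trans (ℕₚ.+-suc k i) (trans (cong suc (ℕₚ.+-comm k i)) (sym (ℕₚ.+-suc i k)))) ⟨
  w (suc i) k * grow k (suc i) + w i (suc k) * grow i (suc k) ∎
  where
  open ≡-Reasoning
  m = i ℕ.+ suc k
  a = fromℕ i
  b = fromℕ k
  M = a + (b + 1ℚ)
  M≡ : fromℕ m ≡ M
  M≡ = trans (fromℕ-+ i (suc k)) (cong (a +_) (fromℕ-suc k))
  ra = ratio i
  rb = ratio k
  P = inv m
  Q = inv (suc m)
  O = inv (2 ℕ.* suc m)
  L = fromℕ 3 * (t i * ra) * (t k * rb) * (t⁻¹ (suc m) * (inv 5 * (M + 1ℚ + fromℕ 2) * O))
  R₁ = fromℕ 3 * (t i * ra) * t k * t⁻¹ (suc m) * (growNum b (a + 1ℚ) * d m)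
  R₂ = fromℕ 3 * t i * (t k * rb) * t⁻¹ (suc m) * (growNum a (b + 1ℚ) * d m)

w-growʳ : ∀ k → w 0 (suc k) ≡ w 0 k * grow k 0
w-growʳ k = begin
  fromℕ 3 * 1ℚ * (t k * ratio k) * (T * (inv 5 * (fromℕ (suc k) + fromℕ 2) * O))
    ≡⟨ cong (λ s → fromℕ 3 * 1ℚ * (t k * ratio k) * (T * (inv 5 * (s + fromℕ 2) * O))) (fromℕ-suc k) ⟩
  L                                ≡⟨ ℚₚ.*-identityʳ L ⟨
  L * 1ℚ                           ≡⟨ cong (L *_) (fromℕ-inv k) ⟨
  L * ((b + 1ℚ) * inv k)           ≡⟨ solve 6 (λ y T b P Q O →
       let 2′ = con (fromℕ 2) ; 3′ = con (fromℕ 3) ; 6′ = con (fromℕ 6) ; 1′ = con 1ℚ in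
       3′ :* 1′ :* (y :* (6′ :* (2′ :* b :+ 1′) :* Q)) :* (T :* (con (inv 5) :* (b :+ 1′ :+ 2′) :* O)) :* ((b :+ 1′) :* P)
       := 3′ :* 1′ :* y :* T :* ((b :+ 1′) :* (2′ :* b :+ 1′) :* (b :+ 3′ :* con 0ℚ :+ 3′) :* (P :* Q :* O)))
       refl (t k) T b (inv k) (inv (suc k)) O ⟩
  fromℕ 3 * 1ℚ * t k * T * (growNum b 0ℚ * d k)   ≡⟨ cong (λ n → w 0 k * (growNum b 0ℚ * d n)) (ℕₚ.+-identityʳ k) ⟨
  w 0 k * grow k 0                 ∎
  where
  open ≡-Reasoning
  b = fromℕ k
  T = t⁻¹ (suc k)
  O = inv (2 ℕ.* suc k)
  L = fromℕ 3 * 1ℚ * (t k * ratio k) * (T * (inv 5 * (b + 1ℚ + fromℕ 2) * O))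

w-growˡ : ∀ i → w (suc i) 0 ≡ w i 0 * grow i 0
w-growˡ i = trans (w-comm (suc i) 0) (trans (w-growʳ i) (cong (_* grow i 0) (w-comm 0 i)))

-- `w-grow` summed over all splits: the split of a tree with n + 2 edges has the law of one growth
-- step applied to the split of a tree with n + 1 edges.
Δ-grow : ∀ n (h : ℕ → ℕ → ℚ) → Δ (suc n) (λ i k → w i k * h i k) ≡
  Δ n (λ i k → w i k * (grow k i * h i (suc k) + grow i k * h (suc i) k))
Δ-grow n h = begin
  Δ (suc n) (λ i k → w i k * h i k)              ≡⟨ Δ-cong (suc n) split ⟩
  Δ (suc n) (λ i k → P i k + Q i k)              ≡⟨ Δ-+ (suc n) P Q ⟩
  Δ (suc n) P + Δ (suc n) Q                      ≡⟨ cong₂ _+_ (trans (Δ-snoc n P) (ℚₚ.+-identityʳ (Δ n p))) (ℚₚ.+-identityˡ (Δ n q)) ⟩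
  Δ n p + Δ n q                                  ≡⟨ Δ-+ n p q ⟨
  Δ n (λ i k → p i k + q i k)                    ≡⟨ Δ-cong n (λ i k _ → solve 5 (λ w c x c′ x′ → w :* c :* x :+ w :* c′ :* x′ := w :* (c :* x :+ c′ :* x′)) refl (w i k) (grow k i) (h i (suc k)) (grow i k) (h (suc i) k)) ⟩
  Δ n (λ i k → w i k * (grow k i * h i (suc k) + grow i k * h (suc i) k)) ∎
  where
  open ≡-Reasoning
  p q P Q : ℕ → ℕ → ℚ
  p i k = w i k * grow k i * h i (suc k)
  q i k = w i k * grow i k * h (suc i) k
  -- An empty part cannot have just grown. Padding with 0 on the two axes lets both contributions be
  -- summed over the splits of n + 1.
  P i zero    = 0ℚ
  P i (suc k) = p i k
  Q zero    k = 0ℚ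
  Q (suc i) k = q i k
  split : ∀ i k → i ℕ.+ k ≡ suc n → w i k * h i k ≡ P i k + Q i k
  split zero    (suc k) _ = trans (cong (_* h 0 (suc k)) (w-growʳ k)) (sym (ℚₚ.+-identityʳ (p 0 k)))
  split (suc i) zero    _ = trans (cong (_* h (suc i) 0) (w-growˡ i)) (sym (ℚₚ.+-identityˡ (q i 0)))
  split (suc i) (suc k) _ = trans (cong (_* h (suc i) (suc k)) (w-grow i k))
    (ℚₚ.*-distribʳ-+ (h (suc i) (suc k)) (w (suc i) k * grow k (suc i)) (w i (suc k) * grow i (suc k)))

-- Growth preserves total weight, so the normalisation propagates from the single split of a
-- one-edge tree. The Catalan convolution `t-suc` is deduced from this, `t` having been defined by
-- its ratios.
Δ-w : ∀ n → Δ n w ≡ 1ℚ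
Δ-w zero    = refl
Δ-w (suc n) = begin
  Δ (suc n) w                                             ≡⟨ Δ-cong (suc n) (λ i k _ → sym (ℚₚ.*-identityʳ (w i k))) ⟩
  Δ (suc n) (λ i k → w i k * 1ℚ)                          ≡⟨ Δ-grow n (λ _ _ → 1ℚ) ⟩
  Δ n (λ i k → w i k * (grow k i * 1ℚ + grow i k * 1ℚ))   ≡⟨ Δ-cong n (λ i k _ → trans (cong (w i k *_)
       (trans (cong₂ _+_ (ℚₚ.*-identityʳ (grow k i)) (ℚₚ.*-identityʳ (grow i k))) (grow-sum i k))) (ℚₚ.*-identityʳ (w i k))) ⟩
  Δ n w                                                   ≡⟨ Δ-w n ⟩
  1ℚ                                                      ∎
  where open ≡-Reasoning

t-w : ∀ n (h : ℕ → ℕ → ℚ) → t (suc n) * Δ n (λ i k → w i k * h i k) ≡ Δ n (λ i k → fromℕ 3 * t i * t k * h i k)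
t-w n h = trans (sym (Δ-*ˡ n (t (suc n)) (λ i k → w i k * h i k))) (Δ-cong n λ { i k refl → begin
  t (suc (i ℕ.+ k)) * (fromℕ 3 * t i * t k * t⁻¹ (suc (i ℕ.+ k)) * h i k)
    ≡⟨ solve 4 (λ T x T′ h → T :* (x :* T′ :* h) := T :* T′ :* (x :* h)) refl (t (suc (i ℕ.+ k))) (fromℕ 3 * t i * t k) (t⁻¹ (suc (i ℕ.+ k))) (h i k) ⟩
  t (suc (i ℕ.+ k)) * t⁻¹ (suc (i ℕ.+ k)) * (fromℕ 3 * t i * t k * h i k)
    ≡⟨ trans (cong (_* (fromℕ 3 * t i * t k * h i k)) (t-inverse (suc (i ℕ.+ k)))) (ℚₚ.*-identityˡ _) ⟩
  fromℕ 3 * t i * t k * h i k ∎ })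
  where open ≡-Reasoning

t-suc : ∀ n → t (suc n) ≡ Δ n (λ i k → fromℕ 3 * t i * t k)
t-suc n = begin
  t (suc n)                                   ≡⟨ ℚₚ.*-identityʳ (t (suc n)) ⟨
  t (suc n) * 1ℚ                              ≡⟨ cong (t (suc n) *_) (trans (Δ-cong n (λ i k _ → ℚₚ.*-identityʳ (w i k))) (Δ-w n)) ⟨
  t (suc n) * Δ n (λ i k → w i k * 1ℚ)        ≡⟨ t-w n (λ _ _ → 1ℚ) ⟩
  Δ n (λ i k → fromℕ 3 * t i * t k * 1ℚ)      ≡⟨ Δ-cong n (λ i k _ → ℚₚ.*-identityʳ (fromℕ 3 * t i * t k)) ⟩
  Δ n (λ i k → fromℕ 3 * t i * t k)           ∎
  where open ≡-Reasoning

-- Avoidance probabilities and generating functions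

-- For a vertex j + 1 below the level, a child is j, j + 1 or j + 2 below it, each with probability
-- 1/3.
mean : (ℕ → ℚ) → ℕ → ℚ
mean h j = inv 2 * (h j + h (suc j) + h (suc (suc j)))

mean-nonNeg : ∀ {h} → (∀ j → 0ℚ ≤ h j) → ∀ j → 0ℚ ≤ mean h j
mean-nonNeg h≥0 j = *-nonNeg (inv-nonNeg 2) (+-nonNeg (+-nonNeg (h≥0 j) (h≥0 (suc j))) (h≥0 (suc (suc j))))

mean-mono : ∀ {h k} → (∀ j → h j ≤ k j) → ∀ j → mean h j ≤ mean k j
mean-mono le j = monoˡ (inv-nonNeg 2) (+-mono-≤ (+-mono-≤ (le j) (le (suc j))) (le (suc (suc j))))

-- At level 0 the root itself already reaches the level, whence the value 0. The fuel stands in for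
-- well-founded recursion on n through `Δ`; its exhausted case is never met when n ≤ f.
avoidᶠ : (fuel : ℕ) → ℕ → ℕ → ℚ
avoidᶠ f       n       zero    = 0ℚ
avoidᶠ f       zero    (suc j) = 1ℚ
avoidᶠ zero    (suc n) (suc j) = 0ℚ
avoidᶠ (suc f) (suc n) (suc j) = Δ n (λ i k → w i k * (mean (avoidᶠ f i) j * avoidᶠ f k (suc j)))

-- The probability that the labels of a uniform tree with n edges all stay
-- strictly below root label + j.
avoid : ℕ → ℕ → ℚ
avoid n = avoidᶠ n n

avoidᶠ-stable : ∀ f f′ n j → n ℕ.≤ f → n ℕ.≤ f′ → avoidᶠ f n j ≡ avoidᶠ f′ n j
avoidᶠ-stable f       f′       n       zero    _ _ = refl
avoidᶠ-stable f       f′       zero    (suc j) _ _ = refl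
avoidᶠ-stable (suc f) (suc f′) (suc n) (suc j) (ℕ.s≤s n≤f) (ℕ.s≤s n≤f′) =
  Δ-cong n λ { i k refl → cong (w i k *_) (cong₂ _*_
    (cong (inv 2 *_) (cong₂ _+_ (cong₂ _+_ (left i k j n≤f n≤f′) (left i k (suc j) n≤f n≤f′)) (left i k (suc (suc j)) n≤f n≤f′)))
    (avoidᶠ-stable f f′ k (suc j) (ℕₚ.≤-trans (ℕₚ.m≤n+m k i) n≤f) (ℕₚ.≤-trans (ℕₚ.m≤n+m k i) n≤f′))) }
  where
  left : ∀ i k j → i ℕ.+ k ℕ.≤ f → i ℕ.+ k ℕ.≤ f′ → avoidᶠ f i j ≡ avoidᶠ f′ i j
  left i k j h h′ = avoidᶠ-stable f f′ i j (ℕₚ.≤-trans (ℕₚ.m≤m+n i k) h) (ℕₚ.≤-trans (ℕₚ.m≤m+n i k) h′)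

avoid-suc : ∀ n j → avoid (suc n) (suc j) ≡ Δ n (λ i k → w i k * (mean (avoid i) j * avoid k (suc j)))
avoid-suc n j = Δ-cong n λ { i k refl → cong (w i k *_) (cong₂ _*_
  (cong (inv 2 *_) (cong₂ _+_ (cong₂ _+_ (left i k j) (left i k (suc j))) (left i k (suc (suc j)))))
  (avoidᶠ-stable (i ℕ.+ k) k k (suc j) (ℕₚ.m≤n+m k i) ℕₚ.≤-refl)) }
  where
  left : ∀ i k j → avoidᶠ (i ℕ.+ k) i j ≡ avoid i j
  left i k j = avoidᶠ-stable (i ℕ.+ k) i i j (ℕₚ.m≤m+n i k) ℕₚ.≤-refl

avoidᶠ-nonNeg : ∀ f n j → 0ℚ ≤ avoidᶠ f n j
avoidᶠ-nonNeg f       n       zero    = ≤-refl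
avoidᶠ-nonNeg f       zero    (suc j) = <⇒≤ 0<1
avoidᶠ-nonNeg zero    (suc n) (suc j) = ≤-refl
avoidᶠ-nonNeg (suc f) (suc n) (suc j) = Δ-nonNeg n (λ i k → *-nonNeg (w-nonNeg i k)
  (*-nonNeg (mean-nonNeg (avoidᶠ-nonNeg f i) j) (avoidᶠ-nonNeg f k (suc j))))

avoidᶠ≤1 : ∀ f n j → avoidᶠ f n j ≤ 1ℚ
avoidᶠ≤1 f       n       zero    = <⇒≤ 0<1
avoidᶠ≤1 f       zero    (suc j) = ≤-refl
avoidᶠ≤1 zero    (suc n) (suc j) = <⇒≤ 0<1
avoidᶠ≤1 (suc f) (suc n) (suc j) = ≤-trans (Δ-mono n (λ i k _ →
  ≤-trans (monoˡ (w-nonNeg i k) (*-mono {q = 1ℚ} {s = 1ℚ} (avoidᶠ-nonNeg f k (suc j)) (<⇒≤ 0<1) (mean-mono (avoidᶠ≤1 f i) j) (avoidᶠ≤1 f k (suc j))))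
    (≤-reflexive (ℚₚ.*-identityʳ (w i k))))) (≤-reflexive (Δ-w n))

-- By `Δ-grow` the larger tree is the smaller one with one of its two parts grown, and by induction
-- growing either part lowers that part's avoidance probability. Both sizes are evaluated with the
-- same fuel, so that they are sums of one and the same `h`.
avoidᶠ-anti : ∀ f n j → n ℕ.< f → avoidᶠ f (suc n) j ≤ avoidᶠ f n j
avoidᶠ-anti f       n       zero    _ = ≤-refl
avoidᶠ-anti (suc f) zero    (suc j) _ = avoidᶠ≤1 (suc f) 1 (suc j)
avoidᶠ-anti (suc f) (suc n) (suc j) (ℕ.s≤s n<f) = begin
  Δ (suc n) (λ i k → w i k * h i k)                                           ≡⟨ Δ-grow n h ⟩
  Δ n (λ i k → w i k * (grow k i * h i (suc k) + grow i k * h (suc i) k))     ≤⟨ Δ-mono n (λ { i k refl → monoˡ (w-nonNeg i k) (shrink i k n<f) }) ⟩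
  Δ n (λ i k → w i k * h i k)                                                 ∎
  where
  open ≤-Reasoning
  h : ℕ → ℕ → ℚ
  h i k = mean (avoidᶠ f i) j * avoidᶠ f k (suc j)
  shrink : ∀ i k → i ℕ.+ k ℕ.< f → grow k i * h i (suc k) + grow i k * h (suc i) k ≤ h i k
  shrink i k i+k<f = begin
    grow k i * h i (suc k) + grow i k * h (suc i) k
      ≤⟨ +-mono-≤
        (monoˡ (grow-nonNeg k i) (monoˡ (mean-nonNeg (avoidᶠ-nonNeg f i) j) (avoidᶠ-anti f k (suc j) (ℕₚ.≤-<-trans (ℕₚ.m≤n+m k i) i+k<f))))
        (monoˡ (grow-nonNeg i k) (monoʳ (avoidᶠ-nonNeg f k (suc j)) (mean-mono (λ l → avoidᶠ-anti f i l (ℕₚ.≤-<-trans (ℕₚ.m≤m+n i k) i+k<f)) j))) ⟩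
    grow k i * h i k + grow i k * h i k      ≡⟨ ℚₚ.*-distribʳ-+ (h i k) (grow k i) (grow i k) ⟨
    (grow k i + grow i k) * h i k            ≡⟨ trans (cong (_* h i k) (grow-sum i k)) (ℚₚ.*-identityˡ (h i k)) ⟩
    h i k                                    ∎

avoid-anti : ∀ {m n} j → m ℕ.≤ n → avoid n j ≤ avoid m j
avoid-anti {m} j m≤n = go (ℕₚ.≤⇒≤′ m≤n)
  where
  go : ∀ {n} → m ℕ.≤′ n → avoid n j ≤ avoid m j
  go (ℕ.≤′-reflexive refl) = ≤-refl
  go (ℕ.≤′-step {n} m≤n) = ≤-trans (avoidᶠ-anti (suc n) n j ℕₚ.≤-refl)
    (≤-trans (≤-reflexive (avoidᶠ-stable (suc n) n n j (ℕₚ.n≤1+n n) ℕₚ.≤-refl)) (go m≤n))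

hit : ℕ → ℕ → ℚ
hit n j = 1ℚ - avoid n j

hit-nonNeg : ∀ n j → 0ℚ ≤ hit n j
hit-nonNeg n j = diff-nonNeg (avoidᶠ≤1 n n j)

hit≤1 : ∀ n j → hit n j ≤ 1ℚ
hit≤1 n j = ≤-by (avoid n j) (avoidᶠ-nonNeg n n j) (solve 1 (λ a → con 1ℚ := con 1ℚ :- a :+ a) refl (avoid n j))

hit-mono : ∀ {m n} j → m ℕ.≤ n → hit m j ≤ hit n j
hit-mono j m≤n = ℚₚ.+-monoʳ-≤ 1ℚ (ℚₚ.neg-antimono-≤ (avoid-anti j m≤n))

hits : ℕ → ℕ → ℚ
hits n j = hit n j + hit n (suc j) + hit n (suc (suc j))

hits-nonNeg : ∀ n j → 0ℚ ≤ hits n j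
hits-nonNeg n j = +-nonNeg (+-nonNeg (hit-nonNeg n j) (hit-nonNeg n (suc j))) (hit-nonNeg n (suc (suc j)))

hits≤3 : ∀ n j → hits n j ≤ fromℕ 3
hits≤3 n j = +-mono-≤ (+-mono-≤ (hit≤1 n j) (hit≤1 n (suc j))) (hit≤1 n (suc (suc j)))

-- A tree whose labels reach the level either does so in the subtree of its first
-- child, or does not, and then does so in the rest.
t-hit-suc : ∀ m j → t (suc m) * hit (suc m) (suc j) ≡
  conv (λ i → t i * hits i j) t m + conv (λ i → t i * (fromℕ 3 - hits i j)) (λ k → t k * hit k (suc j)) m
t-hit-suc m j = begin
  t (suc m) * (1ℚ - avoid (suc m) (suc j))               ≡⟨ cong (λ a → t (suc m) * (1ℚ - a)) (avoid-suc m j) ⟩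
  t (suc m) * (1ℚ - H)                                   ≡⟨ cong (λ u → t (suc m) * (u - H)) 1≡ ⟩
  t (suc m) * (H′ + H - H)                               ≡⟨ cong (t (suc m) *_) (solve 2 (λ a b → a :+ b :- b := a) refl H′ H) ⟩
  t (suc m) * H′                                         ≡⟨ t-w m (λ i k → 1ℚ - h i k) ⟩
  Δ m (λ i k → fromℕ 3 * t i * t k * (1ℚ - h i k))       ≡⟨ Δ-cong m (λ i k _ → solve 6 (λ x y a b c e →
      con (fromℕ 3) :* x :* y :* (con 1ℚ :- con (inv 2) :* (a :+ b :+ c) :* e) :=
      x :* (con 1ℚ :- a :+ (con 1ℚ :- b) :+ (con 1ℚ :- c)) :* y :+
      x :* (con (fromℕ 3) :- (con 1ℚ :- a :+ (con 1ℚ :- b) :+ (con 1ℚ :- c))) :* (y :* (con 1ℚ :- e))) refl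
      (t i) (t k) (avoid i j) (avoid i (suc j)) (avoid i (suc (suc j))) (avoid k (suc j))) ⟩
  Δ m (λ i k → p i k + q i k)                            ≡⟨ Δ-+ m p q ⟩
  Δ m p + Δ m q                                          ∎
  where
  open ≡-Reasoning
  h p q : ℕ → ℕ → ℚ
  h i k = mean (avoid i) j * avoid k (suc j)
  p i k = t i * hits i j * t k
  q i k = t i * (fromℕ 3 - hits i j) * (t k * hit k (suc j))
  H = Δ m (λ i k → w i k * h i k)
  H′ = Δ m (λ i k → w i k * (1ℚ - h i k))
  1≡ : 1ℚ ≡ H′ + H
  1≡ = trans (sym (Δ-w m)) (trans (Δ-cong m (λ i k _ → solve 2 (λ w h → w := w :* (con 1ℚ :- h) :+ w :* h) refl (w i k) (h i k)))
    (Δ-+ m (λ i k → w i k * (1ℚ - h i k)) (λ i k → w i k * h i k)))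

-- Supersolutions for the truncated generating functions

U : ℕ → ℚ
U j = fromℕ 4 * (inv j * inv (suc j))

U-nonNeg : ∀ j → 0ℚ ≤ U j
U-nonNeg j = *-nonNeg (fromℕ-nonNeg 4) (*-nonNeg (inv-nonNeg j) (inv-nonNeg (suc j)))

U≤2 : ∀ j → U j ≤ fromℕ 2
U≤2 j = ≤-trans (monoˡ (fromℕ-nonNeg 4) (*-mono {q = 1ℚ} {s = inv 1} (inv-nonNeg (suc j)) (<⇒≤ 0<1) (1/-anti {0} {j} ℕ.z≤n) (1/-anti {1} {suc j} (ℕ.s≤s ℕ.z≤n)))) ≤-refl

-- U is the exact difference of the generating functions at the critical point
-- 1/12: 2 − U j = 2 j (j + 3) / ((j + 1) (j + 2)) solves r = 1 + r (r₋ + r + r₊) / 12.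
U-fixed : ∀ j → inv 11 * ((U j + U (suc j) + U (suc (suc j))) * (fromℕ 2 - U (suc j)) + fromℕ 6 * U (suc j)) ≡ U (suc j)
U-fixed j = begin
  inv 11 * ((U j + U (suc j) + U (suc (suc j))) * (fromℕ 2 - U (suc j)) + fromℕ 6 * U (suc j))
    ≡⟨ cong₂ (λ s r → inv 11 * (s * r + fromℕ 6 * U (suc j))) sum two ⟩
  inv 11 * (fromℕ 12 * (A * D) * (fromℕ 2 * (B * C) * ((a + 1ℚ) * (a + fromℕ 4))) + fromℕ 6 * U (suc j))
    ≡⟨ solve 5 (λ a A B C D → con (inv 11) :* (con (fromℕ 12) :* (A :* D) :* (con (fromℕ 2) :* (B :* C) :* ((a :+ con 1ℚ) :* (a :+ con (fromℕ 4)))) :+ con (fromℕ 6) :* (con (fromℕ 4) :* (B :* C)))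
        := con (fromℕ 2) :* (B :* C) :* ((a :+ con 1ℚ) :* A :* ((a :+ con (fromℕ 4)) :* D) :+ con 1ℚ)) refl a A B C D ⟩
  fromℕ 2 * (B * C) * ((a + 1ℚ) * A * ((a + fromℕ 4) * D) + 1ℚ)
    ≡⟨ cong₂ (λ u v → fromℕ 2 * (B * C) * (u * v + 1ℚ)) A-unit D-unit ⟩
  fromℕ 2 * (B * C) * (1ℚ * 1ℚ + 1ℚ)
    ≡⟨ solve 2 (λ B C → con (fromℕ 2) :* (B :* C) :* (con 1ℚ :* con 1ℚ :+ con 1ℚ) := con (fromℕ 4) :* (B :* C)) refl B C ⟩
  U (suc j) ∎
  where
  open ≡-Reasoning
  a = fromℕ j
  A = inv j
  B = inv (suc j)
  C = inv (suc (suc j))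
  D = inv (suc (suc (suc j)))
  A-unit : (a + 1ℚ) * A ≡ 1ℚ
  A-unit = fromℕ-inv j
  B-unit : (a + fromℕ 2) * B ≡ 1ℚ
  B-unit = inv-suc j
  C-unit : (a + fromℕ 3) * C ≡ 1ℚ
  C-unit = trans (cong (_* C) (trans (solve 1 (λ a → a :+ con (fromℕ 3) := a :+ con 1ℚ :+ con (fromℕ 2)) refl a) (cong (_+ fromℕ 2) (sym (fromℕ-suc j))))) (inv-suc (suc j))
  D-unit : (a + fromℕ 4) * D ≡ 1ℚ
  D-unit = trans (cong (_* D) (trans (solve 1 (λ a → a :+ con (fromℕ 4) := a :+ con 1ℚ :+ con 1ℚ :+ con (fromℕ 2)) refl a)
    (cong (_+ fromℕ 2) (trans (cong (_+ 1ℚ) (sym (fromℕ-suc j))) (sym (fromℕ-suc (suc j))))))) (inv-suc (suc (suc j)))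
  diff : ∀ x y X Y → x * X ≡ 1ℚ → y * Y ≡ 1ℚ → X - Y ≡ (y - x) * (X * Y)
  diff x y X Y xX yY = begin
    X - Y                      ≡⟨ solve 2 (λ X Y → X :- Y := X :* con 1ℚ :- Y :* con 1ℚ) refl X Y ⟩
    X * 1ℚ - Y * 1ℚ            ≡⟨ cong₂ (λ u v → X * u - Y * v) yY xX ⟨
    X * (y * Y) - Y * (x * X)  ≡⟨ solve 4 (λ x y X Y → X :* (y :* Y) :- Y :* (x :* X) := (y :- x) :* (X :* Y)) refl x y X Y ⟩
    (y - x) * (X * Y)          ∎
  step : ∀ X Y e → (a + e) * X ≡ 1ℚ → (a + (e + 1ℚ)) * Y ≡ 1ℚ → X * Y ≡ X - Y
  step X Y e eX eY = sym (trans (diff (a + e) (a + (e + 1ℚ)) X Y eX eY)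
    (solve 4 (λ a e X Y → (a :+ (e :+ con 1ℚ) :- (a :+ e)) :* (X :* Y) := X :* Y) refl a e X Y))
  -- Since 1 / (s (s + 1)) = 1/s - 1/(s + 1), the three terms telescope and only the outer factors
  -- `A` and `D` survive.
  sum : U j + U (suc j) + U (suc (suc j)) ≡ fromℕ 12 * (A * D)
  sum = begin
    fromℕ 4 * (A * B) + fromℕ 4 * (B * C) + fromℕ 4 * (C * D)
      ≡⟨ cong₂ _+_ (cong₂ (λ u v → fromℕ 4 * u + fromℕ 4 * v) (step A B 1ℚ A-unit B-unit) (step B C (fromℕ 2) B-unit C-unit)) (cong (fromℕ 4 *_) (step C D (fromℕ 3) C-unit D-unit)) ⟩
    fromℕ 4 * (A - B) + fromℕ 4 * (B - C) + fromℕ 4 * (C - D)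
      ≡⟨ solve 4 (λ A B C D → con (fromℕ 4) :* (A :- B) :+ con (fromℕ 4) :* (B :- C) :+ con (fromℕ 4) :* (C :- D) := con (fromℕ 4) :* (A :- D)) refl A B C D ⟩
    fromℕ 4 * (A - D)
      ≡⟨ cong (fromℕ 4 *_) (diff (a + 1ℚ) (a + fromℕ 4) A D A-unit D-unit) ⟩
    fromℕ 4 * ((a + fromℕ 4 - (a + 1ℚ)) * (A * D))
      ≡⟨ solve 3 (λ a A D → con (fromℕ 4) :* ((a :+ con (fromℕ 4) :- (a :+ con 1ℚ)) :* (A :* D)) := con (fromℕ 12) :* (A :* D)) refl a A D ⟩
    fromℕ 12 * (A * D) ∎
  two : fromℕ 2 - U (suc j) ≡ fromℕ 2 * (B * C) * ((a + 1ℚ) * (a + fromℕ 4))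
  two = begin
    fromℕ 2 * (1ℚ * 1ℚ) - U (suc j)                                       ≡⟨ cong₂ (λ u v → fromℕ 2 * (u * v) - U (suc j)) B-unit C-unit ⟨
    fromℕ 2 * ((a + fromℕ 2) * B * ((a + fromℕ 3) * C)) - U (suc j)        ≡⟨ solve 3 (λ a B C →
      con (fromℕ 2) :* ((a :+ con (fromℕ 2)) :* B :* ((a :+ con (fromℕ 3)) :* C)) :- con (fromℕ 4) :* (B :* C) :=
      con (fromℕ 2) :* (B :* C) :* ((a :+ con 1ℚ) :* (a :+ con (fromℕ 4)))) refl a B C ⟩
    fromℕ 2 * (B * C) * ((a + 1ℚ) * (a + fromℕ 4)) ∎

module Series {g : ℚ} (g≥0 : 0ℚ ≤ g) where

  T : ℕ → ℚ
  T M = [ M ] t ⟨ g ⟩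

  F : ℕ → ℕ → ℚ
  F M j = [ M ] (λ m → t m * hit m j) ⟨ g ⟩

  S : ℕ → ℕ → ℚ
  S M j = F M j + F M (suc j) + F M (suc (suc j))

  T-nonNeg : ∀ M → 0ℚ ≤ T M
  T-nonNeg M = []-nonNeg M g≥0 t-nonNeg

  F-nonNeg : ∀ M j → 0ℚ ≤ F M j
  F-nonNeg M j = []-nonNeg M g≥0 (λ m → *-nonNeg (t-nonNeg m) (hit-nonNeg m j))

  F≤T : ∀ M j → F M j ≤ T M
  F≤T M j = []-mono M g≥0 (λ m → ≤-trans (monoˡ (t-nonNeg m) (hit≤1 m j)) (≤-reflexive (ℚₚ.*-identityʳ (t m))))

  S-nonNeg : ∀ M j → 0ℚ ≤ S M j
  S-nonNeg M j = +-nonNeg (+-nonNeg (F-nonNeg M j) (F-nonNeg M (suc j))) (F-nonNeg M (suc (suc j)))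

  S≤3T : ∀ M j → S M j ≤ fromℕ 3 * T M
  S≤3T M j = ≤-trans (+-mono-≤ (+-mono-≤ (F≤T M j) (F≤T M (suc j))) (F≤T M (suc (suc j))))
    (≤-reflexive (solve 1 (λ T → T :+ T :+ T := con (fromℕ 3) :* T) refl (T M)))

  T-suc : ∀ M → T (suc M) ≤ 1ℚ + fromℕ 3 * g * (T M * T M)
  T-suc M = begin
    T (suc M)                                        ≡⟨ []-suc M g t ⟩
    1ℚ + g * [ M ] (t ∘ suc) ⟨ g ⟩                   ≡⟨ cong (λ s → 1ℚ + g * s) (trans ([]-cong M g (λ m → trans (t-suc m)
                                                          (trans (Δ-cong m (λ i k _ → ℚₚ.*-assoc (fromℕ 3) (t i) (t k))) (Δ-*ˡ m (fromℕ 3) (λ i k → t i * t k)))))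
                                                          ([]-*ˡ M g (fromℕ 3) (conv t t))) ⟩
    1ℚ + g * (fromℕ 3 * [ M ] conv t t ⟨ g ⟩)        ≤⟨ ℚₚ.+-monoʳ-≤ 1ℚ (monoˡ g≥0 (monoˡ (fromℕ-nonNeg 3) ([]-conv-≤ g≥0 t-nonNeg t-nonNeg M))) ⟩
    1ℚ + g * (fromℕ 3 * (T M * T M))                 ≡⟨ solve 2 (λ g x → con 1ℚ :+ g :* (con (fromℕ 3) :* x) := con 1ℚ :+ con (fromℕ 3) :* g :* x) refl g (T M * T M) ⟩
    1ℚ + fromℕ 3 * g * (T M * T M)                   ∎
    where open ≤-Reasoning

  -- `t-hit-suc` is already a sum of two convolutions with nonnegative coefficients, as `[]-conv-≤`
  -- requires; the difference 3 - `hits` is kept together as one coefficient for this reason and is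
  -- expanded only after the truncation.
  F-suc : ∀ M j → F (suc M) (suc j) ≤ g * (S M j * T M + (fromℕ 3 * T M - S M j) * F M (suc j))
  F-suc M j = begin
    F (suc M) (suc j)                                ≡⟨ []-suc M g (λ m → t m * hit m (suc j)) ⟩
    0ℚ + g * [ M ] (λ m → t (suc m) * hit (suc m) (suc j)) ⟨ g ⟩
      ≡⟨ trans (ℚₚ.+-identityˡ _) (cong (g *_) (trans ([]-cong M g (λ m → t-hit-suc m j)) ([]-+ M g (conv p t) (conv q (r (suc j)))))) ⟩
    g * ([ M ] conv p t ⟨ g ⟩ + [ M ] conv q (r (suc j)) ⟨ g ⟩)
      ≤⟨ monoˡ g≥0 (+-mono-≤ ([]-conv-≤ g≥0 p≥0 t-nonNeg M) ([]-conv-≤ g≥0 q≥0 (λ k → *-nonNeg (t-nonNeg k) (hit-nonNeg k (suc j))) M)) ⟩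
    g * ([ M ] p ⟨ g ⟩ * T M + [ M ] q ⟨ g ⟩ * F M (suc j))
      ≡⟨ cong₂ (λ u v → g * (u * T M + v * F M (suc j))) p-sum q-sum ⟩
    g * (S M j * T M + (fromℕ 3 * T M - S M j) * F M (suc j)) ∎
    where
    open ≤-Reasoning
    p q : ℕ → ℚ
    r : ℕ → ℕ → ℚ
    p i = t i * hits i j
    q i = t i * (fromℕ 3 - hits i j)
    r l k = t k * hit k l
    p≥0 : ∀ i → 0ℚ ≤ p i
    p≥0 i = *-nonNeg (t-nonNeg i) (hits-nonNeg i j)
    q≥0 : ∀ i → 0ℚ ≤ q i
    q≥0 i = *-nonNeg (t-nonNeg i) (diff-nonNeg (hits≤3 i j))
    p-sum : [ M ] p ⟨ g ⟩ ≡ S M j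
    p-sum = trans ([]-cong M g (λ i → solve 4 (λ x a b c → x :* (a :+ b :+ c) := x :* a :+ x :* b :+ x :* c) refl (t i) (hit i j) (hit i (suc j)) (hit i (suc (suc j)))))
      (trans ([]-+ M g (λ i → r j i + r (suc j) i) (r (suc (suc j)))) (cong (_+ F M (suc (suc j))) ([]-+ M g (r j) (r (suc j)))))
    q-sum : [ M ] q ⟨ g ⟩ ≡ fromℕ 3 * T M - S M j
    q-sum = begin-equality
      [ M ] q ⟨ g ⟩                                       ≡⟨ solve 2 (λ x y → x := x :+ y :- y) refl ([ M ] q ⟨ g ⟩) ([ M ] p ⟨ g ⟩) ⟩
      [ M ] q ⟨ g ⟩ + [ M ] p ⟨ g ⟩ - [ M ] p ⟨ g ⟩       ≡⟨ cong (_- [ M ] p ⟨ g ⟩) ([]-+ M g q p) ⟨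
      [ M ] (λ i → q i + p i) ⟨ g ⟩ - [ M ] p ⟨ g ⟩       ≡⟨ cong₂ _-_ (trans ([]-cong M g (λ i → solve 2 (λ x s → x :* (con (fromℕ 3) :- s) :+ x :* s := con (fromℕ 3) :* x) refl (t i) (hits i j))) ([]-*ˡ M g (fromℕ 3) t)) p-sum ⟩
      fromℕ 3 * T M - S M j                               ∎

  module _ (g≤1/12 : g ≤ inv 11) (T≤2 : ∀ M → T M ≤ fromℕ 2) where

    -- The bound of `F-suc` is monotone in each quantity in turn: in F because S ≤ 3T, then in T,
    -- then in S because `U` ≤ 2, then in g. Replacing them by `U`, 2, `U` and 1/12 in this order
    -- leaves the fixed-point equation `U-fixed`. At level 0 the bound T ≤ 2 is `U 0`.
    F≤U : ∀ M j → F M j ≤ U j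
    F≤U zero    j       = U-nonNeg j
    F≤U (suc M) zero    = ≤-trans (F≤T (suc M) 0) (T≤2 (suc M))
    F≤U (suc M) (suc j) = begin
      F (suc M) (suc j)                         ≤⟨ F-suc M j ⟩
      g * (s * T M + (fromℕ 3 * T M - s) * f)   ≤⟨ monoˡ g≥0 (ℚₚ.+-monoʳ-≤ (s * T M) (monoˡ (diff-nonNeg (S≤3T M j)) (F≤U M (suc j)))) ⟩
      g * (s * T M + (fromℕ 3 * T M - s) * u)   ≡⟨ cong (g *_) (solve 3 (λ s T u → s :* T :+ (con (fromℕ 3) :* T :- s) :* u := (s :+ con (fromℕ 3) :* u) :* T :- s :* u) refl s (T M) u) ⟩
      g * ((s + fromℕ 3 * u) * T M - s * u)     ≤⟨ monoˡ g≥0 (ℚₚ.+-monoˡ-≤ (- (s * u)) (monoˡ (+-nonNeg (S-nonNeg M j) (*-nonNeg (fromℕ-nonNeg 3) (U-nonNeg (suc j)))) (T≤2 M))) ⟩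
      g * ((s + fromℕ 3 * u) * fromℕ 2 - s * u) ≡⟨ cong (g *_) (solve 2 (λ s u → (s :+ con (fromℕ 3) :* u) :* con (fromℕ 2) :- s :* u := s :* (con (fromℕ 2) :- u) :+ con (fromℕ 6) :* u) refl s u) ⟩
      g * (s * (fromℕ 2 - u) + fromℕ 6 * u)     ≤⟨ monoˡ g≥0 (ℚₚ.+-monoˡ-≤ (fromℕ 6 * u) (monoʳ (diff-nonNeg (U≤2 (suc j))) (+-mono-≤ (+-mono-≤ (F≤U M j) (F≤U M (suc j))) (F≤U M (suc (suc j)))))) ⟩
      g * (v * (fromℕ 2 - u) + fromℕ 6 * u)     ≤⟨ monoʳ (+-nonNeg (*-nonNeg (+-nonNeg (+-nonNeg (U-nonNeg j) (U-nonNeg (suc j))) (U-nonNeg (suc (suc j)))) (diff-nonNeg (U≤2 (suc j)))) (*-nonNeg (fromℕ-nonNeg 6) (U-nonNeg (suc j)))) g≤1/12 ⟩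
      inv 11 * (v * (fromℕ 2 - u) + fromℕ 6 * u) ≡⟨ U-fixed j ⟩
      u                                         ∎
      where
      open ≤-Reasoning
      s = S M j
      f = F M (suc j)
      u = U (suc j)
      v = U j + U (suc j) + U (suc (suc j))

  -- Dropping the quadratic term of F-suc leaves a linear recursion, of which
  -- geometric sequences are supersolutions.
  F-decay : ∀ {R x K} → (∀ M → T M ≤ R) → 0ℚ ≤ R → 0ℚ ≤ x → 0ℚ ≤ K →
    g * R * (1ℚ + fromℕ 4 * x + x * x) ≤ x →
    ∀ q → (∀ M → F M q ≤ K) → ∀ M i → F M (i ℕ.+ q) ≤ K * x ^ i
  F-decay {R} {x} {K} T≤R R≥0 x≥0 K≥0 gRx q base = go
    where
    open ≤-Reasoning
    go : ∀ M i → F M (i ℕ.+ q) ≤ K * x ^ i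
    go M       zero    = ≤-trans (base M) (≤-reflexive (sym (ℚₚ.*-identityʳ K)))
    go zero    (suc i) = *-nonNeg K≥0 (^-nonNeg x≥0 (suc i))
    go (suc M) (suc i) = begin
      F (suc M) (suc i ℕ.+ q)                            ≤⟨ F-suc M (i ℕ.+ q) ⟩
      g * (s * T M + (fromℕ 3 * T M - s) * f)            ≤⟨ monoˡ g≥0 (ℚₚ.+-monoʳ-≤ (s * T M) (monoʳ {p = fromℕ 3 * T M - s} (F-nonNeg M (suc i ℕ.+ q)) (≤-by s (S-nonNeg M (i ℕ.+ q)) (solve 2 (λ a s → a := a :- s :+ s) refl (fromℕ 3 * T M) s)))) ⟩
      g * (s * T M + fromℕ 3 * T M * f)                  ≡⟨ cong (g *_) (solve 3 (λ s T f → s :* T :+ con (fromℕ 3) :* T :* f := (s :+ con (fromℕ 3) :* f) :* T) refl s (T M) f) ⟩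
      g * ((s + fromℕ 3 * f) * T M)                      ≤⟨ monoˡ g≥0 (*-mono (T-nonNeg M) (*-nonNeg K≥0 (*-nonNeg (^-nonNeg x≥0 i) X≥0))
                                                             (≤-trans (+-mono-≤ (+-mono-≤ (+-mono-≤ (go M i) (go M (suc i))) (go M (suc (suc i)))) (monoˡ (fromℕ-nonNeg 3) (go M (suc i))))
                                                               (≤-reflexive (solve 3 (λ K x y → K :* y :+ K :* (x :* y) :+ K :* (x :* (x :* y)) :+ con (fromℕ 3) :* (K :* (x :* y)) := K :* (y :* (con 1ℚ :+ con (fromℕ 4) :* x :+ x :* x))) refl K x (x ^ i))))
                                                             (T≤R M)) ⟩
      g * (K * (x ^ i * X) * R)                          ≡⟨ solve 5 (λ g K y X R → g :* (K :* (y :* X) :* R) := K :* y :* (g :* R :* X)) refl g K (x ^ i) X R ⟩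
      K * x ^ i * (g * R * X)                            ≤⟨ monoˡ (*-nonNeg K≥0 (^-nonNeg x≥0 i)) gRx ⟩
      K * x ^ i * x                                      ≡⟨ solve 3 (λ K y x → K :* y :* x := K :* (x :* y)) refl K (x ^ i) x ⟩
      K * x ^ suc i                                      ∎
      where
      s = S M (i ℕ.+ q)
      f = F M (suc i ℕ.+ q)
      X = 1ℚ + fromℕ 4 * x + x * x
      X≥0 : 0ℚ ≤ X
      X≥0 = +-nonNeg (+-nonNeg (<⇒≤ 0<1) (*-nonNeg (fromℕ-nonNeg 4) x≥0)) (*-nonNeg x≥0 x≥0)

-- Below the critical point

-- central m = (2m choose m) / 4ᵐ
central : ℕ → ℚ
central zero    = 1ℚ
central (suc m) = central m * ((fromℕ 2 * fromℕ m + 1ℚ) * (inv 1 * inv m))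

central-nonNeg : ∀ m → 0ℚ ≤ central m
central-nonNeg zero    = <⇒≤ 0<1
central-nonNeg (suc m) = *-nonNeg (central-nonNeg m) (*-nonNeg (odd-nonNeg m) (*-nonNeg (inv-nonNeg 1) (inv-nonNeg m)))

t-central : ∀ m → t m * inv 11 ^ m ≡ central m * inv m
t-central zero    = refl
t-central (suc m) = begin
  t m * ratio m * (inv 11 * inv 11 ^ m)         ≡⟨ solve 4 (λ x r c y → x :* r :* (c :* y) := x :* y :* (c :* r)) refl (t m) (ratio m) (inv 11) (inv 11 ^ m) ⟩
  t m * inv 11 ^ m * (inv 11 * ratio m)         ≡⟨ cong (_* (inv 11 * ratio m)) (t-central m) ⟩
  central m * inv m * (inv 11 * ratio m)        ≡⟨ solve 4 (λ b a p q → b :* p :* (con (inv 11) :* (con (fromℕ 6) :* (con (fromℕ 2) :* a :+ con 1ℚ) :* q)) :=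
                                                    b :* ((con (fromℕ 2) :* a :+ con 1ℚ) :* (con (inv 1) :* p)) :* q) refl (central m) (fromℕ m) (inv m) (inv (suc m)) ⟩
  central (suc m) * inv (suc m)                 ∎
  where open ≡-Reasoning

-- A discrete antiderivative of the critical weights: their mass on an interval of sizes becomes a
-- difference of two values of `central`.
t-telescopes : ∀ m → t m * inv 11 ^ m ≡ fromℕ 2 * (central m - central (suc m))
t-telescopes m = trans (t-central m) (sym (begin
  fromℕ 2 * (b - b * ((fromℕ 2 * a + 1ℚ) * (inv 1 * p)))
    ≡⟨ solve 3 (λ a b p → con (fromℕ 2) :* (b :- b :* ((con (fromℕ 2) :* a :+ con 1ℚ) :* (con (inv 1) :* p))) :=
        b :* (con (fromℕ 2) :* con 1ℚ :- (con (fromℕ 2) :* a :+ con 1ℚ) :* p)) refl a b p ⟩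
  b * (fromℕ 2 * 1ℚ - (fromℕ 2 * a + 1ℚ) * p)
    ≡⟨ cong (λ u → b * (fromℕ 2 * u - (fromℕ 2 * a + 1ℚ) * p)) (fromℕ-inv m) ⟨
  b * (fromℕ 2 * ((a + 1ℚ) * p) - (fromℕ 2 * a + 1ℚ) * p)
    ≡⟨ solve 3 (λ a b p → b :* (con (fromℕ 2) :* ((a :+ con 1ℚ) :* p) :- (con (fromℕ 2) :* a :+ con 1ℚ) :* p) := b :* p) refl a b p ⟩
  b * p ∎))
  where
  open ≡-Reasoning
  a = fromℕ m
  b = central m
  p = inv m

-- m · `central m`² is nondecreasing and equals 1/4 at m = 1.
central-lower : ∀ m → 1ℚ ≤ fromℕ 4 * fromℕ (suc m) * (central (suc m) * central (suc m))
central-lower zero    = ≤-refl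
central-lower (suc m) = ≤-trans (central-lower m) (≤-by (b * b * p) (*-nonNeg (*-nonNeg (central-nonNeg (suc m)) (central-nonNeg (suc m))) (inv-nonNeg (suc m))) (begin
  fromℕ 4 * fromℕ (suc (suc m)) * (b * ((fromℕ 2 * a + 1ℚ) * (inv 1 * p)) * (b * ((fromℕ 2 * a + 1ℚ) * (inv 1 * p))))
    ≡⟨ cong (λ s → fromℕ 4 * s * (b * ((fromℕ 2 * a + 1ℚ) * (inv 1 * p)) * (b * ((fromℕ 2 * a + 1ℚ) * (inv 1 * p))))) (fromℕ-suc (suc m)) ⟩
  fromℕ 4 * (a + 1ℚ) * (b * ((fromℕ 2 * a + 1ℚ) * (inv 1 * p)) * (b * ((fromℕ 2 * a + 1ℚ) * (inv 1 * p))))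
    ≡⟨ solve 3 (λ a b p → con (fromℕ 4) :* (a :+ con 1ℚ) :* (b :* ((con (fromℕ 2) :* a :+ con 1ℚ) :* (con (inv 1) :* p)) :* (b :* ((con (fromℕ 2) :* a :+ con 1ℚ) :* (con (inv 1) :* p))))
        := (a :+ con 1ℚ) :* p :* (con (fromℕ 4) :* a :* (b :* b) :* ((a :+ con 1ℚ) :* p) :+ b :* b :* p)) refl a b p ⟩
  (a + 1ℚ) * p * (fromℕ 4 * a * (b * b) * ((a + 1ℚ) * p) + b * b * p)
    ≡⟨ cong (λ u → u * (fromℕ 4 * a * (b * b) * u + b * b * p)) (fromℕ-inv (suc m)) ⟩
  1ℚ * (fromℕ 4 * a * (b * b) * 1ℚ + b * b * p)
    ≡⟨ solve 3 (λ a b p → con 1ℚ :* (con (fromℕ 4) :* a :* (b :* b) :* con 1ℚ :+ b :* b :* p) := con (fromℕ 4) :* a :* (b :* b) :+ b :* b :* p) refl a b p ⟩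
  fromℕ 4 * a * (b * b) + b * b * p ∎))
  where
  open ≡-Reasoning
  a = fromℕ (suc m)
  b = central (suc m)
  p = inv (suc m)

-- (2m + 1) · `central m`² is nonincreasing and starts at 1.
central-upper : ∀ m → (fromℕ 2 * fromℕ m + 1ℚ) * (central m * central m) ≤ 1ℚ
central-upper zero    = ≤-refl
central-upper (suc m) = ≤-trans (≤-by ((fromℕ 2 * a + 1ℚ) * (b * b) * (inv 3 * (p * p)))
  (*-nonNeg (*-nonNeg (odd-nonNeg m) (*-nonNeg (central-nonNeg m) (central-nonNeg m))) (*-nonNeg (inv-nonNeg 3) (*-nonNeg (inv-nonNeg m) (inv-nonNeg m)))) (begin
  (fromℕ 2 * a + 1ℚ) * (b * b)
    ≡⟨ solve 2 (λ a b → (con (fromℕ 2) :* a :+ con 1ℚ) :* (b :* b) := (con (fromℕ 2) :* a :+ con 1ℚ) :* (b :* b) :* (con 1ℚ :* con 1ℚ)) refl a b ⟩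
  (fromℕ 2 * a + 1ℚ) * (b * b) * (1ℚ * 1ℚ)
    ≡⟨ cong (λ u → (fromℕ 2 * a + 1ℚ) * (b * b) * (u * u)) (fromℕ-inv m) ⟨
  (fromℕ 2 * a + 1ℚ) * (b * b) * ((a + 1ℚ) * p * ((a + 1ℚ) * p))
    ≡⟨ solve 3 (λ a b p → (con (fromℕ 2) :* a :+ con 1ℚ) :* (b :* b) :* ((a :+ con 1ℚ) :* p :* ((a :+ con 1ℚ) :* p)) :=
        (con (fromℕ 2) :* (a :+ con 1ℚ) :+ con 1ℚ) :* (b :* ((con (fromℕ 2) :* a :+ con 1ℚ) :* (con (inv 1) :* p)) :* (b :* ((con (fromℕ 2) :* a :+ con 1ℚ) :* (con (inv 1) :* p))))
        :+ (con (fromℕ 2) :* a :+ con 1ℚ) :* (b :* b) :* (con (inv 3) :* (p :* p))) refl a b p ⟩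
  (fromℕ 2 * (a + 1ℚ) + 1ℚ) * (b′ * b′) + (fromℕ 2 * a + 1ℚ) * (b * b) * (inv 3 * (p * p))
    ≡⟨ cong (λ s → (fromℕ 2 * s + 1ℚ) * (b′ * b′) + (fromℕ 2 * a + 1ℚ) * (b * b) * (inv 3 * (p * p))) (fromℕ-suc m) ⟨
  (fromℕ 2 * fromℕ (suc m) + 1ℚ) * (b′ * b′) + (fromℕ 2 * a + 1ℚ) * (b * b) * (inv 3 * (p * p)) ∎)) (central-upper m)
  where
  open ≡-Reasoning
  a = fromℕ m
  b = central m
  b′ = central (suc m)
  p = inv m

-- The mass is 2 (`central N` - `central (16 N)`), with `central N` ≥ 1/(2q²) and `central (16 N)` ≤
-- 1/(4q²). The factor 16 is there to separate these two bounds, whose constants differ; being a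
-- fourth power times q⁴, it keeps the square roots rational.
critical-mass : ∀ r → let q = suc r ; N = q ℕ.^ 4 in
  inv 1 ≤ fromℕ q * fromℕ q * Σ< (15 ℕ.* N) (λ i → t (N ℕ.+ i) * inv 11 ^ (N ℕ.+ i))
critical-mass r = begin
  1ℚ - inv 1 * 1ℚ                               ≤⟨ +-mono-≤ lower (ℚₚ.neg-antimono-≤ (monoˡ (inv-nonNeg 1) upper)) ⟩
  fromℕ 2 * QQ * B - inv 1 * (fromℕ 4 * QQ * B′) ≡⟨ solve 3 (λ q b b′ → con (fromℕ 2) :* q :* b :- con (inv 1) :* (con (fromℕ 4) :* q :* b′) := q :* (con (fromℕ 2) :* (b :- b′))) refl QQ B B′ ⟩
  QQ * (fromℕ 2 * (B - B′))                     ≡⟨ cong (λ m → QQ * (fromℕ 2 * (central m - B′))) (ℕₚ.+-identityʳ N) ⟨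
  QQ * (fromℕ 2 * (central (N ℕ.+ 0) - B′))     ≡⟨ cong (λ s → QQ * (fromℕ 2 * s)) (Σ<-telescope (15 ℕ.* N) (λ i → central (N ℕ.+ i))) ⟨
  QQ * (fromℕ 2 * Σ< (15 ℕ.* N) (λ i → central (N ℕ.+ i) - central (N ℕ.+ suc i)))
    ≡⟨ cong (QQ *_) (Σ<-*ˡ (15 ℕ.* N) (fromℕ 2) (λ i → central (N ℕ.+ i) - central (N ℕ.+ suc i))) ⟨
  QQ * Σ< (15 ℕ.* N) (λ i → fromℕ 2 * (central (N ℕ.+ i) - central (N ℕ.+ suc i)))
    ≡⟨ cong (QQ *_) (Σ<-cong (15 ℕ.* N) (λ i → trans (cong (λ m → fromℕ 2 * (central (N ℕ.+ i) - central m)) (ℕₚ.+-suc N i)) (sym (t-telescopes (N ℕ.+ i))))) ⟩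
  QQ * Σ< (15 ℕ.* N) (λ i → t (N ℕ.+ i) * inv 11 ^ (N ℕ.+ i)) ∎
  where
  open ≤-Reasoning
  q N M : ℕ
  q = suc r
  N = q ℕ.^ 4
  M = 16 ℕ.* N
  Q QQ B B′ : ℚ
  Q = fromℕ q
  QQ = Q * Q
  B = central N
  B′ = central M
  Q⁴ : fromℕ N ≡ QQ * QQ
  Q⁴ = trans (fromℕ-^ q 4) (solve 1 (λ q → q :* (q :* (q :* (q :* con 1ℚ))) := q :* q :* (q :* q)) refl Q)
  QQ≥0 : 0ℚ ≤ QQ
  QQ≥0 = *-nonNeg (fromℕ-nonNeg q) (fromℕ-nonNeg q)
  central-lower′ : ∀ m → 1 ℕ.≤ m → 1ℚ ≤ fromℕ 4 * fromℕ m * (central m * central m)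
  central-lower′ (suc m) _ = central-lower m
  lower : 1ℚ ≤ fromℕ 2 * QQ * B
  lower = 1≤square (*-nonNeg (*-nonNeg (fromℕ-nonNeg 2) QQ≥0) (central-nonNeg N))
    (≤-trans (central-lower′ N (ℕ.>-nonZero⁻¹ N {{ℕₚ.m^n≢0 q 4}})) (≤-reflexive (trans (cong (λ s → fromℕ 4 * s * (B * B)) Q⁴)
      (solve 2 (λ q b → con (fromℕ 4) :* (q :* q) :* (b :* b) := con (fromℕ 2) :* q :* b :* (con (fromℕ 2) :* q :* b)) refl QQ B))))
  upper : fromℕ 4 * QQ * B′ ≤ 1ℚ
  upper = square≤1 (begin
    fromℕ 4 * QQ * B′ * (fromℕ 4 * QQ * B′)      ≡⟨ solve 2 (λ q b → con (fromℕ 4) :* q :* b :* (con (fromℕ 4) :* q :* b) := con (fromℕ 16) :* (q :* q) :* (b :* b)) refl QQ B′ ⟩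
    fromℕ 16 * (QQ * QQ) * (B′ * B′)             ≡⟨ cong (_* (B′ * B′)) (trans (fromℕ-* 16 N) (cong (fromℕ 16 *_) Q⁴)) ⟨
    fromℕ M * (B′ * B′)                          ≤⟨ monoʳ {p = fromℕ M} (*-nonNeg (central-nonNeg M) (central-nonNeg M))
                                                     (≤-by (fromℕ M + 1ℚ) (+-nonNeg (fromℕ-nonNeg M) (<⇒≤ 0<1)) (solve 1 (λ m → con (fromℕ 2) :* m :+ con 1ℚ := m :+ (m :+ con 1ℚ)) refl (fromℕ M))) ⟩
    (fromℕ 2 * fromℕ M + 1ℚ) * (B′ * B′)         ≤⟨ central-upper M ⟩
    1ℚ                                           ∎)

-- The subcritical point g is parametrised so that R, the value of the full
-- generating function, and the decay rate x are rational: R = 1 + 3 g R², and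
-- g R² (x + 1 + 1/x) ≤ 1.
module Subcritical {θ : ℚ} (θ≥0 : 0ℚ ≤ θ) where

  σ v : ℚ
  σ = θ * θ
  v = 1ℚ + σ * σ

  σ≥0 : 0ℚ ≤ σ
  σ≥0 = *-nonNeg θ≥0 θ≥0

  v≥1 : 1ℚ ≤ v
  v≥1 = p≤p+q (*-nonNeg σ≥0 σ≥0)

  v≥0 : 0ℚ ≤ v
  v≥0 = ≤-trans (<⇒≤ 0<1) v≥1

  1+pos : ∀ {p} → 0ℚ ≤ p → 0ℚ < 1ℚ + p
  1+pos p≥0 = ℚₚ.<-≤-trans 0<1 (p≤p+q p≥0)

  x : ℚ
  x = proj₁ (reciprocal (1ℚ + θ) (1+pos θ≥0))
  x≥0 : 0ℚ ≤ x
  x≥0 = <⇒≤ (proj₁ (proj₂ (reciprocal (1ℚ + θ) (1+pos θ≥0))))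
  x-unit : (1ℚ + θ) * x ≡ 1ℚ
  x-unit = proj₂ (proj₂ (reciprocal (1ℚ + θ) (1+pos θ≥0)))

  ρ : ℚ
  ρ = proj₁ (reciprocal (1ℚ + σ) (1+pos σ≥0))
  ρ≥0 : 0ℚ ≤ ρ
  ρ≥0 = <⇒≤ (proj₁ (proj₂ (reciprocal (1ℚ + σ) (1+pos σ≥0))))
  ρ-unit : (1ℚ + σ) * ρ ≡ 1ℚ
  ρ-unit = proj₂ (proj₂ (reciprocal (1ℚ + σ) (1+pos σ≥0)))

  R : ℚ
  R = 1ℚ + ρ
  R⁻¹ : ℚ
  R⁻¹ = proj₁ (reciprocal R (1+pos ρ≥0))
  R⁻¹≥0 : 0ℚ ≤ R⁻¹
  R⁻¹≥0 = <⇒≤ (proj₁ (proj₂ (reciprocal R (1+pos ρ≥0))))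
  R-unit : R * R⁻¹ ≡ 1ℚ
  R-unit = proj₂ (proj₂ (reciprocal R (1+pos ρ≥0)))

  g : ℚ
  g = inv 2 * (ρ * (R⁻¹ * R⁻¹))

  g≥0 : 0ℚ ≤ g
  g≥0 = *-nonNeg (inv-nonNeg 2) (*-nonNeg ρ≥0 (*-nonNeg R⁻¹≥0 R⁻¹≥0))

  ρ≤1 : ρ ≤ 1ℚ
  ρ≤1 = ≤-by (σ * ρ) (*-nonNeg σ≥0 ρ≥0) (trans (sym ρ-unit) (solve 2 (λ s r → (con 1ℚ :+ s) :* r := r :+ s :* r) refl σ ρ))

  R≤2 : R ≤ fromℕ 2
  R≤2 = ℚₚ.+-monoʳ-≤ 1ℚ ρ≤1

  R≥0 : 0ℚ ≤ R
  R≥0 = +-nonNeg (<⇒≤ 0<1) ρ≥0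

  R-fixed : 1ℚ + fromℕ 3 * g * (R * R) ≡ R
  R-fixed = cong (1ℚ +_) (begin
    fromℕ 3 * g * (R * R)        ≡⟨ solve 3 (λ p r i → con (fromℕ 3) :* (con (inv 2) :* (p :* (i :* i))) :* (r :* r) := p :* (r :* i :* (r :* i))) refl ρ R R⁻¹ ⟩
    ρ * (R * R⁻¹ * (R * R⁻¹))    ≡⟨ cong (λ u → ρ * (u * u)) R-unit ⟩
    ρ * (1ℚ * 1ℚ)                ≡⟨ ℚₚ.*-identityʳ ρ ⟩
    ρ                            ∎)
    where open ≡-Reasoning

  open Series g≥0

  T≤R : ∀ M → T M ≤ R
  T≤R zero    = R≥0
  T≤R (suc M) = ≤-trans (T-suc M) (≤-trans (ℚₚ.+-monoʳ-≤ 1ℚ (monoˡ (*-nonNeg (fromℕ-nonNeg 3) g≥0)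
    (*-mono (T-nonNeg M) R≥0 (T≤R M) (T≤R M)))) (≤-reflexive R-fixed))

  R²R⁻² : ∀ c → c * (R * R) * (R⁻¹ * R⁻¹) ≡ c
  R²R⁻² c = begin
    c * (R * R) * (R⁻¹ * R⁻¹)    ≡⟨ solve 3 (λ c r i → c :* (r :* r) :* (i :* i) := c :* (r :* i :* (r :* i))) refl c R R⁻¹ ⟩
    c * (R * R⁻¹ * (R * R⁻¹))    ≡⟨ cong (λ u → c * (u * u)) R-unit ⟩
    c * (1ℚ * 1ℚ)                ≡⟨ ℚₚ.*-identityʳ c ⟩
    c                            ∎
    where open ≡-Reasoning

  R⁻²≥0 : 0ℚ ≤ R⁻¹ * R⁻¹
  R⁻²≥0 = *-nonNeg R⁻¹≥0 R⁻¹≥0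

  -- 12 g = 4ρ / (1 + ρ)², at most 1 because (1 - ρ)² ≥ 0.
  g≤1/12 : g ≤ inv 11
  g≤1/12 = subst₂ _≤_ (solve 2 (λ p i → con (inv 11) :* (con (fromℕ 4) :* p) :* i := con (inv 2) :* (p :* i)) refl ρ (R⁻¹ * R⁻¹)) (R²R⁻² (inv 11))
    (monoʳ R⁻²≥0 (monoˡ (inv-nonNeg 11) (≤-by {fromℕ 4 * ρ} ((1ℚ - ρ) * (1ℚ - ρ)) (square-nonNeg (1ℚ - ρ))
      (solve 1 (λ p → (con 1ℚ :+ p) :* (con 1ℚ :+ p) := con (fromℕ 4) :* p :+ (con 1ℚ :- p) :* (con 1ℚ :- p)) refl ρ))))

  -- In terms of σ, 1 / (12 g) = (2 + σ)² / (4 (1 + σ)), and (2 + σ)² agrees with 4 (1 + σ) (1 + σ²)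
  -- up to first order in σ. Hence passing to g costs only 1 + θ⁴ per edge.
  1/12≤gv : inv 11 ≤ g * v
  1/12≤gv = subst₂ _≤_ (R²R⁻² (inv 11)) (solve 3 (λ p i v → con (inv 11) :* (con (fromℕ 4) :* p :* v) :* i := con (inv 2) :* (p :* i) :* v) refl ρ (R⁻¹ * R⁻¹) v)
    (monoʳ R⁻²≥0 (monoˡ (inv-nonNeg 11) R²≤4ρv))
    where
    open ≡-Reasoning
    e = ρ * ρ * (fromℕ 3 * σ * σ + fromℕ 4 * σ * σ * σ)
    R²≤4ρv : R * R ≤ fromℕ 4 * ρ * v
    R²≤4ρv = ≤-by e (*-nonNeg (*-nonNeg ρ≥0 ρ≥0) (+-nonNeg (*-nonNeg (*-nonNeg (fromℕ-nonNeg 3) σ≥0) σ≥0) (*-nonNeg (*-nonNeg (*-nonNeg (fromℕ-nonNeg 4) σ≥0) σ≥0) σ≥0))) (begin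
      fromℕ 4 * ρ * v                                  ≡⟨ ℚₚ.*-identityʳ (fromℕ 4 * ρ * v) ⟨
      fromℕ 4 * ρ * v * 1ℚ                             ≡⟨ cong (fromℕ 4 * ρ * v *_) ρ-unit ⟨
      fromℕ 4 * ρ * v * ((1ℚ + σ) * ρ)                 ≡⟨ solve 2 (λ p s → con (fromℕ 4) :* p :* (con 1ℚ :+ s :* s) :* ((con 1ℚ :+ s) :* p) :=
          ((con 1ℚ :+ s) :* p :+ p) :* ((con 1ℚ :+ s) :* p :+ p) :+ p :* p :* (con (fromℕ 3) :* s :* s :+ con (fromℕ 4) :* s :* s :* s)) refl ρ σ ⟩
      ((1ℚ + σ) * ρ + ρ) * ((1ℚ + σ) * ρ + ρ) + e      ≡⟨ cong (λ u → (u + ρ) * (u + ρ) + e) ρ-unit ⟩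
      R * R + e                                        ∎)

  x≤1 : x ≤ 1ℚ
  x≤1 = ≤-by (θ * x) (*-nonNeg θ≥0 x≥0) (trans (sym x-unit) (solve 2 (λ s r → (con 1ℚ :+ s) :* r := r :+ s :* r) refl θ x))

  -- Since 1/x = 1 + θ, x + 4 + 1/x = 6 + σx ≤ 6 + σ. As g R = ρ / (3R), it remains to see that (6 +
  -- σ) ρ = 5ρ + 1 ≤ 3 (1 + ρ) = 3R, which is ρ ≤ 1.
  decay-condition : g * R * (1ℚ + fromℕ 4 * x + x * x) ≤ x
  decay-condition = begin
    g * R * (1ℚ + fromℕ 4 * x + x * x)             ≡⟨ trans (cong (λ u → g * R * (u * u + fromℕ 4 * (x * u) + x * x)) x-unit) (cong (λ u → g * R * (1ℚ + fromℕ 4 * u + x * x)) (ℚₚ.*-identityʳ x)) ⟨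
    g * R * ((1ℚ + θ) * x * ((1ℚ + θ) * x) + fromℕ 4 * (x * ((1ℚ + θ) * x)) + x * x)
      ≡⟨ solve 3 (λ c x s → c :* ((con 1ℚ :+ s) :* x :* ((con 1ℚ :+ s) :* x) :+ con (fromℕ 4) :* (x :* ((con 1ℚ :+ s) :* x)) :+ x :* x) :=
          c :* x :* (con (fromℕ 6) :* ((con 1ℚ :+ s) :* x) :+ s :* s :* x)) refl (g * R) x θ ⟩
    g * R * x * (fromℕ 6 * ((1ℚ + θ) * x) + σ * x)
      ≤⟨ monoˡ (*-nonNeg (*-nonNeg g≥0 R≥0) x≥0) (+-mono-≤ (≤-reflexive (cong (fromℕ 6 *_) x-unit)) (≤-trans (monoˡ σ≥0 x≤1) (≤-reflexive (ℚₚ.*-identityʳ σ)))) ⟩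
    g * R * x * (fromℕ 6 * 1ℚ + σ)
      ≡⟨ solve 5 (λ p i r x s → con (inv 2) :* (p :* (i :* i)) :* r :* x :* (con (fromℕ 6) :* con 1ℚ :+ s) := con (inv 2) :* (r :* i) :* x :* i :* (con (fromℕ 5) :* p :+ (con 1ℚ :+ s) :* p)) refl ρ R⁻¹ R x σ ⟩
    inv 2 * (R * R⁻¹) * x * R⁻¹ * (fromℕ 5 * ρ + (1ℚ + σ) * ρ)
      ≡⟨ cong₂ (λ u u′ → inv 2 * u * x * R⁻¹ * (fromℕ 5 * ρ + u′)) R-unit ρ-unit ⟩
    inv 2 * 1ℚ * x * R⁻¹ * (fromℕ 5 * ρ + 1ℚ)
      ≤⟨ monoˡ (*-nonNeg (*-nonNeg (inv-nonNeg 2) x≥0) R⁻¹≥0) (≤-by (fromℕ 2 * (1ℚ - ρ)) (*-nonNeg (fromℕ-nonNeg 2) (diff-nonNeg ρ≤1))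
          (solve 1 (λ p → con (fromℕ 3) :* (con 1ℚ :+ p) := con (fromℕ 5) :* p :+ con 1ℚ :+ con (fromℕ 2) :* (con 1ℚ :- p)) refl ρ)) ⟩
    inv 2 * 1ℚ * x * R⁻¹ * (fromℕ 3 * R)
      ≡⟨ solve 3 (λ x i r → con (inv 2) :* con 1ℚ :* x :* i :* (con (fromℕ 3) :* r) := x :* (r :* i)) refl x R⁻¹ R ⟩
    x * (R * R⁻¹)                                   ≡⟨ trans (cong (x *_) R-unit) (ℚₚ.*-identityʳ x) ⟩
    x                                               ∎
    where open ≤-Reasoning

  F-bound : ∀ M q i → F M (i ℕ.+ q) ≤ U q * x ^ i
  F-bound M q i = F-decay T≤R R≥0 x≥0 (U-nonNeg q) decay-condition q
    (λ M → F≤U g≤1/12 (λ M → ≤-trans (T≤R M) R≤2) M q) M i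

  -- Each size m of the window has `hit m j` ≥ `hit n j`, and 12⁻ᵐ ≤ (g v)ᵐ with m ≤ N + L.
  hit-mass : ∀ n N L j → n ℕ.≤ N → hit n j * Σ< L (λ i → t (N ℕ.+ i) * inv 11 ^ (N ℕ.+ i)) ≤ v ^ (N ℕ.+ L) * F (N ℕ.+ L) j
  hit-mass n N L j n≤N = begin
    hit n j * Σ< L (λ i → t (N ℕ.+ i) * inv 11 ^ (N ℕ.+ i))       ≡⟨ Σ<-*ˡ L (hit n j) _ ⟨
    Σ< L (λ i → hit n j * (t (N ℕ.+ i) * inv 11 ^ (N ℕ.+ i)))     ≤⟨ Σ<-mono L (λ i i<L → term (N ℕ.+ i) (ℕₚ.≤-trans n≤N (ℕₚ.m≤m+n N i)) (ℕₚ.+-monoʳ-≤ N (ℕₚ.<⇒≤ i<L))) ⟩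
    Σ< L (λ i → v ^ (N ℕ.+ L) * f (N ℕ.+ i))                      ≡⟨ Σ<-*ˡ L (v ^ (N ℕ.+ L)) (λ i → f (N ℕ.+ i)) ⟩
    v ^ (N ℕ.+ L) * Σ< L (λ i → f (N ℕ.+ i))                      ≤⟨ monoˡ (^-nonNeg v≥0 (N ℕ.+ L))
                                                                      (≤-by (Σ< N f) (Σ<-nonNeg N (λ m → *-nonNeg (*-nonNeg (t-nonNeg m) (hit-nonNeg m j)) (^-nonNeg g≥0 m)))
                                                                        (trans (Σ<-++ N L f) (ℚₚ.+-comm (Σ< N f) (Σ< L (λ i → f (N ℕ.+ i)))))) ⟩
    v ^ (N ℕ.+ L) * F (N ℕ.+ L) j                                 ∎
    where
    open ≤-Reasoning
    f : ℕ → ℚ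
    f m = t m * hit m j * g ^ m
    term : ∀ m → n ℕ.≤ m → m ℕ.≤ N ℕ.+ L → hit n j * (t m * inv 11 ^ m) ≤ v ^ (N ℕ.+ L) * f m
    term m n≤m m≤ = begin
      hit n j * (t m * inv 11 ^ m)           ≤⟨ *-mono (*-nonNeg (t-nonNeg m) (^-nonNeg (inv-nonNeg 11) m)) (hit-nonNeg m j) (hit-mono j n≤m)
                                                 (monoˡ (t-nonNeg m) (≤-trans (^-monoˡ (inv-nonNeg 11) 1/12≤gv m) (≤-reflexive (^-distribʳ-* g v m)))) ⟩
      hit m j * (t m * (g ^ m * v ^ m))      ≤⟨ monoˡ (hit-nonNeg m j) (monoˡ (t-nonNeg m) (monoˡ (^-nonNeg g≥0 m) (^-monoʳ v≥1 m≤))) ⟩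
      hit m j * (t m * (g ^ m * v ^ (N ℕ.+ L))) ≡⟨ solve 4 (λ h t g v → h :* (t :* (g :* v)) := v :* (t :* h :* g)) refl (hit m j) (t m) (g ^ m) (v ^ (N ℕ.+ L)) ⟩
      v ^ (N ℕ.+ L) * f m                    ∎

  -- The constant is 8 = 2 · 4: the window has mass at least 1/(2q²), and q² `U q` ≤ 4.
  hit-bound : ∀ n r i → n ℕ.≤ suc r ℕ.^ 4 → hit n (i ℕ.+ suc r) ≤ fromℕ 8 * (v ^ (16 ℕ.* suc r ℕ.^ 4) * x ^ i)
  hit-bound n r i n≤N = begin
    hit n j                             ≡⟨ solve 1 (λ h → h := con (fromℕ 2) :* (h :* con (inv 1))) refl (hit n j) ⟩
    fromℕ 2 * (hit n j * inv 1)         ≤⟨ monoˡ (fromℕ-nonNeg 2) (monoˡ (hit-nonNeg n j) (critical-mass r)) ⟩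
    fromℕ 2 * (hit n j * (Q * Q * m))   ≡⟨ cong (fromℕ 2 *_) (solve 3 (λ h q m → h :* (q :* m) := q :* (h :* m)) refl (hit n j) (Q * Q) m) ⟩
    fromℕ 2 * (Q * Q * (hit n j * m))   ≤⟨ monoˡ (fromℕ-nonNeg 2) (monoˡ (*-nonNeg Q≥0 Q≥0) (≤-trans (hit-mass n N (15 ℕ.* N) j n≤N) (monoˡ v^≥0 (F-bound (16 ℕ.* N) q i)))) ⟩
    fromℕ 2 * (Q * Q * (vᴹ * (U q * x ^ i)))
      ≡⟨ solve 5 (λ q v a b y → con (fromℕ 2) :* (q :* q :* (v :* (con (fromℕ 4) :* (a :* b) :* y))) := con (fromℕ 8) :* (v :* y) :* (q :* a :* (q :* b))) refl Q vᴹ (inv q) (inv (suc q)) (x ^ i) ⟩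
    fromℕ 8 * (vᴹ * x ^ i) * (Q * inv q * (Q * inv (suc q)))
      ≤⟨ monoˡ (*-nonNeg (fromℕ-nonNeg 8) (*-nonNeg v^≥0 (^-nonNeg x≥0 i))) (*-mono {p = Q * inv q} {q = 1ℚ} {s = 1ℚ} (*-nonNeg Q≥0 (inv-nonNeg (suc q))) (<⇒≤ 0<1)
          (≤-trans (monoʳ {p = Q} (inv-nonNeg q) (p≤p+q (<⇒≤ 0<1))) (≤-reflexive (fromℕ-inv q)))
          (≤-trans (monoʳ {p = Q} (inv-nonNeg (suc q)) (p≤p+q (fromℕ-nonNeg 2))) (≤-reflexive (inv-suc q)))) ⟩
    fromℕ 8 * (vᴹ * x ^ i) * (1ℚ * 1ℚ)  ≡⟨ ℚₚ.*-identityʳ (fromℕ 8 * (vᴹ * x ^ i)) ⟩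
    fromℕ 8 * (vᴹ * x ^ i)              ∎
    where
    open ≤-Reasoning
    q N j : ℕ
    q = suc r
    N = q ℕ.^ 4
    j = i ℕ.+ q
    Q m vᴹ : ℚ
    Q = fromℕ q
    m = Σ< (15 ℕ.* N) (λ i → t (N ℕ.+ i) * inv 11 ^ (N ℕ.+ i))
    vᴹ = v ^ (16 ℕ.* N)
    Q≥0 : 0ℚ ≤ Q
    Q≥0 = fromℕ-nonNeg q
    v^≥0 : 0ℚ ≤ vᴹ
    v^≥0 = ^-nonNeg v≥0 (16 ℕ.* N)

-- Geometric decay on the fourth-root scale

-- The choice θ = κ / q. By Bernoulli (1 + θ)^q ≥ 1 + κ, so every block of q levels gains 1 + κ,
-- while the total cost of leaving the critical point is independent of l, n and r.
hit-tail : ∀ κ l n r → n ℕ.≤ suc r ℕ.^ 4 →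
  hit n (l ℕ.* suc r ℕ.+ suc r) * fromℕ (suc κ) ^ l ≤ fromℕ 8 * fromℕ 2 ^ (16 ℕ.* (2 ℕ.* κ ℕ.^ 4))
hit-tail κ l n r n≤N = begin
  hit n (l ℕ.* q ℕ.+ q) * K ^ l                           ≤⟨ monoʳ (^-nonNeg (fromℕ-nonNeg (suc κ)) l) (hit-bound n r (l ℕ.* q) n≤N) ⟩
  fromℕ 8 * (v ^ (16 ℕ.* N) * x ^ (l ℕ.* q)) * K ^ l      ≡⟨ solve 4 (λ c a b d → c :* (a :* b) :* d := c :* (a :* (d :* b))) refl (fromℕ 8) (v ^ (16 ℕ.* N)) (x ^ (l ℕ.* q)) (K ^ l) ⟩
  fromℕ 8 * (v ^ (16 ℕ.* N) * (K ^ l * x ^ (l ℕ.* q)))    ≤⟨ monoˡ (fromℕ-nonNeg 8) (*-mono {q = fromℕ 2 ^ (16 ℕ.* A)} {s = 1ℚ}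
      (*-nonNeg (^-nonNeg (fromℕ-nonNeg (suc κ)) l) (^-nonNeg x≥0 (l ℕ.* q))) (^-nonNeg (fromℕ-nonNeg 2) (16 ℕ.* A)) v-bound x-bound) ⟩
  fromℕ 8 * (fromℕ 2 ^ (16 ℕ.* A) * 1ℚ)                   ≡⟨ cong (fromℕ 8 *_) (ℚₚ.*-identityʳ (fromℕ 2 ^ (16 ℕ.* A))) ⟩
  fromℕ 8 * fromℕ 2 ^ (16 ℕ.* A)                          ∎
  where
  open ≤-Reasoning
  q N A : ℕ
  q = suc r
  N = q ℕ.^ 4
  A = 2 ℕ.* κ ℕ.^ 4
  K θ p u : ℚ
  K = fromℕ (suc κ)
  p = inv r
  θ = fromℕ κ * p
  u = inv 1 * p ^ 4
  u≥0 : 0ℚ ≤ u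
  u≥0 = *-nonNeg (inv-nonNeg 1) (^-nonNeg (inv-nonNeg r) 4)
  open Subcritical (*-nonNeg (fromℕ-nonNeg κ) (inv-nonNeg r)) using (v; v≥0; x; x≥0; x-unit; hit-bound)
  qp : fromℕ q * p ≡ 1ℚ
  qp = *-/-cancel (ℤ.+ 1) q
  x-bound : K ^ l * x ^ (l ℕ.* q) ≤ 1ℚ
  x-bound = begin
    K ^ l * x ^ (l ℕ.* q)        ≡⟨ trans (cong (K ^ l *_) (^-*-assoc x l q)) (sym (^-distribʳ-* K (x ^ q) l)) ⟩
    (K * x ^ q) ^ l              ≤⟨ ^-monoˡ (*-nonNeg (fromℕ-nonNeg (suc κ)) (^-nonNeg x≥0 q)) Kx≤1 l ⟩
    1ℚ ^ l                       ≡⟨ 1^ l ⟩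
    1ℚ                           ∎
    where
    Kx≤1 : K * x ^ q ≤ 1ℚ
    Kx≤1 = begin
      K * x ^ q                        ≡⟨ cong (_* x ^ q) (trans (fromℕ-suc κ) (trans (ℚₚ.+-comm (fromℕ κ) 1ℚ) (cong (1ℚ +_)
                                           (trans (sym (ℚₚ.*-identityʳ (fromℕ κ))) (trans (cong (fromℕ κ *_) (sym qp)) (solve 3 (λ k q p → k :* (q :* p) := q :* (k :* p)) refl (fromℕ κ) (fromℕ q) p)))))) ⟩
      (1ℚ + fromℕ q * θ) * x ^ q       ≤⟨ monoʳ (^-nonNeg x≥0 q) (bernoulli⁺ (*-nonNeg (fromℕ-nonNeg κ) (inv-nonNeg r)) q) ⟩
      (1ℚ + θ) ^ q * x ^ q             ≡⟨ trans (sym (^-distribʳ-* (1ℚ + θ) x q)) (trans (cong (_^ q) x-unit) (1^ q)) ⟩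
      1ℚ                               ∎
  -- θ⁴ equals A u with u = 1/(2N). Writing v as at most a power of 1 + u and swapping exponents, v
  -- to the N is at most the A-th power of (1 + u)^N ≤ 2.
  v≤ : v ≤ (1ℚ + u) ^ A
  v≤ = ≤-trans (≤-reflexive (cong (1ℚ +_) (trans (solve 2 (λ k p → k :* p :* (k :* p) :* (k :* p :* (k :* p)) :=
      con (fromℕ 2) :* (k :* (k :* (k :* (k :* con 1ℚ)))) :* (con (inv 1) :* (p :* (p :* (p :* (p :* con 1ℚ)))))) refl (fromℕ κ) p)
      (cong (_* u) (trans (cong (fromℕ 2 *_) (sym (fromℕ-^ κ 4))) (sym (fromℕ-* 2 (κ ℕ.^ 4)))))))) (bernoulli⁺ u≥0 A)
  N2u≡1 : fromℕ N * (u + u) ≡ 1ℚ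
  N2u≡1 = trans (cong₂ _*_ (fromℕ-^ q 4) (solve 1 (λ y → con (inv 1) :* y :+ con (inv 1) :* y := y) refl (p ^ 4)))
    (trans (sym (^-distribʳ-* (fromℕ q) p 4)) (trans (cong (_^ 4) qp) (1^ 4)))
  v-bound : v ^ (16 ℕ.* N) ≤ fromℕ 2 ^ (16 ℕ.* A)
  v-bound = begin
    v ^ (16 ℕ.* N)               ≡⟨ ^-*-assoc v 16 N ⟩
    (v ^ N) ^ 16                 ≤⟨ ^-monoˡ (^-nonNeg v≥0 N) (begin
      v ^ N                        ≤⟨ ^-monoˡ v≥0 v≤ N ⟩
      ((1ℚ + u) ^ A) ^ N           ≡⟨ ^-*-assoc (1ℚ + u) N A ⟨
      (1ℚ + u) ^ (N ℕ.* A)         ≡⟨ trans (cong ((1ℚ + u) ^_) (ℕₚ.*-comm N A)) (^-*-assoc (1ℚ + u) A N) ⟩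
      ((1ℚ + u) ^ N) ^ A           ≤⟨ ^-monoˡ (^-nonNeg (+-nonNeg (<⇒≤ 0<1) u≥0) N)
                                       (≤-trans ([1+u]^k≤1+2ku u≥0 N (≤-reflexive N2u≡1) N ℕₚ.≤-refl) (≤-reflexive (cong (1ℚ +_) N2u≡1))) A ⟩
      fromℕ 2 ^ A                  ∎) 16 ⟩
    (fromℕ 2 ^ A) ^ 16           ≡⟨ ^-*-assoc (fromℕ 2) 16 A ⟨
    fromℕ 2 ^ (16 ℕ.* A)         ∎

-- Counting labelled trees

module _ {A : Set} where

  count : (A → Bool) → List A → ℕ
  count p xs = length (filterᵇ p xs)

  count-++ : ∀ p xs ys → count p (xs ++ ys) ≡ count p xs ℕ.+ count p ys
  count-++ p xs ys = trans (cong length (filter-++ (T? ∘ p) xs ys)) (length-++ (filterᵇ p xs))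

  count-cong : ∀ {p q} → (∀ x → p x ≡ q x) → ∀ xs → count p xs ≡ count q xs
  count-cong eq [] = refl
  count-cong {p} {q} eq (x ∷ xs) with p x | q x | eq x
  ... | true  | _ | refl = cong suc (count-cong eq xs)
  ... | false | _ | refl = count-cong eq xs

  count-true : ∀ xs → count (λ _ → true) xs ≡ length xs
  count-true []       = refl
  count-true (x ∷ xs) = cong suc (count-true xs)

  count-false : ∀ xs → count (λ _ → false) xs ≡ 0
  count-false []       = refl
  count-false (x ∷ xs) = count-false xs

  count-disjoint : ∀ {p q} xs → (∀ {x} → x ∈ xs → p x ≡ true → q x ≡ false) → count p xs ℕ.+ count q xs ℕ.≤ length xs
  count-disjoint []       _ = ℕ.z≤n
  count-disjoint {p} {q} (x ∷ xs) dis with ih ← count-disjoint {p} {q} xs (dis ∘ there) | p x | q x | dis (here refl)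
  ... | true  | true  | h = contradiction (h refl) λ ()
  ... | true  | false | _ = ℕ.s≤s ih
  ... | false | true  | _ = ℕₚ.≤-trans (ℕₚ.≤-reflexive (ℕₚ.+-suc (count p xs) (count q xs))) (ℕ.s≤s ih)
  ... | false | false | _ = ℕₚ.m≤n⇒m≤1+n ih

count-map : ∀ {A B : Set} p (f : A → B) xs → count p (map f xs) ≡ count (p ∘ f) xs
count-map p f [] = refl
count-map p f (x ∷ xs) with p (f x)
... | true  = cong suc (count-map p f xs)
... | false = count-map p f xs

count-product : ∀ {A B C : Set} {p : C → Bool} {q : A → Bool} {r : B → Bool} (f : A → B → C) →
  (∀ x y → p (f x y) ≡ q x ∧ r y) → ∀ xs ys →
  count p (cartesianProductWith f xs ys) ≡ count q xs ℕ.* count r ys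
count-product f eq [] ys = refl
count-product {p = p} {q} {r} f eq (x ∷ xs) ys = begin
  count p (map (f x) ys ++ cartesianProductWith f xs ys)             ≡⟨ count-++ p (map (f x) ys) (cartesianProductWith f xs ys) ⟩
  count p (map (f x) ys) ℕ.+ count p (cartesianProductWith f xs ys)  ≡⟨ cong₂ ℕ._+_ (trans (count-map p (f x) ys) (count-cong (eq x) ys)) (count-product {p = p} {q} {r} f eq xs ys) ⟩
  count (λ y → q x ∧ r y) ys ℕ.+ count q xs ℕ.* count r ys           ≡⟨ head ⟩
  count q (x ∷ xs) ℕ.* count r ys                                    ∎
  where
  open ≡-Reasoning
  head : count (λ y → q x ∧ r y) ys ℕ.+ count q xs ℕ.* count r ys ≡ count q (x ∷ xs) ℕ.* count r ys
  head with q x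
  ... | true  = refl
  ... | false = cong (ℕ._+ count q xs ℕ.* count r ys) (count-false ys)

Δ-Σ< : ∀ n h → Δ n h ≡ Σ< (suc n) (λ i → h i (n ∸ i))
Δ-Σ< zero    h = sym (ℚₚ.+-identityʳ (h 0 0))
Δ-Σ< (suc n) h = cong (h 0 (suc n) +_) (Δ-Σ< n (h ∘ suc))

# : {A : Set} → (A → Bool) → List A → ℚ
# p xs = fromℕ (count p xs)

#-concatMap-steps : ∀ {A : Set} (p : A → Bool) (h : ℕ × ℤ → List A) f n →
  # p (concatMap h (cartesianProduct (applyUpTo f n) steps)) ≡
  Σ< n (λ i → # p (h (f i , ℤ.-1ℤ)) + # p (h (f i , ℤ.0ℤ)) + # p (h (f i , ℤ.1ℤ)))
#-concatMap-steps p h f zero    = refl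
#-concatMap-steps p h f (suc n) = begin
  # p (h (f 0 , ℤ.-1ℤ) ++ h (f 0 , ℤ.0ℤ) ++ h (f 0 , ℤ.1ℤ) ++ rest)
    ≡⟨ #-++ (h (f 0 , ℤ.-1ℤ)) _ ⟩
  a + # p (h (f 0 , ℤ.0ℤ) ++ h (f 0 , ℤ.1ℤ) ++ rest)
    ≡⟨ cong (a +_) (trans (#-++ (h (f 0 , ℤ.0ℤ)) _) (cong (b +_) (#-++ (h (f 0 , ℤ.1ℤ)) rest))) ⟩
  a + (b + (c + # p rest))
    ≡⟨ solve 4 (λ a b c d → a :+ (b :+ (c :+ d)) := a :+ b :+ c :+ d) refl a b c (# p rest) ⟩
  a + b + c + # p rest
    ≡⟨ cong (a + b + c +_) (#-concatMap-steps p h (f ∘ suc) n) ⟩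
  Σ< (suc n) (λ i → # p (h (f i , ℤ.-1ℤ)) + # p (h (f i , ℤ.0ℤ)) + # p (h (f i , ℤ.1ℤ))) ∎
  where
  open ≡-Reasoning
  rest = concatMap h (cartesianProduct (applyUpTo (f ∘ suc) n) steps)
  a = # p (h (f 0 , ℤ.-1ℤ))
  b = # p (h (f 0 , ℤ.0ℤ))
  c = # p (h (f 0 , ℤ.1ℤ))
  #-++ : ∀ xs ys → # p (xs ++ ys) ≡ # p xs + # p ys
  #-++ xs ys = trans (cong fromℕ (count-++ p xs ys)) (fromℕ-+ (count p xs) (count p ys))

module _ (P : List Tree → Bool) (Q : ℤ → List Tree → Bool) (graft-split : ∀ y cs ts → P (graft y cs ts) ≡ Q y cs ∧ P ts) where

  -- A predicate that factors over the first tree and the remaining forest makes the counts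
  -- multiply. It serves both the total count and the count of forests below a level.
  #-forests-suc : ∀ f x n → let q = λ i δ → # (Q (x ℤ.+ δ)) (forests f (x ℤ.+ δ) i) in
    # P (forests (suc f) x (suc n)) ≡ Δ n (λ i k → (q i ℤ.-1ℤ + q i ℤ.0ℤ + q i ℤ.1ℤ) * # P (forests f x k))
  #-forests-suc f x n = begin
    # P (forests (suc f) x (suc n))
      ≡⟨ #-concatMap-steps P (splits f x n) (λ i → i) (suc n) ⟩
    Σ< (suc n) (λ i → # P (splits f x n (i , ℤ.-1ℤ)) + # P (splits f x n (i , ℤ.0ℤ)) + # P (splits f x n (i , ℤ.1ℤ)))
      ≡⟨ Σ<-cong (suc n) (λ i → trans
          (cong₂ _+_ (cong₂ _+_ (#-splits i ℤ.-1ℤ) (#-splits i ℤ.0ℤ)) (#-splits i ℤ.1ℤ))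
          (solve 4 (λ a b c r → a :* r :+ b :* r :+ c :* r := (a :+ b :+ c) :* r) refl (q i ℤ.-1ℤ) (q i ℤ.0ℤ) (q i ℤ.1ℤ) (# P (forests f x (n ∸ i))))) ⟩
    Σ< (suc n) (λ i → (q i ℤ.-1ℤ + q i ℤ.0ℤ + q i ℤ.1ℤ) * # P (forests f x (n ∸ i)))
      ≡⟨ Δ-Σ< n (λ i k → (q i ℤ.-1ℤ + q i ℤ.0ℤ + q i ℤ.1ℤ) * # P (forests f x k)) ⟨
    Δ n (λ i k → (q i ℤ.-1ℤ + q i ℤ.0ℤ + q i ℤ.1ℤ) * # P (forests f x k)) ∎
    where
    open ≡-Reasoning
    q : ℕ → ℤ → ℚ
    q i δ = # (Q (x ℤ.+ δ)) (forests f (x ℤ.+ δ) i)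
    #-splits : ∀ i δ → # P (splits f x n (i , δ)) ≡ q i δ * # P (forests f x (n ∸ i))
    #-splits i δ = trans
      (cong fromℕ (count-product {p = P} {Q (x ℤ.+ δ)} {P} (graft (x ℤ.+ δ)) (graft-split (x ℤ.+ δ)) (forests f (x ℤ.+ δ) i) (forests f x (n ∸ i))))
      (fromℕ-* (count (Q (x ℤ.+ δ)) (forests f (x ℤ.+ δ) i)) (count P (forests f x (n ∸ i))))

#-forests : ∀ f x n → n ℕ.≤ f → # (λ _ → true) (forests f x n) ≡ t n
#-forests zero    x zero    _ = refl
#-forests (suc f) x zero    _ = refl
#-forests (suc f) x (suc n) (ℕ.s≤s n≤f) = begin
  # (λ _ → true) (forests (suc f) x (suc n))      ≡⟨ #-forests-suc (λ _ → true) (λ _ _ → true) (λ _ _ _ → refl) f x n ⟩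
  Δ n (λ i k → (q i ℤ.-1ℤ + q i ℤ.0ℤ + q i ℤ.1ℤ) * # (λ _ → true) (forests f x k))
    ≡⟨ Δ-cong n (λ { i k refl → cong₂ _*_ (cong₂ _+_ (cong₂ _+_ (left i k ℤ.-1ℤ refl) (left i k ℤ.0ℤ refl)) (left i k ℤ.1ℤ refl)) (#-forests f x k (ℕₚ.≤-trans (ℕₚ.m≤n+m k i) n≤f)) }) ⟩
  Δ n (λ i k → (t i + t i + t i) * t k)           ≡⟨ Δ-cong n (λ i k _ → solve 2 (λ x y → (x :+ x :+ x) :* y := con (fromℕ 3) :* x :* y) refl (t i) (t k)) ⟩
  Δ n (λ i k → fromℕ 3 * t i * t k)               ≡⟨ t-suc n ⟨
  t (suc n)                                       ∎
  where
  open ≡-Reasoning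
  q : ℕ → ℤ → ℚ
  q i δ = # (λ _ → true) (forests f (x ℤ.+ δ) i)
  left : ∀ i k δ → i ℕ.+ k ≡ n → q i δ ≡ t i
  left i k δ refl = #-forests f (x ℤ.+ δ) i (ℕₚ.≤-trans (ℕₚ.m≤m+n i k) n≤f)

-- Trees whose labels stay below a level

-- The test recurses on the tree and not on the contour, so that it factors over `graft`;
-- `contour-low` carries it over to the walk.
low    : ℤ → Tree → Bool
allLow : ℤ → List Tree → Bool
low c (node x ts) = does (x ℤₚ.<? c) ∧ allLow c ts
allLow c []       = true
allLow c (u ∷ us) = low c u ∧ allLow c us

does⇒ : ∀ x c → does (x ℤₚ.<? c) ≡ true → x ℤ.< c
does⇒ x c h with x ℤₚ.<? c
... | yes x<c = x<c
... | no  _   = contradiction h λ ()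

contour-low    : ∀ c u → low c u ≡ true → All (λ v → label v ℤ.< c) (contour u)
excursions-low : ∀ c u us → label u ℤ.< c → allLow c us ≡ true → All (λ v → label v ℤ.< c) (excursions u us)
contour-low c u@(node x ts) h = x<c ∷ excursions-low c u ts x<c (∧-conicalʳ _ _ h)
  where x<c = does⇒ x c (∧-conicalˡ _ _ h)
excursions-low c u []       u<c h = []
excursions-low c u (v ∷ vs) u<c h = ++⁺ (contour-low c v (∧-conicalˡ _ _ h)) (u<c ∷ excursions-low c u vs u<c (∧-conicalʳ _ _ h))

V-low : ∀ c U → low c U ≡ true → ∀ k → V U k ℤ.< c
V-low c U h k = All.lookup (contour-low c U h) (∈-lookup {xs = contour U} k)

#-low : ∀ f x n j c → n ℕ.≤ f → c ≡ x ℤ.+ ℤ.+ j → # (λ cs → low c (node x cs)) (forests f x n) ≡ t n * avoid n j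
#-low f x n zero c n≤f refl = trans
  (cong fromℕ (trans (count-cong (λ cs → cong (_∧ allLow c cs) (dec-false (x ℤₚ.<? c) (λ x<c → ℤₚ.<-irrefl (sym (ℤₚ.+-identityʳ x)) x<c))) (forests f x n)) (count-false (forests f x n))))
  (sym (ℚₚ.*-zeroʳ (t n)))
#-low f x n (suc j) c n≤f c≡ = trans (cong fromℕ (unguard f n)) (go f n n≤f)
  where
  x<c : x ℤ.< c
  x<c = subst₂ ℤ._<_ (ℤₚ.+-identityʳ x) (sym c≡) (ℤₚ.+-monoʳ-< x (ℤ.+<+ (ℕ.z<s {j})))
  unguard : ∀ f n → count (λ cs → low c (node x cs)) (forests f x n) ≡ count (allLow c) (forests f x n)
  unguard f n = count-cong (λ cs → cong (_∧ allLow c cs) (dec-true (x ℤₚ.<? c) x<c)) (forests f x n)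
  child : ∀ δ j′ → δ ℤ.+ ℤ.+ j′ ≡ ℤ.+ suc j → c ≡ x ℤ.+ δ ℤ.+ ℤ.+ j′
  child δ j′ eq = trans c≡ (trans (cong (λ k → x ℤ.+ k) (sym eq)) (sym (ℤₚ.+-assoc x δ (ℤ.+ j′))))
  open ≡-Reasoning
  go : ∀ f n → n ℕ.≤ f → # (allLow c) (forests f x n) ≡ t n * avoid n (suc j)
  go zero    zero    _ = refl
  go (suc f) zero    _ = refl
  go (suc f) (suc n) (ℕ.s≤s n≤f) = begin
    # (allLow c) (forests (suc f) x (suc n))   ≡⟨ #-forests-suc (allLow c) (λ y cs → low c (node y cs)) (λ _ _ _ → refl) f x n ⟩
    Δ n (λ i k → (q i ℤ.-1ℤ + q i ℤ.0ℤ + q i ℤ.1ℤ) * # (allLow c) (forests f x k))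
      ≡⟨ Δ-cong n (λ { i k refl → let i≤f = ℕₚ.≤-trans (ℕₚ.m≤m+n i k) n≤f in cong₂ _*_
          (cong₂ _+_ (cong₂ _+_
            (#-low f (x ℤ.+ ℤ.-1ℤ) i (suc (suc j)) c i≤f (child ℤ.-1ℤ (suc (suc j)) refl))
            (#-low f (x ℤ.+ ℤ.0ℤ) i (suc j) c i≤f (child ℤ.0ℤ (suc j) refl)))
            (#-low f (x ℤ.+ ℤ.1ℤ) i j c i≤f (child ℤ.1ℤ j refl)))
          (go f k (ℕₚ.≤-trans (ℕₚ.m≤n+m k i) n≤f)) }) ⟩
    Δ n (λ i k → (t i * avoid i (suc (suc j)) + t i * avoid i (suc j) + t i * avoid i j) * (t k * avoid k (suc j)))
      ≡⟨ Δ-cong n (λ i k _ → solve 6 (λ x y a b c e → (x :* c :+ x :* b :+ x :* a) :* (y :* e) := con (fromℕ 3) :* x :* y :* (con (inv 2) :* (a :+ b :+ c) :* e))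
          refl (t i) (t k) (avoid i j) (avoid i (suc j)) (avoid i (suc (suc j))) (avoid k (suc j))) ⟩
    Δ n (λ i k → fromℕ 3 * t i * t k * (mean (avoid i) j * avoid k (suc j)))
      ≡⟨ t-w n (λ i k → mean (avoid i) j * avoid k (suc j)) ⟨
    t (suc n) * Δ n (λ i k → w i k * (mean (avoid i) j * avoid k (suc j)))
      ≡⟨ cong (t (suc n) *_) (avoid-suc n j) ⟨
    t (suc n) * avoid (suc n) (suc j) ∎
    where
    q : ℕ → ℤ → ℚ
    q i δ = # (λ cs → low c (node (x ℤ.+ δ) cs)) (forests f (x ℤ.+ δ) i)

-- `A` and `low` count disjoint sets of trees, and the share of `low` is exactly `avoid n j`.
-- Disjointness from this decidable event suffices, so the event behind `A` need not be decided.
prob≤hit : ∀ n j A → (∀ U → IsLabelledTree n U → A U ≡ true → low (ℤ.+ j) U ≡ false) → prob n A ≤ hit n j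
prob≤hit n j A dis = *-cancelˡ-≤ {fromℕ L} L>0 (begin
  fromℕ L * prob n A                         ≡⟨ *-/-cancel (ℤ.+ a) L {{∣Ω∣≢0 n}} ⟩
  fromℕ a                                    ≡⟨ solve 2 (λ a b → a := a :+ b :- b) refl (fromℕ a) (fromℕ b) ⟩
  fromℕ a + fromℕ b - fromℕ b                ≡⟨ cong (_- fromℕ b) (fromℕ-+ a b) ⟨
  fromℕ (a ℕ.+ b) - fromℕ b                  ≤⟨ ℚₚ.+-monoˡ-≤ (- fromℕ b) (fromℕ-mono (count-disjoint (Ω n) (λ {U} U∈ → dis U (Ω-sound U∈)))) ⟩
  fromℕ L - fromℕ b                          ≡⟨ cong (λ s → fromℕ L - s) (trans (cong fromℕ (count-map (low (ℤ.+ j)) (node ℤ.0ℤ) (forests n ℤ.0ℤ n))) (#-low n ℤ.0ℤ n j (ℤ.+ j) ℕₚ.≤-refl refl)) ⟩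
  fromℕ L - t n * avoid n j                  ≡⟨ cong (λ s → fromℕ L - s * avoid n j) L≡ ⟨
  fromℕ L - fromℕ L * avoid n j              ≡⟨ solve 2 (λ l a → l :- l :* a := l :* (con 1ℚ :- a)) refl (fromℕ L) (avoid n j) ⟩
  fromℕ L * hit n j                          ∎)
  where
  open ≤-Reasoning
  L a b : ℕ
  L = length (Ω n)
  a = count A (Ω n)
  b = count (low (ℤ.+ j)) (Ω n)
  L>0 : 0ℚ < fromℕ L
  L>0 = /-pos L 1 {{∣Ω∣≢0 n}}
  L≡ : fromℕ L ≡ t n
  L≡ = trans (cong fromℕ (trans (sym (count-true (Ω n))) (count-map (λ _ → true) (node ℤ.0ℤ) (forests n ℤ.0ℤ n)))) (#-forests n ℤ.0ℤ n ℕₚ.≤-refl)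

-- A lower bound for the exponential

module _ {B : ℚ} (B≥0 : 0ℚ ≤ B) where

  -- Exactness of the first-order part rests on (b + Δ) (β + Δ β′ + e) − β b = (j + 3) Δ β + Δ² β′ + a e
  -- for consecutive terms β′, β of the series at b and a = b + Δ.
  term-taylor : ∀ {a b} → ∣ a ∣ ≤ B → ∣ b ∣ ≤ B → ∀ j →
    ∣ expTerm a (suc (suc j)) - expTerm b (suc (suc j)) - (a - b) * expTerm b (suc j) ∣ ≤ expTerm B j * ((a - b) * (a - b))
  term-taylor {a} {b} ha hb zero = ≤-trans (≤-reflexive (trans (cong ∣_∣
      (solve 2 (λ a b → con 1ℚ :* a :* con (inv 0) :* a :* con (inv 1) :- con 1ℚ :* b :* con (inv 0) :* b :* con (inv 1) :- (a :- b) :* (con 1ℚ :* b :* con (inv 0))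
        := con (inv 1) :* ((a :- b) :* (a :- b))) refl a b)) (ℚₚ.0≤p⇒∣p∣≡p ½Δ²≥0)))
    (monoʳ Δ²≥0 (1/-anti {0} {1} ℕ.z≤n))
    where
    Δ²≥0 : 0ℚ ≤ (a - b) * (a - b)
    Δ²≥0 = square-nonNeg (a - b)
    ½Δ²≥0 : 0ℚ ≤ inv 1 * ((a - b) * (a - b))
    ½Δ²≥0 = *-nonNeg (inv-nonNeg 1) Δ²≥0
  term-taylor {a} {b} ha hb (suc j) = begin
    ∣ α * a * ρ - β * b * ρ - δ * β ∣        ≡⟨ cong ∣_∣ expand ⟩
    ∣ ρ * (δ * δ * β′ + e * a) ∣             ≡⟨ trans (ℚₚ.∣p*q∣≡∣p∣*∣q∣ ρ _) (cong (_* ∣ δ * δ * β′ + e * a ∣) (ℚₚ.0≤p⇒∣p∣≡p (inv-nonNeg (suc (suc j))))) ⟩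
    ρ * ∣ δ * δ * β′ + e * a ∣               ≤⟨ monoˡ (inv-nonNeg (suc (suc j))) (≤-trans (ℚₚ.∣p+q∣≤∣p∣+∣q∣ (δ * δ * β′) (e * a)) (+-mono-≤ first second)) ⟩
    ρ * (δ * δ * T′ + T * (δ * δ) * B)       ≡⟨ cong (ρ *_) (trans (solve 4 (λ d T′ T B → d :* T′ :+ T :* d :* B := d :* (T′ :+ T :* B)) refl (δ * δ) T′ T B) (cong (λ s → δ * δ * (T′ + s)) TB)) ⟩
    ρ * (δ * δ * (T′ + (c + 1ℚ) * T′))       ≡⟨ solve 4 (λ p d c T′ → p :* (d :* (T′ :+ (c :+ con 1ℚ) :* T′)) := (c :+ con (fromℕ 2)) :* p :* (T′ :* d)) refl ρ (δ * δ) c T′ ⟩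
    (c + fromℕ 2) * ρ * (T′ * (δ * δ))       ≤⟨ monoʳ {p = (c + fromℕ 2) * ρ} (*-nonNeg (expTerm-nonNeg B≥0 (suc j)) (square-nonNeg δ)) (≤-by ρ (inv-nonNeg (suc (suc j)))
                                                 (trans (sym ρ-unit) (solve 2 (λ c p → (c :+ con (fromℕ 3)) :* p := (c :+ con (fromℕ 2)) :* p :+ p) refl c ρ))) ⟩
    1ℚ * (T′ * (δ * δ))                      ≡⟨ ℚₚ.*-identityˡ _ ⟩
    T′ * (δ * δ)                             ∎
    where
    open ≤-Reasoning
    c α β β′ δ ρ e T T′ : ℚ
    c = fromℕ j
    α = expTerm a (suc (suc j))
    β = expTerm b (suc (suc j))
    β′ = expTerm b (suc j)
    δ = a - b
    ρ = inv (suc (suc j))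
    e = α - β - δ * β′
    T = expTerm B j
    T′ = expTerm B (suc j)
    ρ-unit : (c + fromℕ 3) * ρ ≡ 1ℚ
    ρ-unit = trans (cong (_* ρ) (trans (solve 1 (λ c → c :+ con (fromℕ 3) := c :+ con 1ℚ :+ con (fromℕ 2)) refl c) (cong (_+ fromℕ 2) (sym (fromℕ-suc j))))) (inv-suc (suc j))
    βb : β′ * b ≡ (c + fromℕ 2) * β
    βb = trans (sym (ℚₚ.*-identityʳ (β′ * b))) (trans (cong (β′ * b *_) (sym (inv-suc j)))
      (solve 4 (λ x b c p → x :* b :* ((c :+ con (fromℕ 2)) :* p) := (c :+ con (fromℕ 2)) :* (x :* b :* p)) refl β′ b c (inv (suc j))))
    TB : T * B ≡ (c + 1ℚ) * T′
    TB = trans (sym (ℚₚ.*-identityʳ (T * B))) (trans (cong (T * B *_) (sym (fromℕ-inv j)))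
      (solve 4 (λ x b c p → x :* b :* ((c :+ con 1ℚ) :* p) := (c :+ con 1ℚ) :* (x :* b :* p)) refl T B c (inv j)))
    expand : α * a * ρ - β * b * ρ - δ * β ≡ ρ * (δ * δ * β′ + e * a)
    expand = begin-equality
      α * a * ρ - β * b * ρ - δ * β                              ≡⟨ cong (λ s → α * a * ρ - β * b * ρ - s) (ℚₚ.*-identityˡ (δ * β)) ⟨
      α * a * ρ - β * b * ρ - 1ℚ * (δ * β)                       ≡⟨ cong (λ s → α * a * ρ - β * b * ρ - s * (δ * β)) ρ-unit ⟨
      α * a * ρ - β * b * ρ - (c + fromℕ 3) * ρ * (δ * β)
        ≡⟨ solve 6 (λ a b p α β c → α :* a :* p :- β :* b :* p :- (c :+ con (fromℕ 3)) :* p :* ((a :- b) :* β) :=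
            p :* (α :* a :- β :* a :- (a :- b) :* ((c :+ con (fromℕ 2)) :* β))) refl a b ρ α β c ⟩
      ρ * (α * a - β * a - δ * ((c + fromℕ 2) * β))              ≡⟨ cong (λ s → ρ * (α * a - β * a - δ * s)) βb ⟨
      ρ * (α * a - β * a - δ * (β′ * b))
        ≡⟨ solve 6 (λ a b p α β β′ → p :* (α :* a :- β :* a :- (a :- b) :* (β′ :* b)) :=
            p :* ((a :- b) :* (a :- b) :* β′ :+ (α :- β :- (a :- b) :* β′) :* a)) refl a b ρ α β β′ ⟩
      ρ * (δ * δ * β′ + e * a)                                   ∎
    first : ∣ δ * δ * β′ ∣ ≤ δ * δ * T′
    first = ≤-trans (≤-reflexive (trans (ℚₚ.∣p*q∣≡∣p∣*∣q∣ (δ * δ) β′) (cong (_* ∣ β′ ∣) (ℚₚ.0≤p⇒∣p∣≡p (square-nonNeg δ)))))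
      (monoˡ (square-nonNeg δ) (term-bound B≥0 hb (suc j)))
    second : ∣ e * a ∣ ≤ T * (δ * δ) * B
    second = ≤-trans (≤-reflexive (ℚₚ.∣p*q∣≡∣p∣*∣q∣ e a))
      (*-mono (ℚₚ.0≤∣p∣ a) (*-nonNeg (expTerm-nonNeg B≥0 j) (square-nonNeg δ)) (term-taylor ha hb j) ha)

  -- The derivative of a truncation of the exponential series is the truncation one term shorter,
  -- which is why the linear term stops at `suc k`. The second-order remainder is dominated by the
  -- series at `B`.
  sum-taylor : ∀ {a b} → ∣ a ∣ ≤ B → ∣ b ∣ ≤ B → ∀ k →
    expSum b (suc (suc k)) + (a - b) * expSum b (suc k) ≤ expSum a (suc (suc k)) + expSum B k * ((a - b) * (a - b))
  sum-taylor {a} {b} ha hb k = go k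
    where
    open ≤-Reasoning
    δ = a - b
    term : ∀ k → expTerm b (suc (suc k)) + δ * expTerm b (suc k) ≤ expTerm a (suc (suc k)) + expTerm B k * (δ * δ)
    term k = begin
      y + z             ≡⟨ solve 3 (λ x y z → y :+ z := x :- (x :- y :- z)) refl x y z ⟩
      x - (x - y - z)   ≤⟨ ℚₚ.+-monoʳ-≤ x (≤-trans (x≤∣x∣ (- (x - y - z))) (≤-trans (≤-reflexive (ℚₚ.∣-p∣≡∣p∣ (x - y - z))) (term-taylor ha hb k))) ⟩
      x + expTerm B k * (δ * δ) ∎
      where
      x = expTerm a (suc (suc k))
      y = expTerm b (suc (suc k))
      z = δ * expTerm b (suc k)
    go : ∀ k → expSum b (suc (suc k)) + δ * expSum b (suc k) ≤ expSum a (suc (suc k)) + expSum B k * (δ * δ)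
    go zero = begin
      1ℚ + expTerm b 1 + expTerm b 2 + δ * (1ℚ + expTerm b 1)       ≡⟨ solve 3 (λ a b y → con 1ℚ :+ con 1ℚ :* b :* con (inv 0) :+ y :+ (a :- b) :* (con 1ℚ :+ con 1ℚ :* b :* con (inv 0))
                                                                         := con 1ℚ :+ con 1ℚ :* a :* con (inv 0) :+ (y :+ (a :- b) :* (con 1ℚ :* b :* con (inv 0)))) refl a b (expTerm b 2) ⟩
      1ℚ + expTerm a 1 + (expTerm b 2 + δ * expTerm b 1)            ≤⟨ ℚₚ.+-monoʳ-≤ (1ℚ + expTerm a 1) (term 0) ⟩
      1ℚ + expTerm a 1 + (expTerm a 2 + 1ℚ * (δ * δ))               ≡⟨ ℚₚ.+-assoc (1ℚ + expTerm a 1) (expTerm a 2) (1ℚ * (δ * δ)) ⟨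
      1ℚ + expTerm a 1 + expTerm a 2 + 1ℚ * (δ * δ)                 ∎
    go (suc k) = begin
      P + p + δ * (Q + q)                       ≡⟨ solve 5 (λ P p d Q q → P :+ p :+ d :* (Q :+ q) := P :+ d :* Q :+ (p :+ d :* q)) refl P p δ Q q ⟩
      P + δ * Q + (p + δ * q)                   ≤⟨ +-mono-≤ (go k) (term (suc k)) ⟩
      R + E * (δ * δ) + (r + e * (δ * δ))       ≡⟨ solve 5 (λ R E d r e → R :+ E :* d :+ (r :+ e :* d) := R :+ r :+ (E :+ e) :* d) refl R E (δ * δ) r e ⟩
      R + r + (E + e) * (δ * δ)                 ∎
      where
      P = expSum b (suc (suc k))
      p = expTerm b (suc (suc (suc k)))
      Q = expSum b (suc k)
      q = expTerm b (suc (suc k))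
      R = expSum a (suc (suc k))
      r = expTerm a (suc (suc (suc k)))
      E = expSum B k
      e = expTerm B (suc k)

  -- Taylor at b with increment -h. The error has two sources: the second-order remainder, and the
  -- last term of the series, which is absent from the derivative.
  euler-step : ∀ {b h} → 0ℚ ≤ h → ∣ b - h ∣ ≤ B → ∣ b ∣ ≤ B → ∀ k →
    (1ℚ - h) * expSum b (suc (suc k)) ≤ expSum (b - h) (suc (suc k)) + h * (expTerm B (suc (suc k)) + expSum B k * h)
  euler-step {b} {h} h≥0 hb-h hb k = begin
    (1ℚ - h) * (Q + q)                                     ≡⟨ solve 4 (λ b h Q q → (con 1ℚ :- h) :* (Q :+ q) := (Q :+ q) :+ (b :- h :- b) :* Q :- h :* q) refl b h Q q ⟩
    Q + q + (b - h - b) * Q - h * q                        ≤⟨ +-mono-≤ (sum-taylor hb-h hb k) -hq≤ ⟩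
    A + E * ((b - h - b) * (b - h - b)) + h * τ            ≡⟨ solve 5 (λ A E b h t → A :+ E :* ((b :- h :- b) :* (b :- h :- b)) :+ h :* t := A :+ h :* (t :+ E :* h)) refl A E b h τ ⟩
    A + h * (τ + E * h)                                    ∎
    where
    open ≤-Reasoning
    Q = expSum b (suc k)
    q = expTerm b (suc (suc k))
    A = expSum (b - h) (suc (suc k))
    E = expSum B k
    τ = expTerm B (suc (suc k))
    -hq≤ : - (h * q) ≤ h * τ
    -hq≤ = ≤-trans (≤-reflexive (solve 2 (λ h q → :- (h :* q) := h :* (:- q)) refl h q))
      (monoˡ h≥0 (≤-trans (x≤∣x∣ (- q)) (≤-trans (≤-reflexive (ℚₚ.∣-p∣≡∣p∣ q)) (term-bound B≥0 hb (suc (suc k))))))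

  -- `euler-step` iterated i times from the value 1 at 0. Multiplication by 1 - h ≤ 1 does not
  -- enlarge earlier errors, so they just add up.
  euler : ∀ {h} → 0ℚ ≤ h → h ≤ 1ℚ → ∀ k i → fromℕ i * h ≤ B →
    (1ℚ - h) ^ i ≤ expSum (- (fromℕ i * h)) (suc (suc k)) + fromℕ i * (h * (expTerm B (suc (suc k)) + expSum B k * h))
  euler {h} h≥0 h≤1 k zero _ = ≤-reflexive (sym (trans (cong₂ _+_
      (trans (cong (λ z → expSum (- z) (suc (suc k))) (ℚₚ.*-zeroˡ h)) (expSum-0 (suc (suc k)))) (ℚₚ.*-zeroˡ err)) (ℚₚ.+-identityʳ 1ℚ)))
    where
    err = h * (expTerm B (suc (suc k)) + expSum B k * h)
    expTerm-0 : ∀ j → expTerm 0ℚ (suc j) ≡ 0ℚ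
    expTerm-0 j = trans (cong (_* inv j) (ℚₚ.*-zeroʳ (expTerm 0ℚ j))) (ℚₚ.*-zeroˡ (inv j))
    expSum-0 : ∀ j → expSum 0ℚ j ≡ 1ℚ
    expSum-0 zero    = refl
    expSum-0 (suc j) = trans (cong₂ _+_ (expSum-0 j) (expTerm-0 j)) (ℚₚ.+-identityʳ 1ℚ)
  euler {h} h≥0 h≤1 k (suc i) bound = begin
    (1ℚ - h) * (1ℚ - h) ^ i                       ≤⟨ monoˡ (diff-nonNeg h≤1) (euler h≥0 h≤1 k i ih≤B) ⟩
    (1ℚ - h) * (S b + c * err)                    ≡⟨ solve 4 (λ h s c e → (con 1ℚ :- h) :* (s :+ c :* e) := (con 1ℚ :- h) :* s :+ c :* e :- h :* (c :* e)) refl h (S b) c err ⟩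
    (1ℚ - h) * S b + c * err - h * (c * err)      ≤⟨ ≤-by (h * (c * err)) (*-nonNeg h≥0 (*-nonNeg (fromℕ-nonNeg i) err≥0)) (solve 2 (λ x y → x := x :- y :+ y) refl ((1ℚ - h) * S b + c * err) (h * (c * err))) ⟩
    (1ℚ - h) * S b + c * err                      ≤⟨ ℚₚ.+-monoˡ-≤ (c * err) (euler-step h≥0 (∣-∣≤B (suc i) b-h≡ bound) (∣-∣≤B i refl ih≤B) k) ⟩
    S (b - h) + err + c * err                     ≡⟨ solve 3 (λ s e c → s :+ e :+ c :* e := s :+ (c :+ con 1ℚ) :* e) refl (S (b - h)) err c ⟩
    S (b - h) + (c + 1ℚ) * err                    ≡⟨ cong₂ (λ u v → S u + v * err) b-h≡ (sym (fromℕ-suc i)) ⟩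
    S (- (fromℕ (suc i) * h)) + fromℕ (suc i) * err ∎
    where
    open ≤-Reasoning
    S : ℚ → ℚ
    S z = expSum z (suc (suc k))
    c b err : ℚ
    c = fromℕ i
    b = - (c * h)
    err = h * (expTerm B (suc (suc k)) + expSum B k * h)
    expSum-nonNeg : ∀ j → 0ℚ ≤ expSum B j
    expSum-nonNeg zero    = <⇒≤ 0<1
    expSum-nonNeg (suc j) = +-nonNeg (expSum-nonNeg j) (expTerm-nonNeg B≥0 (suc j))
    err≥0 : 0ℚ ≤ err
    err≥0 = *-nonNeg h≥0 (+-nonNeg (expTerm-nonNeg B≥0 (suc (suc k))) (*-nonNeg (expSum-nonNeg k) h≥0))
    b-h≡ : b - h ≡ - (fromℕ (suc i) * h)
    b-h≡ = trans (solve 2 (λ c h → :- (c :* h) :- h := :- ((c :+ con 1ℚ) :* h)) refl c h) (cong (λ s → - (s * h)) (sym (fromℕ-suc i)))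
    ih≤B : c * h ≤ B
    ih≤B = ≤-trans (monoʳ h≥0 (fromℕ-mono (ℕₚ.n≤1+n i))) bound
    ∣-∣≤B : ∀ j {z} → z ≡ - (fromℕ j * h) → fromℕ j * h ≤ B → ∣ z ∣ ≤ B
    ∣-∣≤B j refl jh≤B = subst (_≤ B) (trans (sym (ℚₚ.0≤p⇒∣p∣≡p (*-nonNeg (fromℕ-nonNeg j) h≥0))) (sym (ℚₚ.∣-p∣≡∣p∣ (fromℕ j * h)))) jh≤B

-- The truncated series alternates at negative arguments, so positivity of its terms gives no lower
-- bound. Euler's product (1 - z/m)ᵐ does: it is at least 4 to the power -Y, by Bernoulli on blocks
-- of factors, and its distance to the series vanishes as m and k grow.
exp-lower : ∀ y {ε} → 0ℚ < ε → let Y = suc y in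
  ∃[ K ] (∀ k z → K ℕ.≤ k → 0ℚ ≤ z → z ≤ fromℕ Y → ½ ^ (Y ℕ.* 2) ≤ expSum (- z) k + ε)
exp-lower y {ε} ε>0 = suc (suc N) , λ { (suc (suc k)) z (ℕ.s≤s (ℕ.s≤s N≤k)) z≥0 z≤Y → lower k z N≤k z≥0 z≤Y }
  where
  open ≤-Reasoning
  Y : ℕ
  Y = suc y
  B : ℚ
  B = fromℕ Y
  B>0 : 0ℚ < B
  B>0 = /-pos Y 1
  E-bound = bounded (expSum B) (expSum-cauchy Y)
  E : ℚ
  E = proj₁ E-bound
  E>0 : 0ℚ < E
  E>0 = proj₁ (proj₂ E-bound)
  ½ε>0 : 0ℚ < ½ * ε
  ½ε>0 = ½-pos ε>0
  BE-inv = reciprocal (B * E) (*-pos B>0 E>0)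
  i : ℚ
  i = proj₁ BE-inv
  unit : B * E * i ≡ 1ℚ
  unit = proj₂ (proj₂ BE-inv)
  i>0 : 0ℚ < i
  i>0 = proj₁ (proj₂ BE-inv)
  arch = archimedean (*-pos i>0 ε>0)
  s : ℕ
  s = proj₁ arch
  tail = expSum-cauchy Y (½ * ε * inv y) (*-pos ½ε>0 (/-pos 1 Y))
  N : ℕ
  N = proj₁ tail
  u : ℚ
  u = inv y * (½ * inv s)
  lower : ∀ k z → N ℕ.≤ k → 0ℚ ≤ z → z ≤ B → ½ ^ (Y ℕ.* 2) ≤ expSum (- z) (suc (suc k)) + ε
  lower k z N≤k z≥0 z≤B = begin
    ½ ^ (Y ℕ.* 2)                               ≤⟨ ^-monoˡ (inv-nonNeg 1) ½≤ (Y ℕ.* 2) ⟩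
    ((1ℚ - h) ^ suc s) ^ (Y ℕ.* 2)              ≡⟨ ^-*-assoc (1ℚ - h) (Y ℕ.* 2) (suc s) ⟨
    (1ℚ - h) ^ m                                ≤⟨ euler (<⇒≤ B>0) h≥0 h≤1 k m (≤-trans (≤-reflexive mh≡z) z≤B) ⟩
    expSum (- (fromℕ m * h)) (suc (suc k)) + fromℕ m * (h * (τ + F * h))
      ≡⟨ cong₂ (λ x e → expSum (- x) (suc (suc k)) + e) mh≡z (trans (sym (ℚₚ.*-assoc (fromℕ m) h (τ + F * h))) (cong (_* (τ + F * h)) mh≡z)) ⟩
    expSum (- z) (suc (suc k)) + z * (τ + F * h) ≤⟨ ℚₚ.+-monoʳ-≤ (expSum (- z) (suc (suc k))) error ⟩
    expSum (- z) (suc (suc k)) + ε              ∎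
    where
    m : ℕ
    -- The m factors form 2Y blocks of s + 1. Within a block (s + 1) h = z / (2Y) ≤ ½, so each block
    -- contributes at least ½; s is free to make h small against the error.
    m = Y ℕ.* 2 ℕ.* suc s
    h τ F : ℚ
    h = z * u
    τ = expTerm B (suc (suc k))
    F = expSum B k
    u≥0 : 0ℚ ≤ u
    u≥0 = *-nonNeg (inv-nonNeg y) (*-nonNeg (inv-nonNeg 1) (inv-nonNeg s))
    h≥0 : 0ℚ ≤ h
    h≥0 = *-nonNeg z≥0 u≥0
    By : B * inv y ≡ 1ℚ
    By = *-/-cancel (ℤ.+ 1) Y
    Ss : fromℕ (suc s) * inv s ≡ 1ℚ
    Ss = *-/-cancel (ℤ.+ 1) (suc s)
    h≤½s : h ≤ ½ * inv s
    h≤½s = ≤-trans (monoʳ u≥0 z≤B) (≤-reflexive (trans (sym (ℚₚ.*-assoc B (inv y) (½ * inv s))) (trans (cong (_* (½ * inv s)) By) (ℚₚ.*-identityˡ (½ * inv s)))))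
    h≤1 : h ≤ 1ℚ
    h≤1 = ≤-trans h≤½s (≤-trans (*-mono {½} {1ℚ} (inv-nonNeg s) (<⇒≤ 0<1) (1/-anti {0} {1} ℕ.z≤n) (1/-anti {0} {s} ℕ.z≤n)) (≤-reflexive (ℚₚ.*-identityˡ 1ℚ)))
    mh≡z : fromℕ m * h ≡ z
    mh≡z = trans (cong (_* h) (trans (fromℕ-* (Y ℕ.* 2) (suc s)) (cong (_* fromℕ (suc s)) (fromℕ-* Y 2))))
      (trans (solve 5 (λ b n z y s → b :* con (fromℕ 2) :* n :* (z :* (y :* (con ½ :* s))) := z :* ((b :* y) :* (n :* s))) refl B (fromℕ (suc s)) z (inv y) (inv s))
      (trans (cong₂ (λ a b → z * (a * b)) By Ss) (ℚₚ.*-identityʳ z)))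
    ½≤ : ½ ≤ (1ℚ - h) ^ suc s
    ½≤ = ≤-trans (≤-by (½ - fromℕ (suc s) * h) (diff-nonNeg sh≤½) (solve 1 (λ x → con 1ℚ :- x := con ½ :+ (con ½ :- x)) refl (fromℕ (suc s) * h))) (bernoulli⁻ h≥0 h≤1 (suc s))
      where
      sh≤½ : fromℕ (suc s) * h ≤ ½
      sh≤½ = ≤-trans (monoˡ (fromℕ-nonNeg (suc s)) h≤½s) (≤-reflexive (trans (solve 2 (λ n s → n :* (con ½ :* s) := con ½ :* (n :* s)) refl (fromℕ (suc s)) (inv s)) (cong (½ *_) Ss)))
    τ≤ : τ ≤ ½ * ε * inv y
    τ≤ = ≤-trans (≤-trans (x≤∣x∣ τ) (≤-reflexive (cong ∣_∣ (solve 2 (λ a t → t := a :+ t :- a) refl (expSum B (suc k)) τ))))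
      (proj₂ tail (suc (suc k)) (suc k) (ℕₚ.m≤n⇒m≤1+n (ℕₚ.m≤n⇒m≤1+n N≤k)) (ℕₚ.m≤n⇒m≤1+n N≤k))
    error : z * (τ + F * h) ≤ ε
    error = begin
      z * (τ + F * h)                           ≤⟨ monoˡ z≥0 (+-mono-≤ τ≤ (*-mono h≥0 (<⇒≤ E>0) (≤-trans (x≤∣x∣ F) (proj₂ (proj₂ E-bound) k)) h≤½s)) ⟩
      z * (½ * ε * inv y + E * (½ * inv s))     ≤⟨ *-mono (+-nonNeg (*-nonNeg (<⇒≤ ½ε>0) (inv-nonNeg y)) (*-nonNeg (<⇒≤ E>0) (*-nonNeg (inv-nonNeg 1) (inv-nonNeg s)))) (<⇒≤ B>0) z≤B
                                                     (ℚₚ.+-monoʳ-≤ (½ * ε * inv y) (monoˡ (<⇒≤ E>0) (monoˡ (inv-nonNeg 1) (proj₂ arch)))) ⟩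
      B * (½ * ε * inv y + E * (½ * (i * ε)))   ≡⟨ solve 5 (λ B e y E i → B :* (con ½ :* e :* y :+ E :* (con ½ :* (i :* e))) := con ½ :* e :* (B :* y) :+ con ½ :* e :* (B :* E :* i)) refl B ε (inv y) E i ⟩
      ½ * ε * (B * inv y) + ½ * ε * (B * E * i) ≡⟨ cong₂ (λ p q → ½ * ε * p + ½ * ε * q) By unit ⟩
      ½ * ε * 1ℚ + ½ * ε * 1ℚ                   ≡⟨ solve 1 (λ e → con ½ :* e :* con 1ℚ :+ con ½ :* e :* con 1ℚ := e) refl ε ⟩
      ε                                         ∎

-- The comparison over the reals

-- (2/3)⁴ = 16/81 is below 8/9, so 2/3 of r (k + 1) lies below the rounded-down root plus 1.
-- Lowering 2/3 to 1/2 absorbs that 1 as soon as r (k + 1) ≥ 6.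
rootNum-half : ∀ r n k → 1 ℕ.≤ r → r ℕ.^ 4 ℕ.≤ n → 5 ℕ.≤ k → r ℕ.* suc k ℕ.≤ 2 ℕ.* rootNum (8 ℕ.* n) 9 k
rootNum-half r n k 1≤r r⁴≤n 5≤k = ℕₚ.*-cancelˡ-≤ 3 (ℕₚ.+-cancelʳ-≤ 6 (3 ℕ.* (r ℕ.* K)) (3 ℕ.* (2 ℕ.* u)) (begin
  3 ℕ.* (r ℕ.* K) ℕ.+ 6                  ≤⟨ ℕₚ.+-monoʳ-≤ (3 ℕ.* (r ℕ.* K)) (ℕₚ.*-mono-≤ 1≤r (ℕ.s≤s 5≤k)) ⟩
  3 ℕ.* (r ℕ.* K) ℕ.+ r ℕ.* K            ≡⟨ ℕsolve 1 (λ x → conℕ 3 :*ℕ x :+ℕ x :=ℕ conℕ 2 :*ℕ (conℕ 2 :*ℕ x)) refl (r ℕ.* K) ⟩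
  2 ℕ.* (2 ℕ.* (r ℕ.* K))                ≤⟨ ℕₚ.*-monoʳ-≤ 2 2rK≤3u ⟩
  2 ℕ.* (3 ℕ.* suc u)                    ≡⟨ ℕsolve 1 (λ u → conℕ 2 :*ℕ (conℕ 3 :*ℕ (conℕ 1 :+ℕ u)) :=ℕ conℕ 3 :*ℕ (conℕ 2 :*ℕ u) :+ℕ conℕ 6) refl u ⟩
  3 ℕ.* (2 ℕ.* u) ℕ.+ 6                  ∎))
  where
  open ℕₚ.≤-Reasoning
  K u : ℕ
  K = suc k
  u = rootNum (8 ℕ.* n) 9 k
  2rK≤3u : 2 ℕ.* (r ℕ.* K) ℕ.≤ 3 ℕ.* suc u
  2rK≤3u = ℕₚ.≮⇒≥ λ 3u<2rK → ℕₚ.<-irrefl refl (begin-strict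
    648 ℕ.* (n ℕ.* K ℕ.^ 4)                ≡⟨ ℕsolve 2 (λ n k → conℕ 648 :*ℕ (n :*ℕ k) :=ℕ conℕ 81 :*ℕ (conℕ 8 :*ℕ n :*ℕ k)) refl n (K ℕ.^ 4) ⟩
    81 ℕ.* (8 ℕ.* n ℕ.* K ℕ.^ 4)           <⟨ ℕₚ.*-monoʳ-< 81 (rootNum-upper (8 ℕ.* n) 9 k) ⟩
    81 ℕ.* (suc u ℕ.^ 4 ℕ.* 9)             ≡⟨ ℕsolve 1 (λ v → conℕ 81 :*ℕ (v :^ℕ 4 :*ℕ conℕ 9) :=ℕ conℕ 9 :*ℕ (conℕ 3 :*ℕ v) :^ℕ 4) refl (suc u) ⟩
    9 ℕ.* (3 ℕ.* suc u) ℕ.^ 4              ≤⟨ ℕₚ.*-monoʳ-≤ 9 (ℕₚ.^-monoˡ-≤ 4 (ℕₚ.<⇒≤ 3u<2rK)) ⟩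
    9 ℕ.* (2 ℕ.* (r ℕ.* K)) ℕ.^ 4          ≡⟨ ℕsolve 2 (λ r k → conℕ 9 :*ℕ (conℕ 2 :*ℕ (r :*ℕ k)) :^ℕ 4 :=ℕ conℕ 144 :*ℕ (r :^ℕ 4 :*ℕ k :^ℕ 4)) refl r K ⟩
    144 ℕ.* (r ℕ.^ 4 ℕ.* K ℕ.^ 4)          ≤⟨ ℕₚ.*-monoʳ-≤ 144 (ℕₚ.*-monoˡ-≤ (K ℕ.^ 4) r⁴≤n) ⟩
    144 ℕ.* (n ℕ.* K ℕ.^ 4)                ≤⟨ ℕₚ.*-monoˡ-≤ (n ℕ.* K ℕ.^ 4) (ℕₚ.m≤m+n 144 504) ⟩
    648 ℕ.* (n ℕ.* K ℕ.^ 4)                ∎)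

root-lower : ∀ r n k → 1 ℕ.≤ r → r ℕ.^ 4 ℕ.≤ n → 5 ℕ.≤ k → fromℕ r * ½ ≤ rootSeq (8 ℕ.* n) 9 k
root-lower r n k 1≤r r⁴≤n 5≤k = *-cancelˡ-≤ {fromℕ K} (/-pos K 1) (begin
  fromℕ K * (fromℕ r * ½)             ≡⟨ solve 2 (λ k r → k :* (r :* con ½) := con ½ :* (r :* k)) refl (fromℕ K) (fromℕ r) ⟩
  ½ * (fromℕ r * fromℕ K)             ≡⟨ cong (½ *_) (fromℕ-* r K) ⟨
  ½ * fromℕ (r ℕ.* K)                 ≤⟨ monoˡ (inv-nonNeg 1) (fromℕ-mono (rootNum-half r n k 1≤r r⁴≤n 5≤k)) ⟩
  ½ * fromℕ (2 ℕ.* u)                 ≡⟨ trans (cong (½ *_) (fromℕ-* 2 u)) (solve 1 (λ u → con ½ :* (con (fromℕ 2) :* u) := u) refl (fromℕ u)) ⟩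
  fromℕ u                             ≡⟨ *-/-cancel (ℤ.+ u) K ⟨
  fromℕ K * rootSeq (8 ℕ.* n) 9 k     ∎)
  where
  open ≤-Reasoning
  K u : ℕ
  K = suc k
  u = rootNum (8 ℕ.* n) 9 k

≤ℝ-eventually : ∀ x y N → (∀ k → N ℕ.≤ k → seq x k ≤ seq y k) → x ≤ℝ y
≤ℝ-eventually x y N h (ε , ε>0 , N′ , y+ε≤x) = ℚₚ.<-irrefl refl (begin-strict
  seq y k        ≡⟨ ℚₚ.+-identityʳ (seq y k) ⟨
  seq y k + 0ℚ   <⟨ ℚₚ.+-monoʳ-< (seq y k) ε>0 ⟩
  seq y k + ε    ≤⟨ y+ε≤x k (ℕₚ.m≤n⊔m N N′) ⟩
  seq x k        ≤⟨ h k (ℕₚ.m≤m⊔n N N′) ⟩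
  seq y k        ∎)
  where
  open ≤-Reasoning
  k = N ℕ.⊔ N′

-- The sequence of `recip` is shifted, so its entry k inverts a later entry m of x; lower bounds on
-- x valid from some index on still apply at m.
recip-inverse : ∀ x (x>0 : fromℚ 0ℚ <ℝ x) k → ∃[ m ] k ℕ.≤ m × seq x m * seq (recip x x>0) k ≡ 1ℚ
recip-inverse x x>0@(ε , ε>0 , N , h) k = N ℕ.+ k , ℕₚ.m≤n+m k N , ℚₚ.*-inverseʳ (seq x (N ℕ.+ k)) {{ℚ.>-nonZero x>0′}}
  where
  x>0′ : 0ℚ < seq x (N ℕ.+ k)
  x>0′ = ℚₚ.<-≤-trans ε>0 (subst (_≤ seq x (N ℕ.+ k)) (ℚₚ.+-identityˡ ε) (h (N ℕ.+ k) (ℕₚ.m≤m+n N k)))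

-- The 8 collects three factors 2: the labels are below (l + 1) (r + 1) ≤ 2 (l + 1) r, the scale is
-- at least r/2, and (8/9)^{1/4} ≥ 1/2.
Ŵ-low : ∀ n .{{_ : NonZero n}} U l y K → let r = ⌊⁴√ n ⌋ in
  (∀ k → K ℕ.≤ k → fromℕ (8 ℕ.* suc l) ≤ seq y k) →
  low (ℤ.+ (l ℕ.* suc r ℕ.+ suc r)) U ≡ true → ∀ τ → Ŵ n U τ ≤ℝ ⁴√ 8 9 *ℝ y
Ŵ-low n U l y K y≥ U-low τ = ≤ℝ-eventually (Ŵ n U τ) (⁴√ 8 9 *ℝ y) (5 ℕ.⊔ K) λ k h → bound k (ℕₚ.≤-trans (ℕₚ.m≤m⊔n 5 K) h) (ℕₚ.≤-trans (ℕₚ.m≤n⊔m 5 K) h)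
  where
  open ≤-Reasoning
  r j : ℕ
  r = ⌊⁴√ n ⌋
  j = l ℕ.* suc r ℕ.+ suc r
  v : ℤ
  v = V U (Time.step τ)
  1≤r : 1 ℕ.≤ r
  1≤r with r in eq
  ... | zero  = contradiction (subst (λ s → n ℕ.< suc s ℕ.^ 4) eq (⌊⁴√⌋-upper n)) (ℕₚ.≤⇒≯ (ℕ.>-nonZero⁻¹ n))
  ... | suc _ = ℕ.s≤s ℕ.z≤n
  v≤j : v / 1 ≤ fromℕ j
  v≤j = /-mono v (ℤ.+ j) 1 1 (ℤₚ.*-monoʳ-≤-nonNeg (ℤ.+ 1) (ℤₚ.<⇒≤ (V-low (ℤ.+ j) U U-low (Time.step τ))))
  j≤ : j ℕ.≤ 2 ℕ.* (suc l ℕ.* r)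
  j≤ = ℕₚ.≤-trans (ℕₚ.≤-reflexive (ℕₚ.+-comm (l ℕ.* suc r) (suc r)))
    (ℕₚ.≤-trans (ℕₚ.*-monoʳ-≤ (suc l) (ℕₚ.+-monoˡ-≤ r 1≤r)) (ℕₚ.≤-reflexive (ℕsolve 2 (λ w r → w :*ℕ (r :+ℕ r) :=ℕ conℕ 2 :*ℕ (w :*ℕ r)) refl (suc l) r)))
  bound : ∀ k → 5 ℕ.≤ k → K ℕ.≤ k → seq (Ŵ n U τ) k ≤ seq (⁴√ 8 9 *ℝ y) k
  bound k 5≤k K≤k = begin
    v / 1 * s                        ≤⟨ monoʳ s≥0 (≤-trans v≤j (fromℕ-mono j≤)) ⟩
    fromℕ (2 ℕ.* (suc l ℕ.* r)) * s  ≡⟨ cong (_* s) (trans (fromℕ-* 2 (suc l ℕ.* r)) (cong (fromℕ 2 *_) (fromℕ-* (suc l) r))) ⟩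
    fromℕ 2 * (fromℕ (suc l) * fromℕ r) * s
      ≡⟨ solve 3 (λ l r s → con (fromℕ 2) :* (l :* r) :* s := con (fromℕ 1) :* con ½ :* (con (fromℕ 8) :* l) :* (r :* con ½) :* s) refl (fromℕ (suc l)) (fromℕ r) s ⟩
    fromℕ 1 * ½ * (fromℕ 8 * fromℕ (suc l)) * (fromℕ r * ½) * s
      ≡⟨ cong (λ w → fromℕ 1 * ½ * w * (fromℕ r * ½) * s) (fromℕ-* 8 (suc l)) ⟨
    fromℕ 1 * ½ * fromℕ (8 ℕ.* suc l) * (fromℕ r * ½) * s
      ≤⟨ monoʳ {p = fromℕ 1 * ½ * fromℕ (8 ℕ.* suc l) * (fromℕ r * ½)} s≥0 (*-mono (*-nonNeg (fromℕ-nonNeg r) (inv-nonNeg 1)) cy≥0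
          (*-mono {p = fromℕ 1 * ½} (fromℕ-nonNeg (8 ℕ.* suc l)) c≥0 c≥ (y≥ k K≤k))
          (root-lower r n m 1≤r (⌊⁴√⌋-lower n) (ℕₚ.≤-trans 5≤k k≤m))) ⟩
    c * seq y k * S m * s            ≡⟨ trans (ℚₚ.*-assoc (c * seq y k) (S m) s) (trans (cong (c * seq y k *_) unit) (ℚₚ.*-identityʳ (c * seq y k))) ⟩
    c * seq y k                      ∎
    where
    S : ℕ → ℚ
    S = rootSeq (8 ℕ.* n) 9
    inverse = recip-inverse (scale n) (scale-pos n) k
    m : ℕ
    m = proj₁ inverse
    k≤m : k ℕ.≤ m
    k≤m = proj₁ (proj₂ inverse)
    s c : ℚ
    s = seq (recip (scale n) (scale-pos n)) k
    c = rootSeq 8 9 k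
    unit : S m * s ≡ 1ℚ
    unit = proj₂ (proj₂ inverse)
    s≥0 : 0ℚ ≤ s
    s≥0 = recip-nonNeg (scale n) (scale-pos n) k
    c≥ : fromℕ 1 * ½ ≤ c
    -- (8/9)^{1/4} is `scale 1`, so the same bound applies.
    c≥ = root-lower 1 1 k ℕₚ.≤-refl ℕₚ.≤-refl 5≤k
    c≥0 : 0ℚ ≤ c
    c≥0 = ≤-trans (*-nonNeg (fromℕ-nonNeg 1) (inv-nonNeg 1)) c≥
    cy≥0 : 0ℚ ≤ c * seq y k
    cy≥0 = *-nonNeg c≥0 (≤-trans (fromℕ-nonNeg (8 ℕ.* suc l)) (y≥ k K≤k))

bracket : ∀ b q → 0ℚ ≤ q → q ≤ fromℕ (8 ℕ.* b) → ∃[ w ] fromℕ (8 ℕ.* w) ≤ q × q ≤ fromℕ (8 ℕ.* suc w)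
bracket zero    q q≥0 q≤ = 0 , q≥0 , ≤-trans q≤ (fromℕ-nonNeg 8)
bracket (suc b) q q≥0 q≤ with ℚₚ.≤-total q (fromℕ (8 ℕ.* b))
... | inj₁ q≤8b = bracket b q q≥0 q≤8b
... | inj₂ 8b≤q = b , 8b≤q , q≤

-- The floor of a Cauchy real is not computable, so one rational q = y_K - 1 is bracketed instead,
-- and q ≤ y_k ≤ q + 2 for k ≥ K. With 8w ≤ q ≤ 8 (w + 1) and l = w - 1 this gives the bounds 8 (l +
-- 1) and 8 (l + 2) + 2. In the threshold, 1 pays for the shift to q and 8 for the upper end of the
-- bracket.
eventual-bracket : ∀ L y → fromℚ (fromℕ (9 ℕ.+ 8 ℕ.* suc L)) <ℝ y →
  ∃[ l ] ∃[ K ] L ℕ.≤ l × (∀ k → K ℕ.≤ k → fromℕ (8 ℕ.* suc l) ≤ seq y k × seq y k ≤ fromℕ (18 ℕ.+ 8 ℕ.* l))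
eventual-bracket L y (ε , ε>0 , N , h) = locate (bracket b q q≥0 q≤8b)
  where
  open ≤-Reasoning
  N′ K b : ℕ
  N′ = proj₁ (cauchy y 1ℚ 0<1)
  K = N ℕ.⊔ N′
  q : ℚ
  q = seq y K - 1ℚ
  near : ∀ k → K ℕ.≤ k → ∣ seq y k - seq y K ∣ ≤ 1ℚ
  near k K≤k = proj₂ (cauchy y 1ℚ 0<1) k K (ℕₚ.≤-trans (ℕₚ.m≤n⊔m N N′) K≤k) (ℕₚ.m≤n⊔m N N′)
  8L≤q : fromℕ (8 ℕ.+ 8 ℕ.* suc L) ≤ q
  8L≤q = begin
    fromℕ (8 ℕ.+ 8 ℕ.* suc L)                 ≡⟨ solve 1 (λ x → x := x :+ con 1ℚ :- con 1ℚ) refl (fromℕ (8 ℕ.+ 8 ℕ.* suc L)) ⟩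
    fromℕ (8 ℕ.+ 8 ℕ.* suc L) + 1ℚ - 1ℚ       ≡⟨ cong (_- 1ℚ) (fromℕ-suc (8 ℕ.+ 8 ℕ.* suc L)) ⟨
    fromℕ (9 ℕ.+ 8 ℕ.* suc L) - 1ℚ            ≤⟨ ℚₚ.+-monoˡ-≤ (- 1ℚ) (≤-trans (p≤p+q {fromℕ (9 ℕ.+ 8 ℕ.* suc L)} (<⇒≤ ε>0)) (h K (ℕₚ.m≤m⊔n N N′))) ⟩
    q                                         ∎
  q≥0 : 0ℚ ≤ q
  q≥0 = ≤-trans (fromℕ-nonNeg (8 ℕ.+ 8 ℕ.* suc L)) 8L≤q
  b = proj₁ (ℕ-bound q q≥0)
  q≤8b : q ≤ fromℕ (8 ℕ.* b)
  q≤8b = ≤-trans (proj₂ (ℕ-bound q q≥0)) (fromℕ-mono (ℕₚ.m≤n*m b 8))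
  q≤y : ∀ k → K ℕ.≤ k → q ≤ seq y k
  q≤y k K≤k = begin
    q                                         ≡⟨ solve 2 (λ a b → a :- con 1ℚ := b :+ (a :- b) :- con 1ℚ) refl (seq y K) (seq y k) ⟩
    seq y k + (seq y K - seq y k) - 1ℚ        ≤⟨ ℚₚ.+-monoˡ-≤ (- 1ℚ) (ℚₚ.+-monoʳ-≤ (seq y k) (≤-trans (x≤∣x∣ _) (≤-trans (≤-reflexive (∣-∣-sym (seq y K) (seq y k))) (near k K≤k)))) ⟩
    seq y k + 1ℚ - 1ℚ                         ≡⟨ solve 1 (λ a → a :+ con 1ℚ :- con 1ℚ := a) refl (seq y k) ⟩
    seq y k                                   ∎
  y≤q+2 : ∀ k → K ℕ.≤ k → seq y k ≤ q + fromℕ 2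
  y≤q+2 k K≤k = begin
    seq y k                                   ≡⟨ solve 2 (λ a b → b := a :+ (b :- a)) refl (seq y K) (seq y k) ⟩
    seq y K + (seq y k - seq y K)             ≤⟨ ℚₚ.+-monoʳ-≤ (seq y K) (≤-trans (x≤∣x∣ _) (near k K≤k)) ⟩
    seq y K + 1ℚ                              ≡⟨ solve 1 (λ a → a :+ con 1ℚ := a :- con 1ℚ :+ con (fromℕ 2)) refl (seq y K) ⟩
    q + fromℕ 2                               ∎
  L<w : ∀ w → q ≤ fromℕ (8 ℕ.* suc w) → L ℕ.< w
  L<w w q≤ = ℕₚ.≤-pred (ℕₚ.*-cancelˡ-≤ 8 (fromℕ-cancel-≤ {8 ℕ.* suc (suc L)} {8 ℕ.* suc w}
    (≤-trans (≤-trans (≤-reflexive (cong fromℕ (ℕₚ.*-suc 8 (suc L)))) 8L≤q) q≤)))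
  locate : ∃[ w ] fromℕ (8 ℕ.* w) ≤ q × q ≤ fromℕ (8 ℕ.* suc w) →
    ∃[ l ] ∃[ K ] L ℕ.≤ l × (∀ k → K ℕ.≤ k → fromℕ (8 ℕ.* suc l) ≤ seq y k × seq y k ≤ fromℕ (18 ℕ.+ 8 ℕ.* l))
  locate (zero  , _    , q≤8w+8) = contradiction (L<w 0 q≤8w+8) λ ()
  locate (suc l , 8w≤q , q≤8w+8) = l , K , ℕₚ.≤-pred (L<w (suc l) q≤8w+8) , λ k K≤k → ≤-trans 8w≤q (q≤y k K≤k) , (begin
    seq y k                                   ≤⟨ y≤q+2 k K≤k ⟩
    q + fromℕ 2                               ≤⟨ ℚₚ.+-monoˡ-≤ (fromℕ 2) q≤8w+8 ⟩
    fromℕ (8 ℕ.* suc (suc l)) + fromℕ 2       ≡⟨ fromℕ-+ (8 ℕ.* suc (suc l)) 2 ⟨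
    fromℕ (8 ℕ.* suc (suc l) ℕ.+ 2)           ≡⟨ cong fromℕ (ℕsolve 1 (λ l → conℕ 8 :*ℕ (conℕ 2 :+ℕ l) :+ℕ conℕ 2 :=ℕ conℕ 18 :+ℕ conℕ 8 :*ℕ l) refl l) ⟩
    fromℕ (18 ℕ.+ 8 ℕ.* l)                    ∎)

-- Per unit of l the left side decays by 1 + κ and the right side by 2¹⁶, so any
-- larger power of 2 would do for 1 + κ.
hit-small : ∀ κ → suc κ ≡ 2 ℕ.^ 18 → ∀ l n r → 20 ℕ.+ 16 ℕ.* κ ℕ.^ 4 ℕ.≤ l → n ℕ.≤ suc r ℕ.^ 4 →
  hit n (l ℕ.* suc r ℕ.+ suc r) ≤ ½ ^ ((18 ℕ.+ 8 ℕ.* l) ℕ.* 2)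
hit-small κ κ≡ l n r L≤l n≤N = begin
  H                                        ≡⟨ trans (sym (ℚₚ.*-identityʳ H)) (cong (H *_) (trans (sym (1^ Y)) (^-distribʳ-* (fromℕ 2) ½ Y))) ⟩
  H * (fromℕ 2 ^ Y * ½ ^ Y)                ≡⟨ ℚₚ.*-assoc H (fromℕ 2 ^ Y) (½ ^ Y) ⟨
  H * fromℕ 2 ^ Y * ½ ^ Y                  ≤⟨ monoʳ (^-nonNeg (inv-nonNeg 1) Y) H2ʸ≤1 ⟩
  1ℚ * ½ ^ Y                               ≡⟨ ℚₚ.*-identityˡ (½ ^ Y) ⟩
  ½ ^ Y                                    ∎
  where
  open ≤-Reasoning
  Y C D e : ℕ
  Y = (18 ℕ.+ 8 ℕ.* l) ℕ.* 2
  C = 16 ℕ.* (2 ℕ.* κ ℕ.^ 4)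
  D = 3 ℕ.+ C
  e = l ∸ (20 ℕ.+ 16 ℕ.* κ ℕ.^ 4)
  H : ℚ
  H = hit n (l ℕ.* suc r ℕ.+ suc r)
  1≤2 : 1ℚ ≤ fromℕ 2
  1≤2 = fromℕ-mono {1} {2} (ℕ.s≤s ℕ.z≤n)
  -- A gain of 18 l binary digits against the required 2 (18 + 8l) leaves 2l - 36. It must cover 3
  -- digits for the factor 8 and 32 κ⁴ for the cost `C`: hence l ≥ 20 + 16 κ⁴, with 1 + 2e to spare.
  budget : l ℕ.* 18 ≡ Y ℕ.+ D ℕ.+ (1 ℕ.+ 2 ℕ.* e)
  budget = trans (cong (ℕ._* 18) (sym l≡)) (trans
    (ℕsolve 2 (λ e c → let l = conℕ 20 :+ℕ conℕ 16 :*ℕ c :+ℕ e in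
      l :*ℕ conℕ 18 :=ℕ (conℕ 18 :+ℕ conℕ 8 :*ℕ l) :*ℕ conℕ 2 :+ℕ (conℕ 3 :+ℕ conℕ 16 :*ℕ (conℕ 2 :*ℕ c)) :+ℕ (conℕ 1 :+ℕ conℕ 2 :*ℕ e)) refl e (κ ℕ.^ 4))
    (cong (λ l → (18 ℕ.+ 8 ℕ.* l) ℕ.* 2 ℕ.+ D ℕ.+ (1 ℕ.+ 2 ℕ.* e)) l≡))
    where
    l≡ : 20 ℕ.+ 16 ℕ.* κ ℕ.^ 4 ℕ.+ e ≡ l
    l≡ = ℕₚ.m+[n∸m]≡n L≤l
  H2ʸ≤1 : H * fromℕ 2 ^ Y ≤ 1ℚ
  H2ʸ≤1 = *-cancelˡ-≤ (^-pos (/-pos 2 1) D) (begin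
    fromℕ 2 ^ D * (H * fromℕ 2 ^ Y)           ≡⟨ solve 3 (λ d h y → d :* (h :* y) := h :* (y :* d)) refl (fromℕ 2 ^ D) H (fromℕ 2 ^ Y) ⟩
    H * (fromℕ 2 ^ Y * fromℕ 2 ^ D)           ≡⟨ cong (H *_) (^-distribˡ-+ (fromℕ 2) Y D) ⟨
    H * fromℕ 2 ^ (Y ℕ.+ D)                   ≤⟨ monoˡ (hit-nonNeg n (l ℕ.* suc r ℕ.+ suc r)) (^-monoʳ 1≤2 (ℕₚ.m≤m+n (Y ℕ.+ D) (1 ℕ.+ 2 ℕ.* e))) ⟩
    H * fromℕ 2 ^ (Y ℕ.+ D ℕ.+ (1 ℕ.+ 2 ℕ.* e)) ≡⟨ cong (λ m → H * fromℕ 2 ^ m) budget ⟨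
    H * fromℕ 2 ^ (l ℕ.* 18)                  ≡⟨ cong (H *_) (trans (^-*-assoc (fromℕ 2) l 18) (cong (_^ l) (trans (sym (fromℕ-^ 2 18)) (cong fromℕ (sym κ≡))))) ⟩
    H * fromℕ (suc κ) ^ l                     ≤⟨ hit-tail κ l n r n≤N ⟩
    fromℕ 8 * fromℕ 2 ^ C                     ≡⟨ solve 1 (λ x → con (fromℕ 8) :* x := con (fromℕ 2) :* (con (fromℕ 2) :* (con (fromℕ 2) :* x)) :* con 1ℚ) refl (fromℕ 2 ^ C) ⟩
    fromℕ 2 ^ D * 1ℚ                          ∎)

module _ (n : ℕ) .{{_ : NonZero n}} (y : ℝ) (l K : ℕ)
  (y-bracket : ∀ k → K ℕ.≤ k → fromℕ (8 ℕ.* suc l) ≤ seq y k × seq y k ≤ fromℕ (18 ℕ.+ 8 ℕ.* l)) where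

  private
    r j : ℕ
    r = ⌊⁴√ n ⌋
    j = l ℕ.* suc r ℕ.+ suc r

  -- If `low` held, (8/9)^{1/4} y would bound `Ŵ` at every time and hence, by leastness, the
  -- supremum; no maximising time is needed.
  Sup>⇒high : ∀ U → Sup Ŵ n U > (⁴√ 8 9 *ℝ y) → low (ℤ.+ j) U ≡ false
  Sup>⇒high U (M , (_ , least) , a<M) = ¬-not λ U-low →
    least (⁴√ 8 9 *ℝ y) (Ŵ-low n U l y K (λ k K≤k → proj₁ (y-bracket k K≤k)) U-low) a<M

  ℙ≤exp : hit n j ≤ ½ ^ ((18 ℕ.+ 8 ℕ.* l) ℕ.* 2) → ℙ[ n ∣ (λ U → Sup Ŵ n U > (⁴√ 8 9 *ℝ y)) ]≤ exp (-ℝ y)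
  ℙ≤exp small A A⇒E (ε , ε>0 , N , h) = ℚₚ.<-irrefl refl (begin-strict
    S + ½ * ε                         <⟨ ℚₚ.+-monoʳ-< S ½ε<ε ⟩
    S + ε                             ≤⟨ h k (ℕₚ.m≤m⊔n N (K ℕ.⊔ K′)) ⟩
    prob n A                          ≤⟨ prob≤hit n j A (λ U isLT AU → Sup>⇒high U (A⇒E U isLT AU)) ⟩
    hit n j                           ≤⟨ small ⟩
    ½ ^ ((18 ℕ.+ 8 ℕ.* l) ℕ.* 2)      ≤⟨ proj₂ (exp-lower (17 ℕ.+ 8 ℕ.* l) (½-pos ε>0)) k (seq y k) K′≤k
                                          (≤-trans (fromℕ-nonNeg (8 ℕ.* suc l)) (proj₁ (y-bracket k K≤k))) (proj₂ (y-bracket k K≤k)) ⟩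
    S + ½ * ε                         ∎)
    where
    open ≤-Reasoning
    K′ k : ℕ
    K′ = proj₁ (exp-lower (17 ℕ.+ 8 ℕ.* l) (½-pos ε>0))
    k = N ℕ.⊔ (K ℕ.⊔ K′)
    S : ℚ
    S = expSum (- seq y k) k
    K≤k : K ℕ.≤ k
    K≤k = ℕₚ.≤-trans (ℕₚ.m≤m⊔n K K′) (ℕₚ.m≤n⊔m N (K ℕ.⊔ K′))
    K′≤k : K′ ℕ.≤ k
    K′≤k = ℕₚ.≤-trans (ℕₚ.m≤n⊔m K K′) (ℕₚ.m≤n⊔m N (K ℕ.⊔ K′))
    ½ε<ε : ½ * ε < ε
    ½ε<ε = subst₂ _<_ (ℚₚ.+-identityʳ (½ * ε)) (½+½ ε) (ℚₚ.+-monoʳ-< (½ * ε) (½-pos ε>0))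

tail-bound : ∀ κ → suc κ ≡ 2 ℕ.^ 18 → ∀ y → fromℚ (fromℕ (9 ℕ.+ 8 ℕ.* suc (20 ℕ.+ 16 ℕ.* κ ℕ.^ 4))) <ℝ y →
  ∀ n .{{_ : NonZero n}} → ℙ[ n ∣ (λ U → Sup Ŵ n U > (⁴√ 8 9 *ℝ y)) ]≤ exp (-ℝ y)
tail-bound κ κ≡ y y₀<y n = conclude (eventual-bracket L y y₀<y)
  where
  L : ℕ
  L = 20 ℕ.+ 16 ℕ.* κ ℕ.^ 4
  conclude : ∃[ l ] ∃[ K ] L ℕ.≤ l × (∀ k → K ℕ.≤ k → fromℕ (8 ℕ.* suc l) ≤ seq y k × seq y k ≤ fromℕ (18 ℕ.+ 8 ℕ.* l)) →
    ℙ[ n ∣ (λ U → Sup Ŵ n U > (⁴√ 8 9 *ℝ y)) ]≤ exp (-ℝ y)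
  conclude (l , K , L≤l , y-bracket) = ℙ≤exp n y l K y-bracket (hit-small κ κ≡ l n ⌊⁴√ n ⌋ L≤l (ℕₚ.<⇒≤ (⌊⁴√⌋-upper n)))

proposition4 : ∃[ y₀ ] fromℚ 0ℚ <ℝ y₀ ×
    (∀ (y : ℝ) → y₀ <ℝ y → ∀ (n : ℕ) .{{_ : NonZero n}} →
    ℙ[ n ∣ (λ U → Sup Ŵ n U > (⁴√ 8 9 *ℝ y)) ]≤ exp (-ℝ y))
proposition4 = conclude (ℕ.pred (2 ℕ.^ 18)) refl
  where
  -- κ is kept a variable, since y₀ involves κ⁴ and should not be evaluated.
  conclude : ∀ κ → suc κ ≡ 2 ℕ.^ 18 → ∃[ y₀ ] fromℚ 0ℚ <ℝ y₀ ×
    (∀ (y : ℝ) → y₀ <ℝ y → ∀ (n : ℕ) .{{_ : NonZero n}} →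
    ℙ[ n ∣ (λ U → Sup Ŵ n U > (⁴√ 8 9 *ℝ y)) ]≤ exp (-ℝ y))
  conclude κ κ≡ = fromℚ (fromℕ y₀) , (1ℚ , 0<1 , 0 , λ _ _ → fromℕ-mono {1} {y₀} (ℕ.s≤s ℕ.z≤n)) , tail-bound κ κ≡
    where y₀ = 9 ℕ.+ 8 ℕ.* suc (20 ℕ.+ 16 ℕ.* κ ℕ.^ 4)
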